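{- Let $d\ge1$ and let $T=T(z)$ be the formal power series with $T(0)=1$ and $T=1+zT^{2d}$. Let $X=X(z)$ denote any of the $2d-1$ small solutions of the characteristic equation $1=zT^{2d-1}\sum_{\ell=1}^{d}(X^{2\ell-1}+X^{ -2\ell+1})$. Then the recurrence relation $$T_j=1+z\prod_{\ell=1}^{d}\big(T_{j+2\ell-1}\,T_{j-2\ell+1}\big),\qquad j\in\mathbb{Z},$$ admits the solution with free parameter $\lambda$ $$T_j=T\cdot\frac{(1-\lambda X^{d+1+j})(1-\lambda X^{3d+4+j})}{(1-\lambda X^{d+3+j})(1-\lambda X^{3d+2+j})},\qquad j\in\mathbb{Z}.$$ Here $\lambda$ is any element, independent of $j$, of the field of Puiseux series in $z$ such that $1-\lambda X^k\ne0$ for all $k\in\mathbb{Z}$.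
   Context: All identities are in the field $K=\bigcup_{m\ge1}\mathbb{C}((z^{1/m}))$ of Puiseux series. A small solution of the characteristic equation is a solution $X\in K$ of positive order in $z$ (i.e. tending to $0$ as $z\to0$); there are $2d-1$ of them. -}

module Defs where

open import Algebra.Bundles.Raw using (RawRing)
import Algebra.Definitions.RawSemiring as RawSemiringDefs
open import Axiom.ExcludedMiddle using (ExcludedMiddle)
open import Data.Fin.Base using (Fin; toℕ)
open import Data.Integer.Base as ℤ using (ℤ; +_; -[1+_])
open import Data.Nat.Base as ℕ using (ℕ; zero; suc; NonZero)
open import Data.Nat.Divisibility using (_∣?_; divides)
import Data.Nat.Properties as ℕ
open import Data.Product using (∃-syntax; _×_; _,_)
open import Data.Rational.Base as ℚ using (ℚ; 0ℚ; 1ℚ; ½; ∣_∣; 1/_)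
import Data.Rational.Properties as ℚ
open import Data.Rational.Solver using (module +-*-Solver)
open import Level using (0ℓ)
open import Relation.Binary.PropositionalEquality
  using (_≡_; refl; sym; trans; cong; cong₂; subst; module ≡-Reasoning)
open import Relation.Nullary.Decidable.Core using (Dec; yes; no)

------------------------------------------------------------------------
-- ℝ: Cauchy sequences of rationals modulo null sequences

IsCauchy : (ℕ → ℚ) → Set
IsCauchy s = ∀ ε → 0ℚ ℚ.< ε →
  ∃[ N ] (∀ m n → N ℕ.≤ m → N ℕ.≤ n → ∣ s m ℚ.- s n ∣ ℚ.< ε)

record ℝ : Set where
  constructor mkℝ
  field
    seq    : ℕ → ℚ
    cauchy : IsCauchy seq

open ℝ

infix 4 _≈ʳ_

_≈ʳ_ : ℝ → ℝ → Set
x ≈ʳ y = ∀ ε → 0ℚ ℚ.< ε →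
  ∃[ N ] (∀ n → N ℕ.≤ n → ∣ seq x n ℚ.- seq y n ∣ ℚ.< ε)

module Closure where

  abstract
    half-pos : ∀ ε → 0ℚ ℚ.< ε → 0ℚ ℚ.< ½ ℚ.* ε
    half-pos ε 0<ε = subst (ℚ._< ½ ℚ.* ε) (ℚ.*-zeroʳ ½) (ℚ.*-monoʳ-<-pos ½ 0<ε)

    halves : ∀ ε → ½ ℚ.* ε ℚ.+ ½ ℚ.* ε ≡ ε
    halves ε = trans (sym (ℚ.*-distribʳ-+ ε ½ ½)) (ℚ.*-identityˡ ε)

    ∣+∣-small : ∀ {ε p q} → ∣ p ∣ ℚ.< ½ ℚ.* ε → ∣ q ∣ ℚ.< ½ ℚ.* ε → ∣ p ℚ.+ q ∣ ℚ.< ε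
    ∣+∣-small {ε} {p} {q} p< q< = begin-strict
      ∣ p ℚ.+ q ∣          ≤⟨ ℚ.∣p+q∣≤∣p∣+∣q∣ p q ⟩
      ∣ p ∣ ℚ.+ ∣ q ∣      <⟨ ℚ.+-mono-< p< q< ⟩
      ½ ℚ.* ε ℚ.+ ½ ℚ.* ε  ≡⟨ halves ε ⟩
      ε                    ∎
      where open ℚ.≤-Reasoning

    constant-cauchy : ∀ q → IsCauchy (λ _ → q)
    constant-cauchy q ε 0<ε = 0 , λ _ _ _ _ →
      subst (ℚ._< ε) (sym (cong ∣_∣ (ℚ.+-inverseʳ q))) 0<ε

    +-cauchy : ∀ s t → IsCauchy s → IsCauchy t → IsCauchy (λ n → s n ℚ.+ t n)
    +-cauchy s t cs ct ε 0<ε with cs (½ ℚ.* ε) (half-pos ε 0<ε) | ct (½ ℚ.* ε) (half-pos ε 0<ε)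
    ... | M , sM | N , tN = M ℕ.⊔ N , λ m n h k →
      subst (λ q → ∣ q ∣ ℚ.< ε)
        (solve 4 (λ a b c d → (a :- b) :+ (c :- d) := (a :+ c) :- (b :+ d)) refl
          (s m) (s n) (t m) (t n))
        (∣+∣-small
          (sM m n (ℕ.m⊔n≤o⇒m≤o M N h) (ℕ.m⊔n≤o⇒m≤o M N k))
          (tN m n (ℕ.m⊔n≤o⇒n≤o M N h) (ℕ.m⊔n≤o⇒n≤o M N k)))
      where open +-*-Solver

    -‿cauchy : ∀ s → IsCauchy s → IsCauchy (λ n → ℚ.- s n)
    -‿cauchy s cs ε 0<ε with cs ε 0<ε
    ... | N , sN = N , λ m n h k →
      subst (ℚ._< ε)
        (trans (sym (ℚ.∣-p∣≡∣p∣ (s m ℚ.- s n)))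
          (cong ∣_∣ (solve 2 (λ a b → :- (a :- b) := (:- a) :- (:- b)) refl (s m) (s n))))
        (sN m n h k)
      where open +-*-Solver

    eventually-bounded : ∀ s → IsCauchy s →
      ∃[ B ] (0ℚ ℚ.< B × ∃[ N ] (∀ n → N ℕ.≤ n → ∣ s n ∣ ℚ.< B))
    eventually-bounded s cs with cs 1ℚ (ℚ.positive⁻¹ 1ℚ)
    ... | N , sN = 1ℚ ℚ.+ ∣ s N ∣ , ℚ.+-mono-<-≤ (ℚ.positive⁻¹ 1ℚ) (ℚ.0≤∣p∣ (s N)) , N , λ n h →
      begin-strict
        ∣ s n ∣                       ≡⟨ cong ∣_∣ (solve 2 (λ a b → a := (a :- b) :+ b) refl (s n) (s N)) ⟩
        ∣ (s n ℚ.- s N) ℚ.+ s N ∣     ≤⟨ ℚ.∣p+q∣≤∣p∣+∣q∣ (s n ℚ.- s N) (s N) ⟩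
        ∣ s n ℚ.- s N ∣ ℚ.+ ∣ s N ∣   <⟨ ℚ.+-monoˡ-< ∣ s N ∣ (sN n N h ℕ.≤-refl) ⟩
        1ℚ ℚ.+ ∣ s N ∣                ∎
      where
      open +-*-Solver
      open ℚ.≤-Reasoning

    shrink : ∀ B → 0ℚ ℚ.< B → ∀ η → 0ℚ ℚ.< η →
      ∃[ δ ] (0ℚ ℚ.< δ × (∀ p q → ∣ p ∣ ℚ.< B → ∣ q ∣ ℚ.< δ → ∣ p ℚ.* q ∣ ℚ.< η))
    shrink B 0<B η 0<η = δ , 0<δ , small
      where
      instance
        B-pos : ℚ.Positive B
        B-pos = ℚ.positive 0<B
        B≢0 : ℚ.NonZero B
        B≢0 = ℚ.pos⇒nonZero B
        1/B-pos : ℚ.Positive (1/ B)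
        1/B-pos = ℚ.1/pos⇒pos B

      δ : ℚ
      δ = 1/ B ℚ.* η

      0<δ : 0ℚ ℚ.< δ
      0<δ = subst (ℚ._< δ) (ℚ.*-zeroʳ (1/ B)) (ℚ.*-monoʳ-<-pos (1/ B) 0<η)

      small : ∀ p q → ∣ p ∣ ℚ.< B → ∣ q ∣ ℚ.< δ → ∣ p ℚ.* q ∣ ℚ.< η
      small p q p< q< = begin-strict
        ∣ p ℚ.* q ∣         ≡⟨ ℚ.∣p*q∣≡∣p∣*∣q∣ p q ⟩
        ∣ p ∣ ℚ.* ∣ q ∣     ≤⟨ ℚ.*-monoʳ-≤-nonNeg ∣ q ∣ {{ℚ.∣-∣-nonNeg q}} (ℚ.<⇒≤ p<) ⟩
        B ℚ.* ∣ q ∣         <⟨ ℚ.*-monoʳ-<-pos B q< ⟩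
        B ℚ.* (1/ B ℚ.* η)  ≡⟨ sym (ℚ.*-assoc B (1/ B) η) ⟩
        B ℚ.* 1/ B ℚ.* η    ≡⟨ cong (ℚ._* η) (ℚ.*-inverseʳ B) ⟩
        1ℚ ℚ.* η            ≡⟨ ℚ.*-identityˡ η ⟩
        η                   ∎
        where open ℚ.≤-Reasoning

    *-distribˡ-- : ∀ p q r → p ℚ.* (q ℚ.- r) ≡ p ℚ.* q ℚ.- p ℚ.* r
    *-distribˡ-- p q r = trans (ℚ.*-distribˡ-+ p q (ℚ.- r))
      (cong (p ℚ.* q ℚ.+_) (sym (ℚ.neg-distribʳ-* p r)))

    product-difference : ∀ a b c d →
      a ℚ.* (c ℚ.- d) ℚ.+ d ℚ.* (a ℚ.- b) ≡ a ℚ.* c ℚ.- b ℚ.* d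
    product-difference a b c d = begin
      a ℚ.* (c ℚ.- d) ℚ.+ d ℚ.* (a ℚ.- b)
        ≡⟨ cong₂ ℚ._+_ (*-distribˡ-- a c d) (*-distribˡ-- d a b) ⟩
      (a ℚ.* c ℚ.- a ℚ.* d) ℚ.+ (d ℚ.* a ℚ.- d ℚ.* b)
        ≡⟨ cong₂ (λ p q → (a ℚ.* c ℚ.- a ℚ.* d) ℚ.+ (p ℚ.- q)) (ℚ.*-comm d a) (ℚ.*-comm d b) ⟩
      (a ℚ.* c ℚ.- a ℚ.* d) ℚ.+ (a ℚ.* d ℚ.- b ℚ.* d)
        ≡⟨ solve 3 (λ p q r → (p :- q) :+ (q :- r) := p :- r) refl (a ℚ.* c) (a ℚ.* d) (b ℚ.* d) ⟩
      a ℚ.* c ℚ.- b ℚ.* d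
        ∎
      where
      open ≡-Reasoning
      open +-*-Solver

    *-cauchy : ∀ s t → IsCauchy s → IsCauchy t → IsCauchy (λ n → s n ℚ.* t n)
    *-cauchy s t cs ct ε 0<ε =
      let B , 0<B , K , sK = eventually-bounded s cs
          C , 0<C , L , tL = eventually-bounded t ct
          δ , 0<δ , smallB = shrink B 0<B (½ ℚ.* ε) (half-pos ε 0<ε)
          γ , 0<γ , smallC = shrink C 0<C (½ ℚ.* ε) (half-pos ε 0<ε)
          M , tM = ct δ 0<δ
          N , sN = cs γ 0<γ
      in (K ℕ.⊔ L) ℕ.⊔ (M ℕ.⊔ N) , λ m n h k →
        subst (λ q → ∣ q ∣ ℚ.< ε)
          (product-difference (s m) (s n) (t m) (t n))
          (∣+∣-small
            (smallB (s m) (t m ℚ.- t n) (sK m (≥K K L M N h)) (tM m n (≥M K L M N h) (≥M K L M N k)))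
            (smallC (t n) (s m ℚ.- s n) (tL n (≥L K L M N k)) (sN m n (≥N K L M N h) (≥N K L M N k))))
      where
      module _ (K L M N : ℕ) {m : ℕ} (h : (K ℕ.⊔ L) ℕ.⊔ (M ℕ.⊔ N) ℕ.≤ m) where
        ≥K : K ℕ.≤ m
        ≥K = ℕ.m⊔n≤o⇒m≤o K L (ℕ.m⊔n≤o⇒m≤o (K ℕ.⊔ L) (M ℕ.⊔ N) h)
        ≥L : L ℕ.≤ m
        ≥L = ℕ.m⊔n≤o⇒n≤o K L (ℕ.m⊔n≤o⇒m≤o (K ℕ.⊔ L) (M ℕ.⊔ N) h)
        ≥M : M ℕ.≤ m
        ≥M = ℕ.m⊔n≤o⇒m≤o M N (ℕ.m⊔n≤o⇒n≤o (K ℕ.⊔ L) (M ℕ.⊔ N) h)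
        ≥N : N ℕ.≤ m
        ≥N = ℕ.m⊔n≤o⇒n≤o M N (ℕ.m⊔n≤o⇒n≤o (K ℕ.⊔ L) (M ℕ.⊔ N) h)

open Closure

infix  8 -ʳ_
infixl 7 _*ʳ_
infixl 6 _+ʳ_ _-ʳ_

constant : ℚ → ℝ
constant q = mkℝ (λ _ → q) (constant-cauchy q)

_+ʳ_ : ℝ → ℝ → ℝ
x +ʳ y = mkℝ (λ n → seq x n ℚ.+ seq y n) (+-cauchy (seq x) (seq y) (cauchy x) (cauchy y))

_*ʳ_ : ℝ → ℝ → ℝ
x *ʳ y = mkℝ (λ n → seq x n ℚ.* seq y n) (*-cauchy (seq x) (seq y) (cauchy x) (cauchy y))

-ʳ_ : ℝ → ℝ
-ʳ x = mkℝ (λ n → ℚ.- seq x n) (-‿cauchy (seq x) (cauchy x))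

_-ʳ_ : ℝ → ℝ → ℝ
x -ʳ y = x +ʳ (-ʳ y)

record ℂ : Set where
  constructor _+i_
  field
    re im : ℝ

open ℂ

ℂ-rawRing : RawRing 0ℓ 0ℓ
ℂ-rawRing = record
  { Carrier = ℂ
  ; _≈_     = λ v w → re v ≈ʳ re w × im v ≈ʳ im w
  ; _+_     = λ v w → (re v +ʳ re w) +i (im v +ʳ im w)
  ; _*_     = λ v w → (re v *ʳ re w -ʳ im v *ʳ im w) +i (re v *ʳ im w +ʳ im v *ʳ re w)
  ; -_      = λ v → (-ʳ re v) +i (-ʳ im v)
  ; 0#      = constant 0ℚ +i constant 0ℚ
  ; 1#      = constant 1ℚ +i constant 0ℚ
  }

------------------------------------------------------------------------
-- ℂ[[z]], a series being its coefficient sequence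

module ℂR = RawRing ℂ-rawRing

Series : Set
Series = ℕ → ℂ

-- a ↦ zᵏ · a
raise : ℕ → Series → Series
raise zero    a n       = a n
raise (suc k) a zero    = ℂR.0#
raise (suc k) a (suc n) = raise k a n

-- a(z) ↦ a(zᵐ)
dilate : ℕ → Series → Series
dilate m a n with m ∣? n
... | yes (divides q _) = a q
... | no  _             = ℂR.0#

1ˢ : Series
1ˢ zero    = ℂR.1#
1ˢ (suc _) = ℂR.0#

zˢ : Series
zˢ = raise 1 1ˢ

Series-rawRing : RawRing 0ℓ 0ℓ
Series-rawRing = record
  { Carrier = Series
  ; _≈_     = λ a b → ∀ n → a n ℂR.≈ b n
  ; _+_     = λ a b n → a n ℂR.+ b n
  ; _*_     = λ a b n → sum {suc n} (λ i → a (toℕ i) ℂR.* b (n ℕ.∸ toℕ i))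
  ; -_      = λ a n → ℂR.- a n
  ; 0#      = λ _ → ℂR.0#
  ; 1#      = 1ˢ
  }
  where open RawSemiringDefs ℂR.rawSemiring using (sum)

module SeriesR where
  open RawRing Series-rawRing public
  open RawSemiringDefs rawSemiring public using (_^_)

------------------------------------------------------------------------
-- K, the Puiseux series in z over ℂ

-- ⟨ m , p , a ⟩ stands for Σᵢ aᵢ z^((i - p) / m).
record K : Set where
  constructor ⟨_,_,_⟩
  field
    ram       : ℕ
    pole      : ℕ
    coeff     : Series
    {{ram≢0}} : NonZero ram

open K

-- Put x and y over the common ramification index ram x · ram y and the
-- common pole order commonPole x y; this is the resulting series for x.
commonPole : K → K → ℕ
commonPole x y = pole x ℕ.* ram y ℕ.+ pole y ℕ.* ram x

align : K → K → Series
align x y = raise (pole y ℕ.* ram x) (dilate (ram y) (coeff x))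

fromSeries : Series → K
fromSeries a = ⟨ 1 , 0 , a ⟩

K-rawRing : RawRing 0ℓ 0ℓ
K-rawRing = record
  { Carrier = K
  ; _≈_     = λ x y → align x y SeriesR.≈ align y x
  ; _+_     = λ x y → ⟨ ram x ℕ.* ram y , commonPole x y , align x y SeriesR.+ align y x ⟩
                        {{ℕ.m*n≢0 (ram x) (ram y) {{ram≢0 x}} {{ram≢0 y}}}}
  ; _*_     = λ x y → ⟨ ram x ℕ.* ram y , commonPole x y
                      , dilate (ram y) (coeff x) SeriesR.* dilate (ram x) (coeff y) ⟩
                        {{ℕ.m*n≢0 (ram x) (ram y) {{ram≢0 x}} {{ram≢0 y}}}}
  ; -_      = λ x → ⟨ ram x , pole x , SeriesR.- coeff x ⟩ {{ram≢0 x}}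
  ; 0#      = fromSeries SeriesR.0#
  ; 1#      = fromSeries SeriesR.1#
  }

open RawRing K-rawRing public
  using (_≈_; _≉_; _+_; _*_; -_; 0#; 1#)
open RawSemiringDefs (RawRing.rawSemiring K-rawRing) public
  using (_^_; sum; product)

infixl 6 _-_

_-_ : K → K → K
x - y = x + (- y)

z : K
z = fromSeries zˢ

-- Terms of exponent (i - pole) / ram ≤ 0 vanish.
PositiveOrder : K → Set
PositiveOrder x = ∀ i → i ℕ.≤ pole x → coeff x i ℂR.≈ ℂR.0#

-- The underlying mathematics is classical: deciding whether a Puiseux
-- series vanishes, hence inverting the nonzero ones, needs excluded middle.
module Classical (em : ExcludedMiddle 0ℓ) where

  infix  9 _⁻¹
  infixl 7 _/_
  infixr 8 _^ᶻ_

  pick : ∀ {x} → Dec (∃[ y ] x * y ≈ 1#) → K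
  pick (yes (y , _)) = y
  pick (no _)        = 0#

  -- Total, with the junk value 0 when x has no inverse, that is for x ≈ 0.
  _⁻¹ : K → K
  x ⁻¹ = pick {x} em

  _/_ : K → K → K
  x / y = x * y ⁻¹

  _^ᶻ_ : K → ℤ → K
  x ^ᶻ (+ n)    = x ^ n
  x ^ᶻ -[1+ n ] = x ⁻¹ ^ suc n

  -- The index i : Fin d encodes ℓ = i + 1 ∈ {1, …, d}; odd i = 2ℓ - 1.
  odd : ∀ {d} → Fin d → ℤ
  odd i = + 2 ℤ.* + suc (toℕ i) ℤ.- + 1

  Characteristic : ℕ → K → K → Set
  Characteristic d T X =
    1# ≈ z * T ^ (2 ℕ.* d ℕ.∸ 1) * sum {d} (λ i → X ^ᶻ odd i + X ^ᶻ (ℤ.- odd i))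

  record SmallSolution (d : ℕ) (T X : K) : Set where
    field
      small          : PositiveOrder X
      characteristic : Characteristic d T X

Recurrence : ℕ → (ℤ → K) → Set
Recurrence d T = ∀ j →
  T j ≈ 1# + z * product {d} (λ i → let ℓ = + suc (toℕ i) in
    T (j ℤ.+ + 2 ℤ.* ℓ ℤ.- + 1) * T (j ℤ.- + 2 ℤ.* ℓ ℤ.+ + 1))

{-# OPTIONS --safe #-}
module Submission where

-- Write u(k) = 1 - Λ X^(k+j). For odd s from -(2d-1) to 2d-1 the products of
-- u(d+1+s) / u(d+3+s) and of u(3d+4+s) / u(3d+2+s) both telescope, and since
-- z T^(2d) = T - 1 the recurrence becomes
--   T u(d+1) u(3d+4) = u(d+3) u(3d+2) + (T-1) u(2-d) u(5d+3).
-- Let S be the sum in the characteristic equation, so that T = (T-1) S. The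
-- coefficients of Λ⁰ and Λ² agree trivially, those of Λ because
-- (1 - X²) S = X^(1-2d) - X^(2d+1). The divisions are legitimate because K is
-- a field, and X is invertible by the characteristic equation.

open import Algebra.Bundles using (CommutativeRing; Semiring)
open import Algebra.Bundles.Raw using (RawRing)
import Algebra.Morphism.RingMonomorphism as RingMonomorphism
import Algebra.Solver.Ring as RingSolver
open import Algebra.Solver.Ring.AlmostCommutativeRing using (fromCommutativeRing; _-Raw-AlmostCommutative⟶_; Induced-equivalence)
open import Algebra.Structures using (IsCommutativeRing)
open import Axiom.ExcludedMiddle using (ExcludedMiddle)
open import Data.Fin.Base as Fin using (Fin; toℕ)
open import Data.Integer.Base as ℤ using (ℤ; +_; -[1+_])
import Data.Integer.Properties as ℤ
import Data.Integer.Tactic.RingSolver as ℤSolver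
open import Data.Maybe.Base using (just; nothing)
open import Data.Nat.Base as ℕ using (ℕ; zero; suc; NonZero)
open import Data.Nat.Divisibility using (_∣_; _∤_; _∣?_; divides; ∣m+n∣m⇒∣n; ∣-refl; >⇒∤)
import Data.Nat.Properties as ℕ
import Data.Nat.Tactic.RingSolver as ℕSolver
open import Data.Product using (∃-syntax; _×_; _,_)
open import Data.Rational.Base as ℚ using (ℚ; 0ℚ; 1ℚ; ½; ∣_∣; 1/_)
import Data.Rational.Properties as ℚ
open import Data.Rational.Solver using (module +-*-Solver)
open import Data.Sum.Base using (_⊎_; inj₁; inj₂)
open import Function.Base using (_∘_; id)
open import Level using (0ℓ)
open import Relation.Binary.Definitions using (WeaklyDecidable)
open import Relation.Binary.PropositionalEquality as ≡ using (_≡_)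
open import Relation.Nullary.Decidable using (Dec; yes; no; decidable-stable)
open import Relation.Nullary.Negation using (¬_; contradiction)

-- Commutative rings

-- The indices of the three products have one common sum: (d+1)+(3d+4) = (d+3)+(3d+2) = (2-d)+(5d+3)
-- = 4d+5. Hence Λ² carries the same power of X in each product, and its coefficients match because
-- T = 1 + (T-1). The coefficient of Λ is, up to a power of X and the factor X^(2d+1) - 1, the
-- relation T (1 - X²) = (T-1)(X^(1-2d) - X^(2d+1)), which is T = (T-1) S multiplied by 1 - X². Most
-- of the work is the field structure of K. Its elements are compared like fractions, by passing to
-- a common ramification index and pole order, and the ring laws rest on z ↦ zᵏ being an injective
-- endomorphism of the power series. To invert a nonzero element one splits off a power of z and
-- inverts a series with nonzero constant term, which leads down to reciprocals in ℂ and in ℝ.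

module IntegerSolver {c ℓ} (R : CommutativeRing c ℓ) where
  open CommutativeRing R
  open import Algebra.Properties.Ring ring
  open import Algebra.Properties.AbelianGroup +-abelianGroup using (⁻¹-∙-comm)
  open import Algebra.Properties.Semiring.Mult.TCOptimised semiring using (×-homo-+; ×1-homo-*) renaming (_×_ to _·_)
  open import Relation.Binary.Reasoning.Setoid setoid

  ⟦_⟧ : ℤ → Carrier
  ⟦ + n ⟧      = n · 1#
  ⟦ -[1+ n ] ⟧ = - (suc n · 1#)

  ⟦-⟧ : ∀ i → ⟦ ℤ.- i ⟧ ≈ - ⟦ i ⟧
  ⟦-⟧ (+ zero)  = sym -0#≈0#
  ⟦-⟧ (+ suc n) = refl
  ⟦-⟧ -[1+ n ]  = sym (-‿involutive _)

  ⟦⊖⟧ : ∀ m n → ⟦ m ℤ.⊖ n ⟧ ≈ m · 1# + - (n · 1#)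
  ⟦⊖⟧ m       zero    = begin
    m · 1#            ≈⟨ +-identityʳ _ ⟨
    m · 1# + 0#       ≈⟨ +-congˡ -0#≈0# ⟨
    m · 1# + - 0#     ∎
  ⟦⊖⟧ zero    (suc n) = sym (+-identityˡ _)
  ⟦⊖⟧ (suc m) (suc n) = begin
    ⟦ suc m ℤ.⊖ suc n ⟧                 ≡⟨ ≡.cong ⟦_⟧ (ℤ.[1+m]⊖[1+n]≡m⊖n m n) ⟩
    ⟦ m ℤ.⊖ n ⟧                         ≈⟨ ⟦⊖⟧ m n ⟩
    a + - b                             ≈⟨ +-congʳ (+-identityʳ a) ⟨
    (a + 0#) + - b                      ≈⟨ +-congʳ (+-congˡ (-‿inverseʳ 1#)) ⟨
    (a + (1# + - 1#)) + - b             ≈⟨ +-congʳ (+-assoc a 1# _) ⟨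
    ((a + 1#) + - 1#) + - b             ≈⟨ +-assoc _ _ _ ⟩
    (a + 1#) + (- 1# + - b)             ≈⟨ +-cong (+-comm a 1#) (⁻¹-∙-comm 1# b) ⟩
    (1# + a) + - (1# + b)               ≈⟨ +-cong (×-homo-+ 1# 1 m) (-‿cong (×-homo-+ 1# 1 n)) ⟨
    suc m · 1# + - (suc n · 1#)         ∎
    where
    a = m · 1#
    b = n · 1#

  ⟦+⟧ : ∀ i j → ⟦ i ℤ.+ j ⟧ ≈ ⟦ i ⟧ + ⟦ j ⟧
  ⟦+⟧ (+ m)    (+ n)    = ×-homo-+ 1# m n
  ⟦+⟧ (+ m)    -[1+ n ] = ⟦⊖⟧ m (suc n)
  ⟦+⟧ -[1+ m ] (+ n)    = trans (⟦⊖⟧ n (suc m)) (+-comm _ _)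
  ⟦+⟧ -[1+ m ] -[1+ n ] = begin
    - (suc (suc (m ℕ.+ n)) · 1#)         ≡⟨ ≡.cong (λ k → - (k · 1#)) (≡.cong suc (ℕ.+-suc m n)) ⟨
    - ((suc m ℕ.+ suc n) · 1#)           ≈⟨ -‿cong (×-homo-+ 1# (suc m) (suc n)) ⟩
    - (suc m · 1# + suc n · 1#)          ≈⟨ ⁻¹-∙-comm _ _ ⟨
    - (suc m · 1#) + - (suc n · 1#)      ∎

  ⟦*⟧⁺ : ∀ m n → ⟦ + m ℤ.* + n ⟧ ≈ ⟦ + m ⟧ * ⟦ + n ⟧
  ⟦*⟧⁺ m n = begin
    ⟦ + m ℤ.* + n ⟧       ≡⟨ ≡.cong ⟦_⟧ (ℤ.pos-* m n) ⟨
    (m ℕ.* n) · 1#        ≈⟨ ×1-homo-* m n ⟩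
    m · 1# * n · 1#       ∎

  ⟦*⟧ : ∀ i j → ⟦ i ℤ.* j ⟧ ≈ ⟦ i ⟧ * ⟦ j ⟧
  ⟦*⟧ (+ m) (+ n) = ⟦*⟧⁺ m n
  ⟦*⟧ (+ m) -[1+ n ] = begin
    ⟦ + m ℤ.* -[1+ n ] ⟧           ≡⟨ ≡.cong ⟦_⟧ (ℤ.neg-distribʳ-* (+ m) (+ suc n)) ⟨
    ⟦ ℤ.- (+ m ℤ.* + suc n) ⟧      ≈⟨ ⟦-⟧ (+ m ℤ.* + suc n) ⟩
    - ⟦ + m ℤ.* + suc n ⟧          ≈⟨ -‿cong (⟦*⟧⁺ m (suc n)) ⟩
    - (⟦ + m ⟧ * ⟦ + suc n ⟧)      ≈⟨ -‿distribʳ-* _ _ ⟩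
    ⟦ + m ⟧ * - ⟦ + suc n ⟧        ∎
  ⟦*⟧ -[1+ m ] j = begin
    ⟦ -[1+ m ] ℤ.* j ⟧             ≡⟨ ≡.cong ⟦_⟧ (ℤ.neg-distribˡ-* (+ suc m) j) ⟨
    ⟦ ℤ.- (+ suc m ℤ.* j) ⟧        ≈⟨ ⟦-⟧ (+ suc m ℤ.* j) ⟩
    - ⟦ + suc m ℤ.* j ⟧            ≈⟨ -‿cong (positive j) ⟩
    - (⟦ + suc m ⟧ * ⟦ j ⟧)        ≈⟨ -‿distribˡ-* _ _ ⟩
    - ⟦ + suc m ⟧ * ⟦ j ⟧          ∎
    where
    positive : ∀ j → ⟦ + suc m ℤ.* j ⟧ ≈ ⟦ + suc m ⟧ * ⟦ j ⟧
    positive (+ n)    = ⟦*⟧⁺ (suc m) n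
    positive -[1+ n ] = ⟦*⟧ (+ suc m) -[1+ n ]

  -- The ring solver has to recognise equal coefficients, and the carriers used below have no
  -- decidable equality. Coefficients are therefore taken in ℤ, which suffices for every identity to
  -- be solved.
  morphism : ℤ.+-*-rawRing -Raw-AlmostCommutative⟶ fromCommutativeRing R
  morphism = record
    { ⟦_⟧    = ⟦_⟧
    ; +-homo = ⟦+⟧
    ; *-homo = ⟦*⟧
    ; -‿homo = ⟦-⟧
    ; 0-homo = refl
    ; 1-homo = refl
    }

  _≟⟦⟧_ : WeaklyDecidable (Induced-equivalence morphism)
  i ≟⟦⟧ j with i ℤ.≟ j
  ... | yes ≡.refl = just refl
  ... | no  _      = nothing

  open RingSolver ℤ.+-*-rawRing (fromCommutativeRing R) morphism _≟⟦⟧_ public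
    using (solve; _:=_; _:+_; _:*_; _:-_; :-_; con)

-- Integer powers and inverses in a commutative ring

module IntegerPower {c ℓ} (R : CommutativeRing c ℓ) where
  open CommutativeRing R hiding (zero)
  open IntegerSolver R
  open import Algebra.Definitions.RawSemiring (Semiring.rawSemiring semiring) using (_^_; sum)
  open import Algebra.Properties.Semiring.Exp semiring using (^-homo-*)
  open import Relation.Binary.Reasoning.Setoid setoid

  module _ (x y : Carrier) (xy≈1 : x * y ≈ 1#)
    (x^ : ℤ → Carrier) (x^-pos : ∀ n → x^ (+ n) ≈ x ^ n) (x^-neg : ∀ n → x^ -[1+ n ] ≈ y ^ suc n) where

    -- This settles the mixed-sign cases of `x^-+`. Lowering both m and n by one costs a factor x y,
    -- which is 1.
    x^-⊖ : ∀ m n → x^ (m ℤ.⊖ n) ≈ x ^ m * y ^ n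
    x^-⊖ m       zero    = trans (x^-pos m) (sym (*-identityʳ _))
    x^-⊖ zero    (suc n) = trans (x^-neg n) (sym (*-identityˡ _))
    x^-⊖ (suc m) (suc n) = begin
      x^ (suc m ℤ.⊖ suc n)          ≡⟨ ≡.cong x^ (ℤ.[1+m]⊖[1+n]≡m⊖n m n) ⟩
      x^ (m ℤ.⊖ n)                  ≈⟨ x^-⊖ m n ⟩
      x ^ m * y ^ n                 ≈⟨ *-identityˡ _ ⟨
      1# * (x ^ m * y ^ n)          ≈⟨ *-congʳ xy≈1 ⟨
      x * y * (x ^ m * y ^ n)       ≈⟨ solve 4 (λ x y a b → x :* y :* (a :* b) := x :* a :* (y :* b)) refl x y _ _ ⟩
      x ^ suc m * y ^ suc n         ∎

    x^-+ : ∀ i j → x^ (i ℤ.+ j) ≈ x^ i * x^ j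
    x^-+ (+ m)    (+ n)    = begin
      x^ (+ (m ℕ.+ n))              ≈⟨ x^-pos (m ℕ.+ n) ⟩
      x ^ (m ℕ.+ n)                 ≈⟨ ^-homo-* x m n ⟩
      x ^ m * x ^ n                 ≈⟨ *-cong (x^-pos m) (x^-pos n) ⟨
      x^ (+ m) * x^ (+ n)           ∎
    x^-+ (+ m)    -[1+ n ] = trans (x^-⊖ m (suc n)) (sym (*-cong (x^-pos m) (x^-neg n)))
    x^-+ -[1+ m ] (+ n)    = trans (x^-⊖ n (suc m)) (trans (*-comm _ _) (sym (*-cong (x^-neg m) (x^-pos n))))
    x^-+ -[1+ m ] -[1+ n ] = begin
      x^ -[1+ suc (m ℕ.+ n) ]       ≈⟨ x^-neg _ ⟩
      y ^ suc (suc (m ℕ.+ n))       ≡⟨ ≡.cong (λ k → y ^ suc k) (ℕ.+-suc m n) ⟨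
      y ^ (suc m ℕ.+ suc n)         ≈⟨ ^-homo-* y (suc m) (suc n) ⟩
      y ^ suc m * y ^ suc n         ≈⟨ *-cong (x^-neg m) (x^-neg n) ⟨
      x^ -[1+ m ] * x^ -[1+ n ]     ∎

  sum-multiple : ∀ x {d} (f : Fin d → Carrier) → (∀ i → ∃[ v ] f i ≈ x * v) → ∃[ v ] sum {d} f ≈ x * v
  sum-multiple x {zero}  f multiple = 0# , sym (zeroʳ x)
  sum-multiple x {suc d} f multiple =
    let v , f₀≈xv = multiple Fin.zero
        w , Σ≈xw  = sum-multiple x (f ∘ Fin.suc) (multiple ∘ Fin.suc)
    in v + w , trans (+-cong f₀≈xv Σ≈xw) (sym (distribˡ x v w))

  -- If negative powers of x are replaced by 0, the characteristic equation still exhibits 1 as a multiple of x.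
  characteristic⇒invertible : ∀ x y → y ≈ 0# →
    (x^ : ℤ → Carrier) → (∀ n → x^ (+ n) ≈ x ^ n) → (∀ n → x^ -[1+ n ] ≈ y ^ suc n) →
    ∀ c {d} → 1# ≈ c * sum {d} (λ i →
      x^ (+ 2 ℤ.* + suc (toℕ i) ℤ.- + 1) + x^ (ℤ.- (+ 2 ℤ.* + suc (toℕ i) ℤ.- + 1))) →
    ∃[ v ] x * v ≈ 1#
  characteristic⇒invertible x y y≈0 x^ x^-pos x^-neg c {d} 1≈cΣ =
    let v , Σ≈xv = sum-multiple x {d} _ λ i → x ^ (toℕ i ℕ.+ toℕ i) , term (toℕ i)
    in c * v , (begin
      x * (c * v)    ≈⟨ solve 3 (λ x c v → x :* (c :* v) := c :* (x :* v)) refl x c v ⟩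
      c * (x * v)    ≈⟨ *-congˡ Σ≈xv ⟨
      c * _          ≈⟨ 1≈cΣ ⟨
      1#             ∎)
    where
    odd : ∀ K → + 2 ℤ.* (+ 1 ℤ.+ K) ℤ.- + 1 ≡ + 1 ℤ.+ (K ℤ.+ K)
    odd = ℤSolver.solve-∀

    term : ∀ k → x^ (+ 2 ℤ.* + suc k ℤ.- + 1) + x^ (ℤ.- (+ 2 ℤ.* + suc k ℤ.- + 1)) ≈ x * x ^ (k ℕ.+ k)
    term k = begin
      x^ (+ 2 ℤ.* + suc k ℤ.- + 1) + x^ (ℤ.- (+ 2 ℤ.* + suc k ℤ.- + 1))
        ≡⟨ ≡.cong (λ i → x^ i + x^ (ℤ.- i)) (odd (+ k)) ⟩
      x^ (+ suc (k ℕ.+ k)) + x^ -[1+ k ℕ.+ k ]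
        ≈⟨ +-cong (x^-pos _) (trans (x^-neg _) (trans (*-congʳ y≈0) (zeroˡ _))) ⟩
      x * x ^ (k ℕ.+ k) + 0#
        ≈⟨ +-identityʳ _ ⟩
      x * x ^ (k ℕ.+ k) ∎

  *-inverse : ∀ {a a′ b b′} → a * a′ ≈ 1# → b * b′ ≈ 1# → a * b * (a′ * b′) ≈ 1#
  *-inverse {a} {a′} {b} {b′} aa′≈1 bb′≈1 = begin
    a * b * (a′ * b′)        ≈⟨ solve 4 (λ a b c d → a :* b :* (c :* d) := (a :* c) :* (b :* d)) refl a b a′ b′ ⟩
    (a * a′) * (b * b′)      ≈⟨ *-cong aa′≈1 bb′≈1 ⟩
    1# * 1#                  ≈⟨ *-identityˡ 1# ⟩
    1#                       ∎

  inverse-unique : ∀ {a b c} → a * b ≈ 1# → a * c ≈ 1# → b ≈ c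
  inverse-unique {a} {b} {c} ab≈1 ac≈1 = begin
    b              ≈⟨ *-identityˡ b ⟨
    1# * b         ≈⟨ *-congʳ ac≈1 ⟨
    a * c * b      ≈⟨ solve 3 (λ a b c → a :* c :* b := a :* b :* c) refl a b c ⟩
    a * b * c      ≈⟨ *-congʳ ab≈1 ⟩
    1# * c         ≈⟨ *-identityˡ c ⟩
    c              ∎

-- Telescoping and the recurrence over a commutative ring

module Telescope {r ℓ} (R : CommutativeRing r ℓ) where
  open CommutativeRing R
  open IntegerSolver R
  open import Algebra.Definitions.RawSemiring (Semiring.rawSemiring semiring) using (_^_; sum; product)
  open import Relation.Binary.Reasoning.Setoid setoid

  -- Sums unfold at their first term, so the induction shifts `f` and `P` by one. The start `P 0`
  -- has to be carried along, since a shifted `P` no longer starts at zero even if `P` does.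
  telescope-sum : ∀ (f P : ℕ → Carrier) → (∀ n → P (suc n) ≈ P n + f n) →
    ∀ n → P 0 + sum {n} (f ∘ toℕ) ≈ P n
  telescope-sum f P step zero    = +-identityʳ (P 0)
  telescope-sum f P step (suc n) = begin
    P 0 + (f 0 + sum {n} (f ∘ suc ∘ toℕ))  ≈⟨ +-assoc _ _ _ ⟨
    P 0 + f 0 + sum {n} (f ∘ suc ∘ toℕ)    ≈⟨ +-congʳ (step 0) ⟨
    P 1 + sum {n} (f ∘ suc ∘ toℕ)          ≈⟨ telescope-sum (f ∘ suc) (P ∘ suc) (step ∘ suc) n ⟩
    P (suc n)                              ∎

  telescope-product : ∀ (f P : ℕ → Carrier) → (∀ n → P (suc n) ≈ P n * f n) →
    ∀ n → P 0 * product {n} (f ∘ toℕ) ≈ P n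
  telescope-product f P step zero    = *-identityʳ (P 0)
  telescope-product f P step (suc n) = begin
    P 0 * (f 0 * product {n} (f ∘ suc ∘ toℕ))  ≈⟨ *-assoc _ _ _ ⟨
    P 0 * f 0 * product {n} (f ∘ suc ∘ toℕ)    ≈⟨ *-congʳ (step 0) ⟨
    P 1 * product {n} (f ∘ suc ∘ toℕ)          ≈⟨ telescope-product (f ∘ suc) (P ∘ suc) (step ∘ suc) n ⟩
    P (suc n)                                  ∎

  -- Denominators enter only through a function `w` with `u k * w k ≈ 1#`, so the argument takes
  -- place in a commutative ring without division.
  module Recurrence
    (d : ℕ) (1≤d : 1 ℕ.≤ d)
    (z T Λ : Carrier)
    (T-equation : T ≈ 1# + z * T ^ (2 ℕ.* d))
    (X^ : ℤ → Carrier)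
    (X^-zero : X^ (+ 0) ≈ 1#)
    (X^-+ : ∀ i j → X^ (i ℤ.+ j) ≈ X^ i * X^ j)
    (characteristic : 1# ≈ z * T ^ (2 ℕ.* d ℕ.∸ 1) * sum {d} (λ i →
      X^ (+ 2 ℤ.* + suc (toℕ i) ℤ.- + 1) + X^ (ℤ.- (+ 2 ℤ.* + suc (toℕ i) ℤ.- + 1))))
    (w : ℤ → Carrier)
    (u*w : ∀ k → (1# - Λ * X^ k) * w k ≈ 1#)
    where

    u : ℤ → Carrier
    u k = 1# - Λ * X^ k

    X^-cong : ∀ {i j} → i ≡ j → X^ i ≈ X^ j
    X^-cong i≡j = reflexive (≡.cong X^ i≡j)

    -- `D³` is 3d, not a cube. It is spelled the way `+ (3 ℕ.* d)` computes, so that the indices of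
    -- the theorem agree with those below by conversion.
    D D³ : ℤ
    D  = + d
    D³ = D ℤ.+ (D ℤ.+ (D ℤ.+ + 0))

    S : Carrier
    S = sum {d} (λ i →
      X^ (+ 2 ℤ.* + suc (toℕ i) ℤ.- + 1) + X^ (ℤ.- (+ 2 ℤ.* + suc (toℕ i) ℤ.- + 1)))

    -- The two powers of X that survive the telescoping of S. Since X² = p h, the powers in `key`,
    -- measured from index d+1+j, are all monomials in them: 1 and p h² on the left, p h and h, then
    -- p and h² on the right.
    p h X² : Carrier
    p  = X^ (+ 1 ℤ.- + 2 ℤ.* D)
    h  = X^ (+ 2 ℤ.* D ℤ.+ + 1)
    X² = X^ (+ 2)

    -- Multiplying by 1 - X² makes the sum over ℓ telescope.
    S-closed : (1# - X²) * S ≈ p - h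
    S-closed = begin
      (1# - X²) * S                          ≈⟨ *-distribˡ-sum {d} (1# - X²) _ ⟩
      sum {d} (f ∘ toℕ)                      ≈⟨ +-identityˡ _ ⟨
      -- `P 0` is X - X.
      0# + sum {d} (f ∘ toℕ)                 ≈⟨ +-congʳ (-‿inverseʳ _) ⟨
      P 0 + sum {d} (f ∘ toℕ)                ≈⟨ telescope-sum f P step d ⟩
      P d                                    ∎
      where
      open import Algebra.Properties.Semiring.Sum semiring using (*-distribˡ-sum)
      f P : ℕ → Carrier
      f n = (1# - X²) * (X^ (+ 2 ℤ.* + suc n ℤ.- + 1) + X^ (ℤ.- (+ 2 ℤ.* + suc n ℤ.- + 1)))
      P n = X^ (+ 1 ℤ.- + 2 ℤ.* + n) - X^ (+ 2 ℤ.* + n ℤ.+ + 1)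

      step : ∀ n → P (suc n) ≈ P n + f n
      step n = begin
        X^ (+ 1 ℤ.- + 2 ℤ.* + suc n) - X^ (+ 2 ℤ.* + suc n ℤ.+ + 1)
          ≈⟨ +-cong (X^-cong (i₁ (+ n))) (-‿cong (trans (X^-cong (i₂ (+ n))) (X^-+ (+ 2) _))) ⟩
        c - X² * b
          ≈⟨ solve 3 (λ b c e → c :- e :* b := (e :* c :- b) :+ (con (+ 1) :- e) :* (b :+ c)) refl b c X² ⟩
        (X² * c - b) + (1# - X²) * (b + c)
          ≈⟨ +-congʳ (+-cong (trans (X^-cong (i₃ (+ n))) (X^-+ (+ 2) _)) (-‿cong (X^-cong (i₄ (+ n))))) ⟨
        P n + f n ∎
        where
        b = X^ (+ 2 ℤ.* + suc n ℤ.- + 1)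
        c = X^ (ℤ.- (+ 2 ℤ.* + suc n ℤ.- + 1))
        i₁ : ∀ N → + 1 ℤ.- + 2 ℤ.* (+ 1 ℤ.+ N) ≡ ℤ.- (+ 2 ℤ.* (+ 1 ℤ.+ N) ℤ.- + 1)
        i₁ = ℤSolver.solve-∀
        i₂ : ∀ N → + 2 ℤ.* (+ 1 ℤ.+ N) ℤ.+ + 1 ≡ + 2 ℤ.+ (+ 2 ℤ.* (+ 1 ℤ.+ N) ℤ.- + 1)
        i₂ = ℤSolver.solve-∀
        i₃ : ∀ N → + 1 ℤ.- + 2 ℤ.* N ≡ + 2 ℤ.+ ℤ.- (+ 2 ℤ.* (+ 1 ℤ.+ N) ℤ.- + 1)
        i₃ = ℤSolver.solve-∀
        i₄ : ∀ N → + 2 ℤ.* N ℤ.+ + 1 ≡ + 2 ℤ.* (+ 1 ℤ.+ N) ℤ.- + 1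
        i₄ = ℤSolver.solve-∀

    X²≈ph : X² ≈ p * h
    X²≈ph = trans (X^-cong (i₀ D)) (X^-+ _ _)
      where
      i₀ : ∀ D → + 2 ≡ (+ 1 ℤ.- + 2 ℤ.* D) ℤ.+ (+ 2 ℤ.* D ℤ.+ + 1)
      i₀ = ℤSolver.solve-∀

    zT²ᵈ : z * T ^ (2 ℕ.* d) ≈ T - 1#
    zT²ᵈ = begin
      z * T ^ (2 ℕ.* d)               ≈⟨ solve 1 (λ x → x := (con (+ 1) :+ x) :- con (+ 1)) refl _ ⟩
      (1# + z * T ^ (2 ℕ.* d)) - 1#   ≈⟨ +-congʳ T-equation ⟨
      T - 1#                          ∎

    T≈[T-1]S : T ≈ (T - 1#) * S
    T≈[T-1]S = begin
      T                                      ≈⟨ *-identityʳ T ⟨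
      T * 1#                                 ≈⟨ *-congˡ characteristic ⟩
      T * (z * T ^ (2 ℕ.* d ℕ.∸ 1) * S)      ≈⟨ solve 4 (λ t z s x → t :* (z :* x :* s) := z :* (t :* x) :* s) refl T z S _ ⟩
      z * (T * T ^ (2 ℕ.* d ℕ.∸ 1)) * S      ≈⟨ *-congʳ (*-congˡ (power 1≤d)) ⟩
      z * T ^ (2 ℕ.* d) * S                  ≈⟨ *-congʳ zT²ᵈ ⟩
      (T - 1#) * S                           ∎
      where
      -- Once d is a successor, truncated subtraction is exact and both sides compute to the same
      -- power. The bound is matched for a fresh `d` because the module parameter cannot be refined.
      power : ∀ {d} → 1 ℕ.≤ d → T * T ^ (2 ℕ.* d ℕ.∸ 1) ≈ T ^ (2 ℕ.* d)
      power (ℕ.s≤s _) = refl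

    key : ∀ j → T * (u (D ℤ.+ + 1 ℤ.+ j) * u (D³ ℤ.+ + 4 ℤ.+ j)) ≈
      u (D ℤ.+ + 3 ℤ.+ j) * u (D³ ℤ.+ + 2 ℤ.+ j) +
      (T - 1#) * (u (D ℤ.+ + 2 ℤ.- + 2 ℤ.* D ℤ.+ j) * u (D³ ℤ.+ + 3 ℤ.+ + 2 ℤ.* D ℤ.+ j))
    key j = begin
      T * (u (D ℤ.+ + 1 ℤ.+ j) * u (D³ ℤ.+ + 4 ℤ.+ j))
        ≈⟨ *-congˡ (*-congˡ (u-shift _ _ (e₁ D j) (trans (X^-+ _ _) (*-congʳ X²≈ph)))) ⟩
      T * ((1# - g) * (1# - p * h * h * g))
        -- The difference of the two sides is g (h - 1)(T (1 - p h) - (T-1)(p - h)). It is written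
        -- as a combination of T - (T-1) S and (1 - p h) S - (p - h), both zero, with weights chosen
        -- so that S cancels; note p h + h - 1 - p h² = (h - 1)(1 - p h).
        ≈⟨ solve 5 (λ T S p h g →
             let t = T :- con (+ 1) ; 1′ = con (+ 1) in
             T :* ((1′ :- g) :* (1′ :- p :* h :* h :* g)) :=
             ((1′ :- p :* h :* g) :* (1′ :- h :* g) :+ t :* ((1′ :- p :* g) :* (1′ :- h :* h :* g)))
             :+ g :* ((T :- t :* S) :* (p :* h :+ h :- 1′ :- p :* h :* h)
                      :+ t :* (h :- 1′) :* ((1′ :- p :* h) :* S :- (p :- h))))
             refl T S p h g ⟩
      main + g * ((T - (T - 1#) * S) * _ + (T - 1#) * (h - 1#) * ((1# - p * h) * S - (p - h)))
        ≈⟨ +-congˡ (*-congˡ (+-cong (*-congʳ (vanish T≈[T-1]S))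
             (*-congˡ (vanish (trans (*-congʳ (+-congˡ (-‿cong (sym X²≈ph)))) S-closed))))) ⟩
      main + g * (0# * _ + (T - 1#) * (h - 1#) * 0#)
        ≈⟨ solve 4 (λ m g y x → m :+ g :* (con (+ 0) :* y :+ x :* con (+ 0)) := m) refl main g _ _ ⟩
      main
        ≈⟨ +-cong
             (*-cong (u-shift _ _ (e₂ D j) X²≈ph) (u-shift _ _ (e₃ D j) refl))
             (*-congˡ (*-cong (u-shift _ _ (e₄ D j) refl) (u-shift _ _ (e₅ D j) (X^-+ _ _)))) ⟨
      u (D ℤ.+ + 3 ℤ.+ j) * u (D³ ℤ.+ + 2 ℤ.+ j) +
      (T - 1#) * (u (D ℤ.+ + 2 ℤ.- + 2 ℤ.* D ℤ.+ j) * u (D³ ℤ.+ + 3 ℤ.+ + 2 ℤ.* D ℤ.+ j)) ∎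
      where
      g main : Carrier
      g = Λ * X^ (D ℤ.+ + 1 ℤ.+ j)
      main = (1# - p * h * g) * (1# - h * g) + (T - 1#) * ((1# - p * g) * (1# - h * h * g))

      vanish : ∀ {x y} → x ≈ y → x - y ≈ 0#
      vanish {x} {y} x≈y = trans (+-congʳ x≈y) (-‿inverseʳ y)

      u-shift : ∀ i k {y} → i ≡ k ℤ.+ (D ℤ.+ + 1 ℤ.+ j) → X^ k ≈ y → u i ≈ 1# - y * g
      u-shift i k {y} i≡ Xᵏ≈y = +-congˡ (-‿cong (begin
        Λ * X^ i                             ≈⟨ *-congˡ (trans (X^-cong i≡) (X^-+ _ _)) ⟩
        Λ * (X^ k * X^ (D ℤ.+ + 1 ℤ.+ j))    ≈⟨ *-congˡ (*-congʳ Xᵏ≈y) ⟩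
        Λ * (y * X^ (D ℤ.+ + 1 ℤ.+ j))       ≈⟨ solve 3 (λ l y x → l :* (y :* x) := y :* (l :* x)) refl Λ y _ ⟩
        y * g                                ∎))

      e₁ : ∀ D j → D ℤ.+ (D ℤ.+ (D ℤ.+ + 0)) ℤ.+ + 4 ℤ.+ j ≡ (+ 2 ℤ.+ (+ 2 ℤ.* D ℤ.+ + 1)) ℤ.+ (D ℤ.+ + 1 ℤ.+ j)
      e₁ = ℤSolver.solve-∀
      e₂ : ∀ D j → D ℤ.+ + 3 ℤ.+ j ≡ + 2 ℤ.+ (D ℤ.+ + 1 ℤ.+ j)
      e₂ = ℤSolver.solve-∀
      e₃ : ∀ D j → D ℤ.+ (D ℤ.+ (D ℤ.+ + 0)) ℤ.+ + 2 ℤ.+ j ≡ (+ 2 ℤ.* D ℤ.+ + 1) ℤ.+ (D ℤ.+ + 1 ℤ.+ j)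
      e₃ = ℤSolver.solve-∀
      e₄ : ∀ D j → D ℤ.+ + 2 ℤ.- + 2 ℤ.* D ℤ.+ j ≡ (+ 1 ℤ.- + 2 ℤ.* D) ℤ.+ (D ℤ.+ + 1 ℤ.+ j)
      e₄ = ℤSolver.solve-∀
      e₅ : ∀ D j → D ℤ.+ (D ℤ.+ (D ℤ.+ + 0)) ℤ.+ + 3 ℤ.+ + 2 ℤ.* D ℤ.+ j ≡ ((+ 2 ℤ.* D ℤ.+ + 1) ℤ.+ (+ 2 ℤ.* D ℤ.+ + 1)) ℤ.+ (D ℤ.+ + 1 ℤ.+ j)
      e₅ = ℤSolver.solve-∀

    uw : ∀ {i k} → i ≡ k → u i * w k ≈ 1#
    uw ≡.refl = u*w _

    module _
      (Q : ℤ → Carrier)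
      (Q≈ : ∀ j → Q j ≈ T * ((u (D ℤ.+ + 1 ℤ.+ j) * u (D³ ℤ.+ + 4 ℤ.+ j))
                            * (w (D ℤ.+ + 3 ℤ.+ j) * w (D³ ℤ.+ + 2 ℤ.+ j))))
      (j : ℤ)
      where

      -- The partial product over ℓ ≤ n, after cancellation.
      P : ℕ → Carrier
      P n = (T ^ 2) ^ n *
        ((u (D ℤ.+ + 2 ℤ.- + 2 ℤ.* + n ℤ.+ j) * u (D³ ℤ.+ + 3 ℤ.+ + 2 ℤ.* + n ℤ.+ j))
        * (w (D ℤ.+ + 2 ℤ.+ + 2 ℤ.* + n ℤ.+ j) * w (D³ ℤ.+ + 3 ℤ.- + 2 ℤ.* + n ℤ.+ j)))

      P-zero : P 0 ≈ 1#
      P-zero = begin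
        P 0                                ≈⟨ solve 4 (λ a b c e → con (+ 1) :* ((a :* b) :* (c :* e)) := (a :* c) :* (b :* e)) refl _ _ _ _ ⟩
        (u (D ℤ.+ + 2 ℤ.- + 0 ℤ.+ j) * w (D ℤ.+ + 2 ℤ.+ + 0 ℤ.+ j)) *
        (u (D³ ℤ.+ + 3 ℤ.+ + 0 ℤ.+ j) * w (D³ ℤ.+ + 3 ℤ.- + 0 ℤ.+ j))
                                           ≈⟨ *-cong (uw ≡.refl) (uw ≡.refl) ⟩
        1# * 1#                            ≈⟨ *-identityˡ 1# ⟩
        1#                                 ∎

      factor : ℕ → Carrier
      factor n = Q (j ℤ.+ + 2 ℤ.* + suc n ℤ.- + 1) * Q (j ℤ.- + 2 ℤ.* + suc n ℤ.+ + 1)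

      P-suc : ∀ n → P (suc n) ≈ P n * factor n
      P-suc n = sym (begin
        P n * factor n
          ≈⟨ *-congˡ (*-cong (Q≈ _) (Q≈ _)) ⟩
        P n * (T * ((u i₁ * u i₂) * (w i₃ * w i₄)) * (T * ((u i₅ * u i₆) * (w i₇ * w i₈))))
          -- The four end factors of `P n` cancel against u₁, w₄, w₇ and u₆. The remaining u₅, u₂,
          -- w₃ and w₈ are the end factors of `P (suc n)`, each with its index moved by 2 up or
          -- down.
          ≈⟨ solve 14 (λ T t uγ uβ wα wδ u₁ u₂ w₃ w₄ u₅ u₆ w₇ w₈ →
               (t :* ((uγ :* uβ) :* (wα :* wδ))) :*
               (T :* ((u₁ :* u₂) :* (w₃ :* w₄)) :* (T :* ((u₅ :* u₆) :* (w₇ :* w₈)))) :=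
               (T :* (T :* con (+ 1)) :* t :* ((u₅ :* u₂) :* (w₃ :* w₈)))
               :* ((u₁ :* wα) :* (uβ :* w₄) :* ((uγ :* w₇) :* (u₆ :* wδ))))
               refl T _ _ _ _ _ _ _ _ _ _ _ _ _ ⟩
        (T * (T * 1#) * (T ^ 2) ^ n * ((u i₅ * u i₂) * (w i₃ * w i₈))) *
        ((u i₁ * w _) * (u _ * w i₄) * ((u _ * w i₇) * (u i₆ * w _)))
          ≈⟨ *-cong (*-congˡ (*-cong
               (*-cong (u-cong (e₅ D j N)) (u-cong (e₂ D j N)))
               (*-cong (w-cong (e₃ D j N)) (w-cong (e₈ D j N)))))
               (*-cong (*-cong (uw (e₁ D j N)) (uw (e₄ D j N))) (*-cong (uw (e₇ D j N)) (uw (e₆ D j N)))) ⟩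
        P (suc n) * (1# * 1# * (1# * 1#))
          ≈⟨ solve 1 (λ x → x :* (con (+ 1) :* con (+ 1) :* (con (+ 1) :* con (+ 1))) := x) refl _ ⟩
        P (suc n) ∎)
        where
        N i₁ i₂ i₃ i₄ i₅ i₆ i₇ i₈ k k′ : ℤ
        N  = + n
        k  = j ℤ.+ + 2 ℤ.* + suc n ℤ.- + 1
        k′ = j ℤ.- + 2 ℤ.* + suc n ℤ.+ + 1
        i₁ = D ℤ.+ + 1 ℤ.+ k
        i₂ = D³ ℤ.+ + 4 ℤ.+ k
        i₃ = D ℤ.+ + 3 ℤ.+ k
        i₄ = D³ ℤ.+ + 2 ℤ.+ k
        i₅ = D ℤ.+ + 1 ℤ.+ k′
        i₆ = D³ ℤ.+ + 4 ℤ.+ k′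
        i₇ = D ℤ.+ + 3 ℤ.+ k′
        i₈ = D³ ℤ.+ + 2 ℤ.+ k′

        u-cong : ∀ {i i′} → i ≡ i′ → u i ≈ u i′
        u-cong i≡i′ = reflexive (≡.cong u i≡i′)
        w-cong : ∀ {i i′} → i ≡ i′ → w i ≈ w i′
        w-cong i≡i′ = reflexive (≡.cong w i≡i′)

        e₁ : ∀ D j N → D ℤ.+ + 1 ℤ.+ (j ℤ.+ + 2 ℤ.* (+ 1 ℤ.+ N) ℤ.- + 1) ≡ D ℤ.+ + 2 ℤ.+ + 2 ℤ.* N ℤ.+ j
        e₁ = ℤSolver.solve-∀
        e₂ : ∀ D j N → D ℤ.+ (D ℤ.+ (D ℤ.+ + 0)) ℤ.+ + 4 ℤ.+ (j ℤ.+ + 2 ℤ.* (+ 1 ℤ.+ N) ℤ.- + 1) ≡ D ℤ.+ (D ℤ.+ (D ℤ.+ + 0)) ℤ.+ + 3 ℤ.+ + 2 ℤ.* (+ 1 ℤ.+ N) ℤ.+ j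
        e₂ = ℤSolver.solve-∀
        e₃ : ∀ D j N → D ℤ.+ + 3 ℤ.+ (j ℤ.+ + 2 ℤ.* (+ 1 ℤ.+ N) ℤ.- + 1) ≡ D ℤ.+ + 2 ℤ.+ + 2 ℤ.* (+ 1 ℤ.+ N) ℤ.+ j
        e₃ = ℤSolver.solve-∀
        e₄ : ∀ D j N → D ℤ.+ (D ℤ.+ (D ℤ.+ + 0)) ℤ.+ + 3 ℤ.+ + 2 ℤ.* N ℤ.+ j ≡ D ℤ.+ (D ℤ.+ (D ℤ.+ + 0)) ℤ.+ + 2 ℤ.+ (j ℤ.+ + 2 ℤ.* (+ 1 ℤ.+ N) ℤ.- + 1)
        e₄ = ℤSolver.solve-∀
        e₅ : ∀ D j N → D ℤ.+ + 1 ℤ.+ (j ℤ.- + 2 ℤ.* (+ 1 ℤ.+ N) ℤ.+ + 1) ≡ D ℤ.+ + 2 ℤ.- + 2 ℤ.* (+ 1 ℤ.+ N) ℤ.+ j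
        e₅ = ℤSolver.solve-∀
        e₆ : ∀ D j N → D ℤ.+ (D ℤ.+ (D ℤ.+ + 0)) ℤ.+ + 4 ℤ.+ (j ℤ.- + 2 ℤ.* (+ 1 ℤ.+ N) ℤ.+ + 1) ≡ D ℤ.+ (D ℤ.+ (D ℤ.+ + 0)) ℤ.+ + 3 ℤ.- + 2 ℤ.* N ℤ.+ j
        e₆ = ℤSolver.solve-∀
        e₇ : ∀ D j N → D ℤ.+ + 2 ℤ.- + 2 ℤ.* N ℤ.+ j ≡ D ℤ.+ + 3 ℤ.+ (j ℤ.- + 2 ℤ.* (+ 1 ℤ.+ N) ℤ.+ + 1)
        e₇ = ℤSolver.solve-∀
        e₈ : ∀ D j N → D ℤ.+ (D ℤ.+ (D ℤ.+ + 0)) ℤ.+ + 2 ℤ.+ (j ℤ.- + 2 ℤ.* (+ 1 ℤ.+ N) ℤ.+ + 1) ≡ D ℤ.+ (D ℤ.+ (D ℤ.+ + 0)) ℤ.+ + 3 ℤ.- + 2 ℤ.* (+ 1 ℤ.+ N) ℤ.+ j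
        e₈ = ℤSolver.solve-∀

      recurrence : Q j ≈ 1# + z * product {d} (factor ∘ toℕ)
      recurrence = begin
        Q j
          ≈⟨ Q≈ j ⟩
        T * ((u (D ℤ.+ + 1 ℤ.+ j) * u (D³ ℤ.+ + 4 ℤ.+ j)) * (w₁ * w₂))
          ≈⟨ solve 4 (λ a b c e → a :* (b :* (c :* e)) := (a :* b) :* (c :* e)) refl _ _ _ _ ⟩
        T * (u (D ℤ.+ + 1 ℤ.+ j) * u (D³ ℤ.+ + 4 ℤ.+ j)) * (w₁ * w₂)
          ≈⟨ *-congʳ (key j) ⟩
        (u (D ℤ.+ + 3 ℤ.+ j) * u (D³ ℤ.+ + 2 ℤ.+ j) + (T - 1#) * U) * (w₁ * w₂)
          -- The denominators are swapped because those of `P d` are those of `Q j` in the opposite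
          -- order: d+2+2d = 3d+2 and 3d+3-2d = d+3. This coincidence reduces the recurrence to the
          -- polynomial identity `key`.
          ≈⟨ solve 6 (λ a b t v c e → (a :* b :+ t :* v) :* (c :* e) := (a :* c) :* (b :* e) :+ t :* (v :* (e :* c))) refl _ _ _ _ _ _ ⟩
        (u (D ℤ.+ + 3 ℤ.+ j) * w₁) * (u (D³ ℤ.+ + 2 ℤ.+ j) * w₂) + (T - 1#) * (U * (w₂ * w₁))
          ≈⟨ +-cong (trans (*-cong (uw ≡.refl) (uw ≡.refl)) (*-identityˡ 1#))
                    (*-cong (sym zT²ᵈ) (*-congˡ (*-cong (w-cong (f₂ D j)) (w-cong (f₁ D j))))) ⟩
        1# + z * T ^ (2 ℕ.* d) * (U * _)
          ≈⟨ +-congˡ (trans (*-assoc _ _ _) (*-congˡ (*-congʳ (sym (^-assocʳ T 2 d))))) ⟩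
        1# + z * P d
          ≈⟨ +-congˡ (*-congˡ (telescope-product factor P P-suc d)) ⟨
        1# + z * (P 0 * product {d} (factor ∘ toℕ))
          ≈⟨ +-congˡ (*-congˡ (trans (*-congʳ P-zero) (*-identityˡ _))) ⟩
        1# + z * product {d} (factor ∘ toℕ) ∎
        where
        open import Algebra.Properties.Semiring.Exp semiring using (^-assocʳ)
        U w₁ w₂ : Carrier
        U  = u (D ℤ.+ + 2 ℤ.- + 2 ℤ.* D ℤ.+ j) * u (D³ ℤ.+ + 3 ℤ.+ + 2 ℤ.* D ℤ.+ j)
        w₁ = w (D ℤ.+ + 3 ℤ.+ j)
        w₂ = w (D³ ℤ.+ + 2 ℤ.+ j)

        w-cong : ∀ {i i′} → i ≡ i′ → w i ≈ w i′
        w-cong i≡i′ = reflexive (≡.cong w i≡i′)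

        f₁ : ∀ D j → D ℤ.+ + 3 ℤ.+ j ≡ D ℤ.+ (D ℤ.+ (D ℤ.+ + 0)) ℤ.+ + 3 ℤ.- + 2 ℤ.* D ℤ.+ j
        f₁ = ℤSolver.solve-∀
        f₂ : ∀ D j → D ℤ.+ (D ℤ.+ (D ℤ.+ + 0)) ℤ.+ + 2 ℤ.+ j ≡ D ℤ.+ + 2 ℤ.+ + 2 ℤ.* D ℤ.+ j
        f₂ = ℤSolver.solve-∀

-- The operations are parameters, rather than fields of a bundle, so that the
-- types below can agree syntactically with the theorem about Puiseux series:
-- conversion checking by unfolding the arithmetic of K is infeasible.
module FieldRecurrence
  {a ℓ} {K : Set a}
  (_≈_ : K → K → Set ℓ) (_+_ _*_ : K → K → K) (-_ : K → K) (0# 1# : K)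
  (isCommutativeRing : IsCommutativeRing _≈_ _+_ _*_ -_ 0# 1#)
  (_-_ : K → K → K) (-‿def : ∀ x y → (x - y) ≡ (x + (- y)))
  (_^_ : K → ℕ → K) (^-zero : ∀ x → (x ^ 0) ≡ 1#) (^-suc : ∀ x n → (x ^ suc n) ≡ (x * (x ^ n)))
  (sum product : ∀ {n} → (Fin n → K) → K)
  (sum-zero : ∀ f → sum {0} f ≡ 0#) (sum-suc : ∀ {n} f → sum {suc n} f ≡ (f Fin.zero + sum {n} (f ∘ Fin.suc)))
  (product-zero : ∀ f → product {0} f ≡ 1#) (product-suc : ∀ {n} f → product {suc n} f ≡ (f Fin.zero * product {n} (f ∘ Fin.suc)))
  (_⁻¹ : K → K)
  (⁻¹-inverseʳ : ∀ x → ∃[ y ] (x * y) ≈ 1# → (x * (x ⁻¹)) ≈ 1#)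
  (invertible⊎⁻¹≡0 : ∀ x → (∃[ y ] (x * y) ≈ 1#) ⊎ (x ⁻¹) ≡ 0#)
  (≉0⇒invertible : ∀ x → ¬ (x ≈ 0#) → ∃[ y ] (x * y) ≈ 1#)
  (_/_ : K → K → K) (/-def : ∀ x y → (x / y) ≡ (x * (y ⁻¹)))
  (_^ᶻ_ : K → ℤ → K) (^ᶻ-pos : ∀ x n → (x ^ᶻ (+ n)) ≡ (x ^ n)) (^ᶻ-neg : ∀ x n → (x ^ᶻ -[1+ n ]) ≡ ((x ⁻¹) ^ suc n))
  (odd : ∀ {d} → Fin d → ℤ) (odd-def : ∀ {d} (i : Fin d) → odd i ≡ + 2 ℤ.* + suc (toℕ i) ℤ.- + 1)
  where

  private
    R : CommutativeRing a ℓ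
    R = record { isCommutativeRing = isCommutativeRing }
    module R = CommutativeRing R
    module RD where
      open import Algebra.Definitions.RawSemiring (Semiring.rawSemiring R.semiring) public using (_^_; sum; product)
    open IntegerPower R

    ^-≡ : ∀ x n → (x ^ n) ≡ x RD.^ n
    ^-≡ x zero    = ^-zero x
    ^-≡ x (suc n) = ≡.trans (^-suc x n) (≡.cong (x *_) (^-≡ x n))

    sum-≡ : ∀ {n} {f g : Fin n → K} → (∀ i → f i ≡ g i) → sum {n} f ≡ RD.sum {n} g
    sum-≡ {zero}  {f} f≡g = sum-zero f
    sum-≡ {suc n} {f} f≡g = ≡.trans (sum-suc f) (≡.cong₂ _+_ (f≡g Fin.zero) (sum-≡ (f≡g ∘ Fin.suc)))

    product-≡ : ∀ {n} (f : Fin n → K) → product {n} f ≡ RD.product {n} f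
    product-≡ {zero}  f = product-zero f
    product-≡ {suc n} f = ≡.trans (product-suc f) (≡.cong (f Fin.zero *_) (product-≡ (f ∘ Fin.suc)))

  recurrence :
    ∀ d → 1 ℕ.≤ d → ∀ z T → T ≈ (1# + (z * (T ^ (2 ℕ.* d)))) →
    ∀ X → 1# ≈ ((z * (T ^ (2 ℕ.* d ℕ.∸ 1))) * sum {d} (λ i → (X ^ᶻ odd i) + (X ^ᶻ (ℤ.- odd i)))) →
    ∀ Λ → (∀ k → ¬ ((1# - (Λ * (X ^ᶻ k))) ≈ 0#)) →
    let Q : ℤ → K
        Q j = let u : ℤ → K
                  u k = 1# - (Λ * (X ^ᶻ (k ℤ.+ j)))
              in T * ((u (+ (d ℕ.+ 1)) * u (+ (3 ℕ.* d ℕ.+ 4)))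
                    / (u (+ (d ℕ.+ 3)) * u (+ (3 ℕ.* d ℕ.+ 2))))
    in ∀ j → Q j ≈ (1# + (z * product {d} (λ i → let ℓ = + suc (toℕ i) in
         Q (j ℤ.+ + 2 ℤ.* ℓ ℤ.- + 1) * Q (j ℤ.- + 2 ℤ.* ℓ ℤ.+ + 1))))
  recurrence d 1≤d z T T-equation X characteristic Λ u≉0 j =
    R.trans (Tel.recurrence Q Q≈ j) (R.+-congˡ (R.*-congˡ (R.reflexive (≡.sym (product-≡ {d} _)))))
    where
    u w : ℤ → K
    u k = 1# - (Λ * (X ^ᶻ k))
    w k = u k ⁻¹

    u*w : ∀ k → (u k * w k) ≈ 1#
    u*w k = ⁻¹-inverseʳ (u k) (≉0⇒invertible (u k) (u≉0 k))

    pos : ∀ n → (X ^ᶻ (+ n)) ≈ (X RD.^ n)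
    pos n = R.reflexive (≡.trans (^ᶻ-pos X n) (^-≡ X n))
    neg : ∀ n → (X ^ᶻ -[1+ n ]) ≈ ((X ⁻¹) RD.^ suc n)
    neg n = R.reflexive (≡.trans (^ᶻ-neg X n) (^-≡ (X ⁻¹) (suc n)))

    characteristic′ : 1# ≈ ((z * (T RD.^ (2 ℕ.* d ℕ.∸ 1))) * RD.sum {d} (λ i →
      (X ^ᶻ (+ 2 ℤ.* + suc (toℕ i) ℤ.- + 1)) + (X ^ᶻ (ℤ.- (+ 2 ℤ.* + suc (toℕ i) ℤ.- + 1)))))
    characteristic′ = R.trans characteristic (R.reflexive (≡.cong₂ (λ p s → (z * p) * s)
      (^-≡ T (2 ℕ.* d ℕ.∸ 1))
      (sum-≡ {d} (λ i → ≡.cong (λ k → (X ^ᶻ k) + (X ^ᶻ (ℤ.- k))) (odd-def i)))))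

    -- No hypothesis states X ≉ 0, so invertibility is read off the characteristic equation, whose
    -- negative powers are built from `X ⁻¹` even when that is the default value 0.
    X-invertible : (X * (X ⁻¹)) ≈ 1#
    X-invertible = ⁻¹-inverseʳ X (go (invertible⊎⁻¹≡0 X))
      where
      go : (∃[ y ] (X * y) ≈ 1#) ⊎ (X ⁻¹) ≡ 0# → ∃[ y ] (X * y) ≈ 1#
      go (inj₁ invertible) = invertible
      go (inj₂ X⁻¹≡0)      = characteristic⇒invertible X (X ⁻¹) (R.reflexive X⁻¹≡0) (X ^ᶻ_) pos neg
        (z * (T RD.^ (2 ℕ.* d ℕ.∸ 1))) {d} characteristic′

    module Tel = Telescope.Recurrence R d 1≤d z T Λ
      (R.trans T-equation (R.reflexive (≡.cong (λ p → 1# + (z * p)) (^-≡ T (2 ℕ.* d)))))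
      (X ^ᶻ_) (pos 0) (x^-+ X (X ⁻¹) X-invertible (X ^ᶻ_) pos neg) characteristic′ w
      (λ k → R.trans (R.*-congʳ (R.reflexive (≡.sym (-‿def 1# (Λ * (X ^ᶻ k)))))) (u*w k))

    Q : ℤ → K
    Q j = T * ((u (+ (d ℕ.+ 1) ℤ.+ j) * u (+ (3 ℕ.* d ℕ.+ 4) ℤ.+ j))
             / (u (+ (d ℕ.+ 3) ℤ.+ j) * u (+ (3 ℕ.* d ℕ.+ 2) ℤ.+ j)))

    -- `_⁻¹` is only some choice of inverse and is not known to be multiplicative; uniqueness of
    -- inverses supplies this.
    *-⁻¹ : ∀ i k → ((u i * u k) ⁻¹) ≈ (w i * w k)
    *-⁻¹ i k = inverse-unique (⁻¹-inverseʳ (u i * u k) (w i * w k , *-inverse (u*w i) (u*w k))) (*-inverse (u*w i) (u*w k))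

    Q≈ : ∀ j → Q j ≈ (T * ((Tel.u (+ (d ℕ.+ 1) ℤ.+ j) * Tel.u (+ (3 ℕ.* d ℕ.+ 4) ℤ.+ j))
                         * (w (+ (d ℕ.+ 3) ℤ.+ j) * w (+ (3 ℕ.* d ℕ.+ 2) ℤ.+ j))))
    Q≈ j = R.*-congˡ (R.trans (R.reflexive (/-def _ _))
      (R.*-cong (R.*-cong (R.reflexive (-‿def _ _)) (R.reflexive (-‿def _ _))) (*-⁻¹ _ _)))

-- Ring structure along an injective homomorphism

module _ {a ℓ₁ b ℓ₂} (R : RawRing a ℓ₁) (S : CommutativeRing b ℓ₂) where
  private
    module R = RawRing R
    module S = CommutativeRing S

  pullback : (f : R.Carrier → S.Carrier) →
    (∀ {x y} → x R.≈ y → f x S.≈ f y) → (∀ {x y} → f x S.≈ f y → x R.≈ y) →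
    (∀ x y → f (x R.+ y) S.≈ f x S.+ f y) → (∀ x y → f (x R.* y) S.≈ f x S.* f y) →
    (∀ x → f (R.- x) S.≈ S.- f x) → f R.0# S.≈ S.0# → f R.1# S.≈ S.1# →
    CommutativeRing a ℓ₁
  pullback f cong injective +-homo *-homo -‿homo 0-homo 1-homo = record
    { isCommutativeRing = RingMonomorphism.isCommutativeRing {R₁ = R} {R₂ = S.rawRing} {⟦_⟧ = f}
      (record
        { isRingHomomorphism = record
          { isSemiringHomomorphism = record
            { isNearSemiringHomomorphism = record
              { +-isMonoidHomomorphism = record
                { isMagmaHomomorphism = record
                  { isRelHomomorphism = record { cong = cong }
                  ; homo = +-homo
                  }
                ; ε-homo = 0-homo
                }
              ; *-homo = *-homo
              }
            ; 1#-homo = 1-homo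
            }
          ; -‿homo = -‿homo
          }
        ; injective = injective
        })
      S.isCommutativeRing
    }

-- ℂ, power series and Puiseux series over an arbitrary ring

module Complexification {c ℓ} (R : CommutativeRing c ℓ) where
  open CommutativeRing R
  open IntegerSolver R

  record Complex : Set c where
    constructor _+i_
    field
      re im : Carrier

  open Complex

  infix  4 _≈ᶜ_
  infixl 7 _*ᶜ_
  infixl 6 _+ᶜ_

  _≈ᶜ_ : Complex → Complex → Set ℓ
  v ≈ᶜ w = re v ≈ re w × im v ≈ im w

  _+ᶜ_ _*ᶜ_ : Complex → Complex → Complex
  v +ᶜ w = (re v + re w) +i (im v + im w)
  v *ᶜ w = (re v * re w - im v * im w) +i (re v * im w + im v * re w)

  -ᶜ_ : Complex → Complex
  -ᶜ v = (- re v) +i (- im v)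

  0ᶜ 1ᶜ : Complex
  0ᶜ = 0# +i 0#
  1ᶜ = 1# +i 0#

  *ᶜ-comm : ∀ v w → v *ᶜ w ≈ᶜ w *ᶜ v
  *ᶜ-comm (a +i b) (c +i d) =
    solve 4 (λ a b c d → a :* c :- b :* d := c :* a :- d :* b) refl a b c d ,
    solve 4 (λ a b c d → a :* d :+ b :* c := c :* b :+ d :* a) refl a b c d

  *ᶜ-identityˡ : ∀ v → 1ᶜ *ᶜ v ≈ᶜ v
  *ᶜ-identityˡ (a +i b) =
    solve 2 (λ a b → con (+ 1) :* a :- con (+ 0) :* b := a) refl a b ,
    solve 2 (λ a b → con (+ 1) :* b :+ con (+ 0) :* a := b) refl a b

  *ᶜ-assoc : ∀ u v w → (u *ᶜ v) *ᶜ w ≈ᶜ u *ᶜ (v *ᶜ w)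
  *ᶜ-assoc (a +i b) (c +i d) (e +i f) =
    solve 6 (λ a b c d e f → (a :* c :- b :* d) :* e :- (a :* d :+ b :* c) :* f :=
                             a :* (c :* e :- d :* f) :- b :* (c :* f :+ d :* e)) refl a b c d e f ,
    solve 6 (λ a b c d e f → (a :* c :- b :* d) :* f :+ (a :* d :+ b :* c) :* e :=
                             a :* (c :* f :+ d :* e) :+ b :* (c :* e :- d :* f)) refl a b c d e f

  *ᶜ-distribˡ-+ᶜ : ∀ u v w → u *ᶜ (v +ᶜ w) ≈ᶜ u *ᶜ v +ᶜ u *ᶜ w
  *ᶜ-distribˡ-+ᶜ (a +i b) (c +i d) (e +i f) =
    solve 6 (λ a b c d e f → a :* (c :+ e) :- b :* (d :+ f) :=
                             (a :* c :- b :* d) :+ (a :* e :- b :* f)) refl a b c d e f ,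
    solve 6 (λ a b c d e f → a :* (d :+ f) :+ b :* (c :+ e) :=
                             (a :* d :+ b :* c) :+ (a :* f :+ b :* e)) refl a b c d e f

  *ᶜ-distribʳ-+ᶜ : ∀ u v w → (v +ᶜ w) *ᶜ u ≈ᶜ v *ᶜ u +ᶜ w *ᶜ u
  *ᶜ-distribʳ-+ᶜ (a +i b) (c +i d) (e +i f) =
    solve 6 (λ a b c d e f → (c :+ e) :* a :- (d :+ f) :* b :=
                             (c :* a :- d :* b) :+ (e :* a :- f :* b)) refl a b c d e f ,
    solve 6 (λ a b c d e f → (c :+ e) :* b :+ (d :+ f) :* a :=
                             (c :* b :+ d :* a) :+ (e :* b :+ f :* a)) refl a b c d e f

  isCommutativeRingᶜ : IsCommutativeRing _≈ᶜ_ _+ᶜ_ _*ᶜ_ -ᶜ_ 0ᶜ 1ᶜ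
  isCommutativeRingᶜ = record
    { isRing = record
      { +-isAbelianGroup = record
        { isGroup = record
          { isMonoid = record
            { isSemigroup = record
              { isMagma = record
                { isEquivalence = record
                  { refl  = refl , refl
                  ; sym   = λ (p , q) → sym p , sym q
                  ; trans = λ (p , q) (r , s) → trans p r , trans q s
                  }
                ; ∙-cong = λ (p , q) (r , s) → +-cong p r , +-cong q s
                }
              ; assoc = λ u v w → +-assoc _ _ _ , +-assoc _ _ _
              }
            ; identity = (λ v → +-identityˡ _ , +-identityˡ _) , (λ v → +-identityʳ _ , +-identityʳ _)
            }
          ; inverse = (λ v → -‿inverseˡ _ , -‿inverseˡ _) , (λ v → -‿inverseʳ _ , -‿inverseʳ _)
          ; ⁻¹-cong = λ (p , q) → -‿cong p , -‿cong q
          }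
        ; comm = λ v w → +-comm _ _ , +-comm _ _
        }
      ; *-cong = λ (p , q) (r , s) →
          +-cong (*-cong p r) (-‿cong (*-cong q s)) , +-cong (*-cong p s) (*-cong q r)
      ; *-assoc = *ᶜ-assoc
      ; *-identity = *ᶜ-identityˡ , λ v → let (p , q) = *ᶜ-comm v 1ᶜ ; (r , s) = *ᶜ-identityˡ v in trans p r , trans q s
      ; distrib = *ᶜ-distribˡ-+ᶜ , *ᶜ-distribʳ-+ᶜ
      }
    ; *-comm = *ᶜ-comm
    }

  complexRing : CommutativeRing c ℓ
  complexRing = record { isCommutativeRing = isCommutativeRingᶜ }

  -- The inverse is the conjugate divided by the norm, with `t` as the reciprocal of the norm.
  inverseᶜ : ∀ v t → (re v * re v + im v * im v) * t ≈ 1# → ∃[ w ] v *ᶜ w ≈ᶜ 1ᶜ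
  inverseᶜ (a +i b) t st≈1 = ((a * t) +i (- (b * t))) ,
    trans (solve 3 (λ a b t → a :* (a :* t) :- b :* (:- (b :* t)) := (a :* a :+ b :* b) :* t) refl a b t) st≈1 ,
    solve 3 (λ a b t → a :* (:- (b :* t)) :+ b :* (a :* t) := con (+ 0)) refl a b t

-- Puiseux series as a commutative ring

module PuiseuxSeries {c ℓ} (S : CommutativeRing c ℓ) where
  open CommutativeRing S hiding (zero)
  open IntegerSolver S
  open import Algebra.Definitions.RawSemiring (Semiring.rawSemiring semiring) using (_^_)
  open import Algebra.Properties.Semiring.Exp semiring using (^-homo-*)
  open import Algebra.Properties.Group +-group using (inverseʳ-unique)
  open import Relation.Binary.Reasoning.Setoid setoid

  -- Here `φ k` stands for the substitution z ↦ zᵏ and `raise e` for multiplication by zᵉ. The ring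
  -- laws are derived from these facts alone: z can be cancelled, each `φ k` is an injective
  -- endomorphism taking z to zᵏ, and substitutions compose.
  module Laws
    (z : Carrier)
    (raise φ : ℕ → Carrier → Carrier)
    (raise-z : ∀ e a → raise e a ≈ z ^ e * a)
    (z^-cancel : ∀ e a b → z ^ e * a ≈ z ^ e * b → a ≈ b)
    (φ-1 : ∀ a → φ 1 a ≈ a)
    (φ-cong : ∀ k {{_ : NonZero k}} {a b} → a ≈ b → φ k a ≈ φ k b)
    (φ-injective : ∀ k {{_ : NonZero k}} a b → φ k a ≈ φ k b → a ≈ b)
    (φ-z^ : ∀ k {{_ : NonZero k}} e → φ k (z ^ e) ≈ z ^ (e ℕ.* k))
    (φ-+ : ∀ k {{_ : NonZero k}} a b → φ k (a + b) ≈ φ k a + φ k b)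
    (φ-* : ∀ k {{_ : NonZero k}} a b → φ k (a * b) ≈ φ k a * φ k b)
    (φ-φ : ∀ k l {{_ : NonZero k}} {{_ : NonZero l}} a → φ k (φ l a) ≈ φ (k ℕ.* l) a)
    where

    private
      -- Rewriting a numerator for a larger ramification index and pole order always has this form.
      -- On exponents it acts as i ↦ e + k i.
      M : ℕ → ℕ → Carrier → Carrier
      M e k a = raise e (φ k a)

      N : ℕ → ℕ → ℕ → Carrier → Carrier → Carrier
      N e k l a b = z ^ e * (φ k a * φ l b)

      φ-0 : ∀ k {{_ : NonZero k}} → φ k 0# ≈ 0#
      φ-0 k = begin
        φ k 0#                            ≈⟨ solve 1 (λ x → x := (x :+ x) :- x) refl (φ k 0#) ⟩
        (φ k 0# + φ k 0#) - φ k 0#        ≈⟨ +-congʳ (φ-+ k 0# 0#) ⟨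
        φ k (0# + 0#) - φ k 0#            ≈⟨ +-congʳ (φ-cong k (+-identityʳ 0#)) ⟩
        φ k 0# - φ k 0#                   ≈⟨ -‿inverseʳ _ ⟩
        0#                                ∎

      φ-neg : ∀ k {{_ : NonZero k}} a → φ k (- a) ≈ - φ k a
      φ-neg k a = inverseʳ-unique (φ k a) (φ k (- a)) (begin
        φ k a + φ k (- a)    ≈⟨ φ-+ k a (- a) ⟨
        φ k (a - a)          ≈⟨ φ-cong k (-‿inverseʳ a) ⟩
        φ k 0#               ≈⟨ φ-0 k ⟩
        0#                   ∎)

      raise-cong : ∀ e {a b} → a ≈ b → raise e a ≈ raise e b
      raise-cong e a≈b = trans (raise-z e _) (trans (*-congˡ a≈b) (sym (raise-z e _)))

      raise-0 : ∀ a → raise 0 a ≈ a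
      raise-0 a = trans (raise-z 0 a) (*-identityˡ a)

      M-cong : ∀ e k {{_ : NonZero k}} {a b} → a ≈ b → M e k a ≈ M e k b
      M-cong e k a≈b = raise-cong e (φ-cong k a≈b)

      M-≡ : ∀ {e e′ k k′ a} → e ≡ e′ → k ≡ k′ → M e k a ≈ M e′ k′ a
      M-≡ ≡.refl ≡.refl = refl

      N-≡ : ∀ {e e′ k k′ l l′ a b} → e ≡ e′ → k ≡ k′ → l ≡ l′ → N e k l a b ≈ N e′ k′ l′ a b
      N-≡ ≡.refl ≡.refl ≡.refl = refl

      M-+ : ∀ e k {{_ : NonZero k}} a b → M e k (a + b) ≈ M e k a + M e k b
      M-+ e k a b = begin
        M e k (a + b)                    ≈⟨ raise-z e _ ⟩
        z ^ e * φ k (a + b)              ≈⟨ *-congˡ (φ-+ k a b) ⟩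
        z ^ e * (φ k a + φ k b)          ≈⟨ distribˡ _ _ _ ⟩
        z ^ e * φ k a + z ^ e * φ k b    ≈⟨ +-cong (raise-z e _) (raise-z e _) ⟨
        M e k a + M e k b                ∎

      M-0 : ∀ e k {{_ : NonZero k}} → M e k 0# ≈ 0#
      M-0 e k = trans (raise-z e _) (trans (*-congˡ (φ-0 k)) (zeroʳ _))

      M-neg : ∀ e k {{_ : NonZero k}} a → M e k (- a) ≈ - M e k a
      M-neg e k a = begin
        M e k (- a)          ≈⟨ raise-z e _ ⟩
        z ^ e * φ k (- a)    ≈⟨ *-congˡ (φ-neg k a) ⟩
        z ^ e * - φ k a      ≈⟨ solve 2 (λ x y → x :* (:- y) := :- (x :* y)) refl _ _ ⟩
        - (z ^ e * φ k a)    ≈⟨ -‿cong (raise-z e _) ⟨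
        - M e k a            ∎

      φ-M : ∀ l e k {{_ : NonZero l}} {{_ : NonZero k}} a → φ l (M e k a) ≈ z ^ (e ℕ.* l) * φ (l ℕ.* k) a
      φ-M l e k a = begin
        φ l (M e k a)                      ≈⟨ φ-cong l (raise-z e _) ⟩
        φ l (z ^ e * φ k a)                ≈⟨ φ-* l _ _ ⟩
        φ l (z ^ e) * φ l (φ k a)          ≈⟨ *-cong (φ-z^ l e) (φ-φ l k a) ⟩
        z ^ (e ℕ.* l) * φ (l ℕ.* k) a      ∎

      -- Composition of the affine maps i ↦ e + k i and i ↦ f + l i.
      M-M : ∀ f l e k {{_ : NonZero l}} {{_ : NonZero k}} a → M f l (M e k a) ≈ M (f ℕ.+ e ℕ.* l) (l ℕ.* k) a
      M-M f l e k a = begin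
        M f l (M e k a)                              ≈⟨ raise-z f _ ⟩
        z ^ f * φ l (M e k a)                        ≈⟨ *-congˡ (φ-M l e k a) ⟩
        z ^ f * (z ^ (e ℕ.* l) * φ (l ℕ.* k) a)      ≈⟨ *-assoc _ _ _ ⟨
        z ^ f * z ^ (e ℕ.* l) * φ (l ℕ.* k) a        ≈⟨ *-congʳ (^-homo-* z f (e ℕ.* l)) ⟨
        z ^ (f ℕ.+ e ℕ.* l) * φ (l ℕ.* k) a          ≈⟨ raise-z _ _ ⟨
        M (f ℕ.+ e ℕ.* l) (l ℕ.* k) a                ∎

      M-injective : ∀ e k {{_ : NonZero k}} {a b} → M e k a ≈ M e k b → a ≈ b
      M-injective e k {a} {b} p = φ-injective k a b (z^-cancel e _ _
        (trans (sym (raise-z e _)) (trans p (raise-z e _))))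

      M-N : ∀ f j k l {{_ : NonZero j}} {{_ : NonZero k}} {{_ : NonZero l}} a b →
        M f j (φ k a * φ l b) ≈ N f (j ℕ.* k) (j ℕ.* l) a b
      M-N f j k l a b = begin
        M f j (φ k a * φ l b)                    ≈⟨ raise-z f _ ⟩
        z ^ f * φ j (φ k a * φ l b)              ≈⟨ *-congˡ (φ-* j _ _) ⟩
        z ^ f * (φ j (φ k a) * φ j (φ l b))      ≈⟨ *-congˡ (*-cong (φ-φ j k a) (φ-φ j l b)) ⟩
        N f (j ℕ.* k) (j ℕ.* l) a b              ∎

      raise-N : ∀ f e k l a b → raise f (N e k l a b) ≈ N (f ℕ.+ e) k l a b
      raise-N f e k l a b = begin
        raise f (N e k l a b)                    ≈⟨ raise-z f _ ⟩
        z ^ f * (z ^ e * (φ k a * φ l b))        ≈⟨ *-assoc _ _ _ ⟨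
        z ^ f * z ^ e * (φ k a * φ l b)          ≈⟨ *-congʳ (^-homo-* z f e) ⟨
        N (f ℕ.+ e) k l a b                      ∎

    -- The record and its operations repeat those of `K` over an arbitrary ring, so that repacking
    -- `K` into it respects the operations by reflexivity.
    record Puiseux : Set c where
      constructor ⟨_,_,_⟩
      field
        ram       : ℕ
        pole      : ℕ
        coeff     : Carrier
        {{ram≢0}} : NonZero ram

    open Puiseux

    commonPole : Puiseux → Puiseux → ℕ
    commonPole x y = pole x ℕ.* ram y ℕ.+ pole y ℕ.* ram x

    align : Puiseux → Puiseux → Carrier
    align x y = raise (pole y ℕ.* ram x) (φ (ram y) (coeff x))

    infix  4 _≈ᵖ_
    infixl 7 _*ᵖ_
    infixl 6 _+ᵖ_
    infix  8 -ᵖ_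

    _≈ᵖ_ : Puiseux → Puiseux → Set ℓ
    x ≈ᵖ y = align x y ≈ align y x

    _+ᵖ_ _*ᵖ_ : Puiseux → Puiseux → Puiseux
    x +ᵖ y = ⟨ ram x ℕ.* ram y , commonPole x y , align x y + align y x ⟩
               {{ℕ.m*n≢0 (ram x) (ram y) {{ram≢0 x}} {{ram≢0 y}}}}
    x *ᵖ y = ⟨ ram x ℕ.* ram y , commonPole x y , φ (ram y) (coeff x) * φ (ram x) (coeff y) ⟩
               {{ℕ.m*n≢0 (ram x) (ram y) {{ram≢0 x}} {{ram≢0 y}}}}

    -ᵖ_ : Puiseux → Puiseux
    -ᵖ x = ⟨ ram x , pole x , - coeff x ⟩ {{ram≢0 x}}

    fromSeries : Carrier → Puiseux
    fromSeries a = ⟨ 1 , 0 , a ⟩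

    -- In associativity, commutativity and the identity laws both sides have equal ramification and
    -- pole, which leaves an identity between coefficient series. Distributivity is not of this
    -- kind.
    same : ∀ {x y} → ram x ≡ ram y → pole x ≡ pole y → coeff x ≈ coeff y → x ≈ᵖ y
    same {x@(⟨ m , p , a ⟩)} {⟨ _ , _ , b ⟩} ≡.refl ≡.refl a≈b = M-cong (p ℕ.* m) m {{ram≢0 x}} a≈b

    -- As for fractions compared by cross-multiplication: both hypotheses are expanded to a format
    -- common to x, y and w, and the contribution of the middle element y is cancelled at the end by
    -- `M-injective`.
    ≈ᵖ-trans : ∀ {x y w} → x ≈ᵖ y → y ≈ᵖ w → x ≈ᵖ w
    ≈ᵖ-trans {⟨ m , p , a ⟩} {⟨ n , q , b ⟩} {⟨ l , r , c ⟩} x≈y y≈w = M-injective (q ℕ.* m ℕ.* l) n (begin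
      M (q ℕ.* m ℕ.* l) n (M (r ℕ.* m) l a)           ≈⟨ M-M _ n _ l a ⟩
      M (q ℕ.* m ℕ.* l ℕ.+ r ℕ.* m ℕ.* n) (n ℕ.* l) a ≈⟨ M-≡ (e₁ m n l q r) (ℕ.*-comm n l) ⟩
      M (r ℕ.* n ℕ.* m ℕ.+ q ℕ.* m ℕ.* l) (l ℕ.* n) a ≈⟨ M-M _ l _ n a ⟨
      M (r ℕ.* n ℕ.* m) l (M (q ℕ.* m) n a)           ≈⟨ M-cong _ l x≈y ⟩
      M (r ℕ.* n ℕ.* m) l (M (p ℕ.* n) m b)           ≈⟨ M-M _ l _ m b ⟩
      M (r ℕ.* n ℕ.* m ℕ.+ p ℕ.* n ℕ.* l) (l ℕ.* m) b ≈⟨ M-≡ (ℕ.+-comm (r ℕ.* n ℕ.* m) _) (ℕ.*-comm l m) ⟩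
      M (p ℕ.* n ℕ.* l ℕ.+ r ℕ.* n ℕ.* m) (m ℕ.* l) b ≈⟨ M-M _ m _ l b ⟨
      M (p ℕ.* n ℕ.* l) m (M (r ℕ.* n) l b)           ≈⟨ M-cong _ m y≈w ⟩
      M (p ℕ.* n ℕ.* l) m (M (q ℕ.* l) n c)           ≈⟨ M-M _ m _ n c ⟩
      M (p ℕ.* n ℕ.* l ℕ.+ q ℕ.* l ℕ.* m) (m ℕ.* n) c ≈⟨ M-≡ (e₂ m n l p q) (ℕ.*-comm m n) ⟩
      M (q ℕ.* m ℕ.* l ℕ.+ p ℕ.* l ℕ.* n) (n ℕ.* m) c ≈⟨ M-M _ n _ m c ⟨
      M (q ℕ.* m ℕ.* l) n (M (p ℕ.* l) m c)           ∎)
      where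
      e₁ : ∀ m n l q r → q ℕ.* m ℕ.* l ℕ.+ r ℕ.* m ℕ.* n ≡ r ℕ.* n ℕ.* m ℕ.+ q ℕ.* m ℕ.* l
      e₁ = ℕSolver.solve-∀
      e₂ : ∀ m n l p q → p ℕ.* n ℕ.* l ℕ.+ q ℕ.* l ℕ.* m ≡ q ℕ.* m ℕ.* l ℕ.+ p ℕ.* l ℕ.* n
      e₂ = ℕSolver.solve-∀

    +ᵖ-comm : ∀ x y → x +ᵖ y ≈ᵖ y +ᵖ x
    +ᵖ-comm x y = same {x +ᵖ y} {y +ᵖ x} (ℕ.*-comm (ram x) (ram y)) (ℕ.+-comm (pole x ℕ.* ram y) _) (+-comm _ _)

    *ᵖ-comm : ∀ x y → x *ᵖ y ≈ᵖ y *ᵖ x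
    *ᵖ-comm x y = same {x *ᵖ y} {y *ᵖ x} (ℕ.*-comm (ram x) (ram y)) (ℕ.+-comm (pole x ℕ.* ram y) _) (*-comm _ _)

    +ᵖ-congʳ : ∀ {y x x′} → x ≈ᵖ x′ → x +ᵖ y ≈ᵖ x′ +ᵖ y
    +ᵖ-congʳ {⟨ n , q , b ⟩} {⟨ m , p , a ⟩} {⟨ m′ , p′ , a′ ⟩} x≈x′ = begin
      M E (m′ ℕ.* n) (M (q ℕ.* m) n a + M (p ℕ.* n) m b)
        ≈⟨ M-+ E (m′ ℕ.* n) _ _ ⟩
      M E (m′ ℕ.* n) (M (q ℕ.* m) n a) + M E (m′ ℕ.* n) (M (p ℕ.* n) m b)
        ≈⟨ +-cong (M-M E (m′ ℕ.* n) _ n a) (M-M E (m′ ℕ.* n) _ m b) ⟩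
      M (E ℕ.+ q ℕ.* m ℕ.* (m′ ℕ.* n)) (m′ ℕ.* n ℕ.* n) a + M (E ℕ.+ p ℕ.* n ℕ.* (m′ ℕ.* n)) (m′ ℕ.* n ℕ.* m) b
        ≈⟨ +-cong (M-≡ (e₁ m m′ n p′ q) (k₁ m′ n)) (M-≡ (e₂ m m′ n p p′ q) (k₂ m m′ n)) ⟩
      M (G ℕ.+ p′ ℕ.* m ℕ.* (n ℕ.* n)) (n ℕ.* n ℕ.* m′) a + _
        ≈⟨ +-congʳ (M-M G (n ℕ.* n) _ m′ a) ⟨
      M G (n ℕ.* n) (M (p′ ℕ.* m) m′ a) + _
        ≈⟨ +-congʳ (M-cong G (n ℕ.* n) x≈x′) ⟩
      M G (n ℕ.* n) (M (p ℕ.* m′) m a′) + _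
        ≈⟨ +-congʳ (M-M G (n ℕ.* n) _ m a′) ⟩
      M (G ℕ.+ p ℕ.* m′ ℕ.* (n ℕ.* n)) (n ℕ.* n ℕ.* m) a′ + M (E′ ℕ.+ p′ ℕ.* n ℕ.* (m ℕ.* n)) (m ℕ.* n ℕ.* m′) b
        ≈⟨ +-congʳ (M-≡ (e₃ m m′ n p q) (k₁ m n)) ⟨
      M (E′ ℕ.+ q ℕ.* m′ ℕ.* (m ℕ.* n)) (m ℕ.* n ℕ.* n) a′ + M (E′ ℕ.+ p′ ℕ.* n ℕ.* (m ℕ.* n)) (m ℕ.* n ℕ.* m′) b
        ≈⟨ +-cong (M-M E′ (m ℕ.* n) _ n a′) (M-M E′ (m ℕ.* n) _ m′ b) ⟨
      M E′ (m ℕ.* n) (M (q ℕ.* m′) n a′) + M E′ (m ℕ.* n) (M (p′ ℕ.* n) m′ b)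
        ≈⟨ M-+ E′ (m ℕ.* n) _ _ ⟨
      M E′ (m ℕ.* n) (M (q ℕ.* m′) n a′ + M (p′ ℕ.* n) m′ b) ∎
      where
      instance
        _ : NonZero (m ℕ.* n)
        _ = ℕ.m*n≢0 m n
        _ : NonZero (m′ ℕ.* n)
        _ = ℕ.m*n≢0 m′ n
        _ : NonZero (n ℕ.* n)
        _ = ℕ.m*n≢0 n n
      -- `E` and `E′` are the shifts produced by comparing the two sums. `G` is what remains of the
      -- exponent after `align x x′`, or `align x′ x`, has been isolated, so that the hypothesis
      -- applies inside `M G (n ℕ.* n)`.
      E E′ G : ℕ
      E  = (p′ ℕ.* n ℕ.+ q ℕ.* m′) ℕ.* (m ℕ.* n)
      E′ = (p ℕ.* n ℕ.+ q ℕ.* m) ℕ.* (m′ ℕ.* n)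
      G  = 2 ℕ.* (q ℕ.* m ℕ.* m′ ℕ.* n)
      e₁ : ∀ m m′ n p′ q → (p′ ℕ.* n ℕ.+ q ℕ.* m′) ℕ.* (m ℕ.* n) ℕ.+ q ℕ.* m ℕ.* (m′ ℕ.* n) ≡
        2 ℕ.* (q ℕ.* m ℕ.* m′ ℕ.* n) ℕ.+ p′ ℕ.* m ℕ.* (n ℕ.* n)
      e₁ = ℕSolver.solve-∀
      e₂ : ∀ m m′ n p p′ q → (p′ ℕ.* n ℕ.+ q ℕ.* m′) ℕ.* (m ℕ.* n) ℕ.+ p ℕ.* n ℕ.* (m′ ℕ.* n) ≡
        (p ℕ.* n ℕ.+ q ℕ.* m) ℕ.* (m′ ℕ.* n) ℕ.+ p′ ℕ.* n ℕ.* (m ℕ.* n)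
      e₂ = ℕSolver.solve-∀
      e₃ : ∀ m m′ n p q → (p ℕ.* n ℕ.+ q ℕ.* m) ℕ.* (m′ ℕ.* n) ℕ.+ q ℕ.* m′ ℕ.* (m ℕ.* n) ≡
        2 ℕ.* (q ℕ.* m ℕ.* m′ ℕ.* n) ℕ.+ p ℕ.* m′ ℕ.* (n ℕ.* n)
      e₃ = ℕSolver.solve-∀
      k₁ : ∀ m n → m ℕ.* n ℕ.* n ≡ n ℕ.* n ℕ.* m
      k₁ = ℕSolver.solve-∀
      k₂ : ∀ m m′ n → m′ ℕ.* n ℕ.* m ≡ m ℕ.* n ℕ.* m′
      k₂ = ℕSolver.solve-∀

    +ᵖ-cong : ∀ {x x′ y y′} → x ≈ᵖ x′ → y ≈ᵖ y′ → x +ᵖ y ≈ᵖ x′ +ᵖ y′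
    +ᵖ-cong {x} {x′} {y} {y′} x≈x′ y≈y′ =
      ≈ᵖ-trans {x +ᵖ y} {x′ +ᵖ y} {x′ +ᵖ y′} (+ᵖ-congʳ {y} {x} {x′} x≈x′)
      (≈ᵖ-trans {x′ +ᵖ y} {y +ᵖ x′} {x′ +ᵖ y′} (+ᵖ-comm x′ y)
      (≈ᵖ-trans {y +ᵖ x′} {y′ +ᵖ x′} {x′ +ᵖ y′} (+ᵖ-congʳ {x′} {y} {y′} y≈y′) (+ᵖ-comm y′ x′)))

    *ᵖ-congʳ : ∀ {y x x′} → x ≈ᵖ x′ → x *ᵖ y ≈ᵖ x′ *ᵖ y
    *ᵖ-congʳ {⟨ n , q , b ⟩} {⟨ m , p , a ⟩} {⟨ m′ , p′ , a′ ⟩} x≈x′ = begin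
      M E (m′ ℕ.* n) (φ n a * φ m b)
        ≈⟨ M-N E (m′ ℕ.* n) n m a b ⟩
      N E (m′ ℕ.* n ℕ.* n) (m′ ℕ.* n ℕ.* m) a b
        ≈⟨ N-≡ (e₁ m m′ n p′ q) (k₁ m′ n) (k₂ m m′ n) ⟩
      N (G ℕ.+ p′ ℕ.* m ℕ.* (n ℕ.* n)) (n ℕ.* n ℕ.* m′) (m ℕ.* n ℕ.* m′) a b
        ≈⟨ split m′ (p′ ℕ.* m) a ⟩
      M G (n ℕ.* n) (M (p′ ℕ.* m) m′ a) * φ (m ℕ.* n ℕ.* m′) b
        ≈⟨ *-congʳ (M-cong G (n ℕ.* n) x≈x′) ⟩
      M G (n ℕ.* n) (M (p ℕ.* m′) m a′) * φ (m ℕ.* n ℕ.* m′) b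
        ≈⟨ split m (p ℕ.* m′) a′ ⟨
      N (G ℕ.+ p ℕ.* m′ ℕ.* (n ℕ.* n)) (n ℕ.* n ℕ.* m) (m ℕ.* n ℕ.* m′) a′ b
        ≈⟨ N-≡ (e₂ m m′ n p q) (k₁ m n) ≡.refl ⟨
      N E′ (m ℕ.* n ℕ.* n) (m ℕ.* n ℕ.* m′) a′ b
        ≈⟨ M-N E′ (m ℕ.* n) n m′ a′ b ⟨
      M E′ (m ℕ.* n) (φ n a′ * φ m′ b) ∎
      where
      instance
        _ : NonZero (m ℕ.* n)
        _ = ℕ.m*n≢0 m n
        _ : NonZero (m′ ℕ.* n)
        _ = ℕ.m*n≢0 m′ n
        _ : NonZero (n ℕ.* n)
        _ = ℕ.m*n≢0 n n
      E E′ G : ℕ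
      E  = (p′ ℕ.* n ℕ.+ q ℕ.* m′) ℕ.* (m ℕ.* n)
      E′ = (p ℕ.* n ℕ.+ q ℕ.* m) ℕ.* (m′ ℕ.* n)
      G  = q ℕ.* m ℕ.* m′ ℕ.* n
      split : ∀ k {{_ : NonZero k}} e a → N (G ℕ.+ e ℕ.* (n ℕ.* n)) (n ℕ.* n ℕ.* k) (m ℕ.* n ℕ.* m′) a b ≈
        M G (n ℕ.* n) (M e k a) * φ (m ℕ.* n ℕ.* m′) b
      split k e a = trans (sym (*-assoc _ _ _)) (*-congʳ (trans (sym (raise-z _ _)) (sym (M-M G (n ℕ.* n) e k a))))
      e₁ : ∀ m m′ n p′ q → (p′ ℕ.* n ℕ.+ q ℕ.* m′) ℕ.* (m ℕ.* n) ≡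
        q ℕ.* m ℕ.* m′ ℕ.* n ℕ.+ p′ ℕ.* m ℕ.* (n ℕ.* n)
      e₁ = ℕSolver.solve-∀
      e₂ : ∀ m m′ n p q → (p ℕ.* n ℕ.+ q ℕ.* m) ℕ.* (m′ ℕ.* n) ≡
        q ℕ.* m ℕ.* m′ ℕ.* n ℕ.+ p ℕ.* m′ ℕ.* (n ℕ.* n)
      e₂ = ℕSolver.solve-∀
      k₁ : ∀ m n → m ℕ.* n ℕ.* n ≡ n ℕ.* n ℕ.* m
      k₁ = ℕSolver.solve-∀
      k₂ : ∀ m m′ n → m′ ℕ.* n ℕ.* m ≡ m ℕ.* n ℕ.* m′
      k₂ = ℕSolver.solve-∀

    *ᵖ-cong : ∀ {x x′ y y′} → x ≈ᵖ x′ → y ≈ᵖ y′ → x *ᵖ y ≈ᵖ x′ *ᵖ y′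
    *ᵖ-cong {x} {x′} {y} {y′} x≈x′ y≈y′ =
      ≈ᵖ-trans {x *ᵖ y} {x′ *ᵖ y} {x′ *ᵖ y′} (*ᵖ-congʳ {y} {x} {x′} x≈x′)
      (≈ᵖ-trans {x′ *ᵖ y} {y *ᵖ x′} {x′ *ᵖ y′} (*ᵖ-comm x′ y)
      (≈ᵖ-trans {y *ᵖ x′} {y′ *ᵖ x′} {x′ *ᵖ y′} (*ᵖ-congʳ {x′} {y} {y′} y≈y′) (*ᵖ-comm y′ x′)))

    -ᵖ-cong : ∀ {x y} → x ≈ᵖ y → -ᵖ x ≈ᵖ -ᵖ y
    -ᵖ-cong {⟨ m , p , a ⟩} {⟨ n , q , b ⟩} x≈y =
      trans (M-neg (q ℕ.* m) n a) (trans (-‿cong x≈y) (sym (M-neg (p ℕ.* n) m b)))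

    +ᵖ-assoc : ∀ x y w → (x +ᵖ y) +ᵖ w ≈ᵖ x +ᵖ (y +ᵖ w)
    +ᵖ-assoc x@(⟨ m , p , a ⟩) y@(⟨ n , q , b ⟩) w@(⟨ l , r , c ⟩) =
      same {(x +ᵖ y) +ᵖ w} {x +ᵖ (y +ᵖ w)} (ℕ.*-assoc m n l) (e₀ m n l p q r) (begin
        M (r ℕ.* (m ℕ.* n)) l (M (q ℕ.* m) n a + M (p ℕ.* n) m b) + M ((p ℕ.* n ℕ.+ q ℕ.* m) ℕ.* l) (m ℕ.* n) c
          ≈⟨ +-congʳ (trans (M-+ _ l _ _) (+-cong (M-M _ l _ n a) (M-M _ l _ m b))) ⟩
        (M (r ℕ.* (m ℕ.* n) ℕ.+ q ℕ.* m ℕ.* l) (l ℕ.* n) a + M (r ℕ.* (m ℕ.* n) ℕ.+ p ℕ.* n ℕ.* l) (l ℕ.* m) b) + _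
          ≈⟨ +-assoc _ _ _ ⟩
        M (r ℕ.* (m ℕ.* n) ℕ.+ q ℕ.* m ℕ.* l) (l ℕ.* n) a +
        (M (r ℕ.* (m ℕ.* n) ℕ.+ p ℕ.* n ℕ.* l) (l ℕ.* m) b + M ((p ℕ.* n ℕ.+ q ℕ.* m) ℕ.* l) (m ℕ.* n) c)
          ≈⟨ +-cong (M-≡ (e₁ m n l q r) (ℕ.*-comm l n))
               (+-cong (M-≡ (e₂ m n l p r) (ℕ.*-comm l m)) (M-≡ (e₃ m n l p q) ≡.refl)) ⟩
        M ((q ℕ.* l ℕ.+ r ℕ.* n) ℕ.* m) (n ℕ.* l) a +
        (M (p ℕ.* (n ℕ.* l) ℕ.+ r ℕ.* n ℕ.* m) (m ℕ.* l) b + M (p ℕ.* (n ℕ.* l) ℕ.+ q ℕ.* l ℕ.* m) (m ℕ.* n) c)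
          ≈⟨ +-congˡ (trans (M-+ _ m _ _) (+-cong (M-M _ m _ l b) (M-M _ m _ n c))) ⟨
        M ((q ℕ.* l ℕ.+ r ℕ.* n) ℕ.* m) (n ℕ.* l) a + M (p ℕ.* (n ℕ.* l)) m (M (r ℕ.* n) l b + M (q ℕ.* l) n c) ∎)
      where
      e₀ : ∀ m n l p q r → (p ℕ.* n ℕ.+ q ℕ.* m) ℕ.* l ℕ.+ r ℕ.* (m ℕ.* n) ≡ p ℕ.* (n ℕ.* l) ℕ.+ (q ℕ.* l ℕ.+ r ℕ.* n) ℕ.* m
      e₀ = ℕSolver.solve-∀
      e₁ : ∀ m n l q r → r ℕ.* (m ℕ.* n) ℕ.+ q ℕ.* m ℕ.* l ≡ (q ℕ.* l ℕ.+ r ℕ.* n) ℕ.* m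
      e₁ = ℕSolver.solve-∀
      e₂ : ∀ m n l p r → r ℕ.* (m ℕ.* n) ℕ.+ p ℕ.* n ℕ.* l ≡ p ℕ.* (n ℕ.* l) ℕ.+ r ℕ.* n ℕ.* m
      e₂ = ℕSolver.solve-∀
      e₃ : ∀ m n l p q → (p ℕ.* n ℕ.+ q ℕ.* m) ℕ.* l ≡ p ℕ.* (n ℕ.* l) ℕ.+ q ℕ.* l ℕ.* m
      e₃ = ℕSolver.solve-∀

    *ᵖ-assoc : ∀ x y w → (x *ᵖ y) *ᵖ w ≈ᵖ x *ᵖ (y *ᵖ w)
    *ᵖ-assoc x@(⟨ m , p , a ⟩) y@(⟨ n , q , b ⟩) w@(⟨ l , r , c ⟩) =
      same {(x *ᵖ y) *ᵖ w} {x *ᵖ (y *ᵖ w)} (ℕ.*-assoc m n l) (e₀ m n l p q r) (begin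
        φ l (φ n a * φ m b) * φ (m ℕ.* n) c
          ≈⟨ *-congʳ (trans (φ-* l _ _) (*-cong (φ-φ l n a) (φ-φ l m b))) ⟩
        (φ (l ℕ.* n) a * φ (l ℕ.* m) b) * φ (m ℕ.* n) c
          ≈⟨ *-assoc _ _ _ ⟩
        φ (l ℕ.* n) a * (φ (l ℕ.* m) b * φ (m ℕ.* n) c)
          ≡⟨ ≡.cong₂ (λ j k → φ j a * (φ k b * φ (m ℕ.* n) c)) (ℕ.*-comm l n) (ℕ.*-comm l m) ⟩
        φ (n ℕ.* l) a * (φ (m ℕ.* l) b * φ (m ℕ.* n) c)
          ≈⟨ *-congˡ (trans (φ-* m _ _) (*-cong (φ-φ m l b) (φ-φ m n c))) ⟨
        φ (n ℕ.* l) a * φ m (φ l b * φ n c) ∎)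
      where
      e₀ : ∀ m n l p q r → (p ℕ.* n ℕ.+ q ℕ.* m) ℕ.* l ℕ.+ r ℕ.* (m ℕ.* n) ≡ p ℕ.* (n ℕ.* l) ℕ.+ (q ℕ.* l ℕ.+ r ℕ.* n) ℕ.* m
      e₀ = ℕSolver.solve-∀

    0ᵖ 1ᵖ : Puiseux
    0ᵖ = fromSeries 0#
    1ᵖ = fromSeries 1#

    φ-1# : ∀ k {{_ : NonZero k}} → φ k 1# ≈ 1#
    φ-1# k = φ-z^ k 0

    ≈0ᵖ : ∀ x → coeff x ≈ 0# → x ≈ᵖ 0ᵖ
    ≈0ᵖ x@(⟨ m , p , a ⟩) a≈0 = begin
      M 0 1 a             ≈⟨ trans (raise-0 _) (φ-1 a) ⟩
      a                   ≈⟨ a≈0 ⟩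
      0#                  ≈⟨ M-0 (p ℕ.* 1) m ⟨
      M (p ℕ.* 1) m 0#    ∎

    +ᵖ-identityˡ : ∀ x → 0ᵖ +ᵖ x ≈ᵖ x
    +ᵖ-identityˡ x@(⟨ m , p , a ⟩) = same {0ᵖ +ᵖ x} {x} (ℕ.*-identityˡ m) (ℕ.*-identityʳ p) (begin
      M (p ℕ.* 1) m 0# + M 0 1 a    ≈⟨ +-cong (M-0 (p ℕ.* 1) m) (trans (raise-0 _) (φ-1 a)) ⟩
      0# + a                        ≈⟨ +-identityˡ a ⟩
      a                             ∎)

    *ᵖ-identityˡ : ∀ x → 1ᵖ *ᵖ x ≈ᵖ x
    *ᵖ-identityˡ x@(⟨ m , p , a ⟩) = same {1ᵖ *ᵖ x} {x} (ℕ.*-identityˡ m) (ℕ.*-identityʳ p) (begin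
      φ m 1# * φ 1 a    ≈⟨ *-cong (φ-1# m) (φ-1 a) ⟩
      1# * a            ≈⟨ *-identityˡ a ⟩
      a                 ∎)

    -ᵖ-inverseʳ : ∀ x → x +ᵖ -ᵖ x ≈ᵖ 0ᵖ
    -ᵖ-inverseʳ x@(⟨ m , p , a ⟩) = ≈0ᵖ (x +ᵖ -ᵖ x)
      (trans (+-congˡ (M-neg (p ℕ.* m) m a)) (-‿inverseʳ _))

    -- The right side contains the ramification of x twice, so the formats differ. Both sides are
    -- expanded into two terms of the form `N`, which are then matched.
    *ᵖ-distribˡ-+ᵖ : ∀ x y w → x *ᵖ (y +ᵖ w) ≈ᵖ x *ᵖ y +ᵖ x *ᵖ w
    *ᵖ-distribˡ-+ᵖ x@(⟨ m , p , a ⟩) y@(⟨ n , q , b ⟩) w@(⟨ l , r , c ⟩) = begin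
      M F R′ (φ (n ℕ.* l) a * φ m (M (r ℕ.* n) l b + M (q ℕ.* l) n c))
        ≈⟨ M-cong F R′ (*-congˡ (trans (φ-+ m _ _) (+-cong (φ-M m _ l b) (φ-M m _ n c)))) ⟩
      M F R′ (φ (n ℕ.* l) a * (z ^ (r ℕ.* n ℕ.* m) * φ (m ℕ.* l) b + z ^ (q ℕ.* l ℕ.* m) * φ (m ℕ.* n) c))
        ≈⟨ M-cong F R′ (solve 5 (λ a z z′ b c → a :* (z :* b :+ z′ :* c) := z :* (a :* b) :+ z′ :* (a :* c)) refl _ _ _ _ _) ⟩
      M F R′ (N (r ℕ.* n ℕ.* m) (n ℕ.* l) (m ℕ.* l) a b + N (q ℕ.* l ℕ.* m) (n ℕ.* l) (m ℕ.* n) a c)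
        ≈⟨ M-+ F R′ _ _ ⟩
      M F R′ (N (r ℕ.* n ℕ.* m) (n ℕ.* l) (m ℕ.* l) a b) + M F R′ (N (q ℕ.* l ℕ.* m) (n ℕ.* l) (m ℕ.* n) a c)
        ≈⟨ +-cong (MN F R′ (r ℕ.* n ℕ.* m) (n ℕ.* l) (m ℕ.* l) a b) (MN F R′ (q ℕ.* l ℕ.* m) (n ℕ.* l) (m ℕ.* n) a c) ⟩
      N (F ℕ.+ r ℕ.* n ℕ.* m ℕ.* R′) (R′ ℕ.* (n ℕ.* l)) (R′ ℕ.* (m ℕ.* l)) a b +
      N (F ℕ.+ q ℕ.* l ℕ.* m ℕ.* R′) (R′ ℕ.* (n ℕ.* l)) (R′ ℕ.* (m ℕ.* n)) a c
        ≈⟨ +-cong (N-≡ (e₁ m n l p q r) (k₁ m n l) (k₂ m n l)) (N-≡ (e₂ m n l p q r) (k₃ m n l) (k₄ m n l)) ⟩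
      N (F′ ℕ.+ B ℕ.* R) (R ℕ.* (m ℕ.* l ℕ.* n)) (R ℕ.* (m ℕ.* l ℕ.* m)) a b +
      N (F′ ℕ.+ C ℕ.* R) (R ℕ.* (m ℕ.* n ℕ.* l)) (R ℕ.* (m ℕ.* n ℕ.* m)) a c
        ≈⟨ +-cong (MMN B (m ℕ.* l) n b) (MMN C (m ℕ.* n) l c) ⟨
      M F′ R (M B (m ℕ.* l) (φ n a * φ m b)) + M F′ R (M C (m ℕ.* n) (φ l a * φ m c))
        ≈⟨ M-+ F′ R _ _ ⟨
      M F′ R (M B (m ℕ.* l) (φ n a * φ m b) + M C (m ℕ.* n) (φ l a * φ m c)) ∎
      where
      instance
        _ : NonZero (m ℕ.* n)
        _ = ℕ.m*n≢0 m n
        _ : NonZero (m ℕ.* l)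
        _ = ℕ.m*n≢0 m l
        _ : NonZero (n ℕ.* l)
        _ = ℕ.m*n≢0 n l
      -- `R` and `R′` are the ramification indices of the left and right sides, `F` and `F′` the
      -- shifts that compare the two sides, and `B` and `C` the shifts that align x y with x w.
      R R′ F F′ B C : ℕ
      R  = m ℕ.* (n ℕ.* l)
      R′ = (m ℕ.* n) ℕ.* (m ℕ.* l)
      B  = (p ℕ.* l ℕ.+ r ℕ.* m) ℕ.* (m ℕ.* n)
      C  = (p ℕ.* n ℕ.+ q ℕ.* m) ℕ.* (m ℕ.* l)
      F  = (C ℕ.+ B) ℕ.* R
      F′ = (p ℕ.* (n ℕ.* l) ℕ.+ (q ℕ.* l ℕ.+ r ℕ.* n) ℕ.* m) ℕ.* R′
      instance
        _ : NonZero (m ℕ.* (n ℕ.* l))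
        _ = ℕ.m*n≢0 m (n ℕ.* l)
        _ : NonZero ((m ℕ.* n) ℕ.* (m ℕ.* l))
        _ = ℕ.m*n≢0 (m ℕ.* n) (m ℕ.* l)

      MN : ∀ f j e k l {{_ : NonZero j}} {{_ : NonZero k}} {{_ : NonZero l}} a b →
        M f j (N e k l a b) ≈ N (f ℕ.+ e ℕ.* j) (j ℕ.* k) (j ℕ.* l) a b
      MN f j e k l a b = begin
        M f j (N e k l a b)                                      ≈⟨ raise-cong f (φ-* j (z ^ e) _) ⟩
        raise f (φ j (z ^ e) * φ j (φ k a * φ l b))              ≈⟨ raise-cong f (*-cong (φ-z^ j e)
                                                                     (trans (φ-* j _ _) (*-cong (φ-φ j k a) (φ-φ j l b)))) ⟩
        raise f (N (e ℕ.* j) (j ℕ.* k) (j ℕ.* l) a b)            ≈⟨ raise-N f _ _ _ a b ⟩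
        N (f ℕ.+ e ℕ.* j) (j ℕ.* k) (j ℕ.* l) a b                ∎

      MMN : ∀ e j k {{_ : NonZero j}} {{_ : NonZero k}} b →
        M F′ R (M e j (φ k a * φ m b)) ≈ N (F′ ℕ.+ e ℕ.* R) (R ℕ.* (j ℕ.* k)) (R ℕ.* (j ℕ.* m)) a b
      MMN e j k b = trans (M-cong F′ R (M-N e j k m a b))
        (MN F′ R e (j ℕ.* k) (j ℕ.* m) {{ℕ.m*n≢0 m (n ℕ.* l)}} {{ℕ.m*n≢0 j k}} {{ℕ.m*n≢0 j m}} a b)

      e₁ : ∀ m n l p q r → ((p ℕ.* n ℕ.+ q ℕ.* m) ℕ.* (m ℕ.* l) ℕ.+ (p ℕ.* l ℕ.+ r ℕ.* m) ℕ.* (m ℕ.* n)) ℕ.* (m ℕ.* (n ℕ.* l)) ℕ.+ r ℕ.* n ℕ.* m ℕ.* ((m ℕ.* n) ℕ.* (m ℕ.* l)) ≡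
        (p ℕ.* (n ℕ.* l) ℕ.+ (q ℕ.* l ℕ.+ r ℕ.* n) ℕ.* m) ℕ.* ((m ℕ.* n) ℕ.* (m ℕ.* l)) ℕ.+ (p ℕ.* l ℕ.+ r ℕ.* m) ℕ.* (m ℕ.* n) ℕ.* (m ℕ.* (n ℕ.* l))
      e₁ = ℕSolver.solve-∀
      e₂ : ∀ m n l p q r → ((p ℕ.* n ℕ.+ q ℕ.* m) ℕ.* (m ℕ.* l) ℕ.+ (p ℕ.* l ℕ.+ r ℕ.* m) ℕ.* (m ℕ.* n)) ℕ.* (m ℕ.* (n ℕ.* l)) ℕ.+ q ℕ.* l ℕ.* m ℕ.* ((m ℕ.* n) ℕ.* (m ℕ.* l)) ≡
        (p ℕ.* (n ℕ.* l) ℕ.+ (q ℕ.* l ℕ.+ r ℕ.* n) ℕ.* m) ℕ.* ((m ℕ.* n) ℕ.* (m ℕ.* l)) ℕ.+ (p ℕ.* n ℕ.+ q ℕ.* m) ℕ.* (m ℕ.* l) ℕ.* (m ℕ.* (n ℕ.* l))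
      e₂ = ℕSolver.solve-∀
      k₁ : ∀ m n l → (m ℕ.* n) ℕ.* (m ℕ.* l) ℕ.* (n ℕ.* l) ≡ m ℕ.* (n ℕ.* l) ℕ.* (m ℕ.* l ℕ.* n)
      k₁ = ℕSolver.solve-∀
      k₂ : ∀ m n l → (m ℕ.* n) ℕ.* (m ℕ.* l) ℕ.* (m ℕ.* l) ≡ m ℕ.* (n ℕ.* l) ℕ.* (m ℕ.* l ℕ.* m)
      k₂ = ℕSolver.solve-∀
      k₃ : ∀ m n l → (m ℕ.* n) ℕ.* (m ℕ.* l) ℕ.* (n ℕ.* l) ≡ m ℕ.* (n ℕ.* l) ℕ.* (m ℕ.* n ℕ.* l)
      k₃ = ℕSolver.solve-∀
      k₄ : ∀ m n l → (m ℕ.* n) ℕ.* (m ℕ.* l) ℕ.* (m ℕ.* n) ≡ m ℕ.* (n ℕ.* l) ℕ.* (m ℕ.* n ℕ.* m)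
      k₄ = ℕSolver.solve-∀

    isCommutativeRingᵖ : IsCommutativeRing _≈ᵖ_ _+ᵖ_ _*ᵖ_ -ᵖ_ 0ᵖ 1ᵖ
    isCommutativeRingᵖ = record
      { isRing = record
        { +-isAbelianGroup = record
          { isGroup = record
            { isMonoid = record
              { isSemigroup = record
                { isMagma = record
                  { isEquivalence = record
                    { refl  = refl
                    ; sym   = sym
                    ; trans = λ {x} {y} {w} → ≈ᵖ-trans {x} {y} {w}
                    }
                  ; ∙-cong = λ {x} {x′} {y} {y′} → +ᵖ-cong {x} {x′} {y} {y′}
                  }
                ; assoc = +ᵖ-assoc
                }
              ; identity = +ᵖ-identityˡ , λ x → ≈ᵖ-trans {x +ᵖ 0ᵖ} {0ᵖ +ᵖ x} {x} (+ᵖ-comm x 0ᵖ) (+ᵖ-identityˡ x)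
              }
            ; inverse = (λ x → ≈ᵖ-trans { (-ᵖ x) +ᵖ x} {x +ᵖ -ᵖ x} {0ᵖ} (+ᵖ-comm (-ᵖ x) x) (-ᵖ-inverseʳ x)) , -ᵖ-inverseʳ
            ; ⁻¹-cong = λ {x} {y} → -ᵖ-cong {x} {y}
            }
          ; comm = +ᵖ-comm
          }
        ; *-cong = λ {x} {x′} {y} {y′} → *ᵖ-cong {x} {x′} {y} {y′}
        ; *-assoc = *ᵖ-assoc
        ; *-identity = *ᵖ-identityˡ , λ x → ≈ᵖ-trans {x *ᵖ 1ᵖ} {1ᵖ *ᵖ x} {x} (*ᵖ-comm x 1ᵖ) (*ᵖ-identityˡ x)
        ; distrib = *ᵖ-distribˡ-+ᵖ , λ w x y →
            ≈ᵖ-trans {(x +ᵖ y) *ᵖ w} {w *ᵖ (x +ᵖ y)} {x *ᵖ w +ᵖ y *ᵖ w} (*ᵖ-comm (x +ᵖ y) w)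
            (≈ᵖ-trans {w *ᵖ (x +ᵖ y)} {w *ᵖ x +ᵖ w *ᵖ y} {x *ᵖ w +ᵖ y *ᵖ w} (*ᵖ-distribˡ-+ᵖ w x y)
            (+ᵖ-cong {w *ᵖ x} {x *ᵖ w} {w *ᵖ y} {y *ᵖ w} (*ᵖ-comm w x) (*ᵖ-comm w y)))
        }
      ; *-comm = *ᵖ-comm
      }

    puiseuxRing : CommutativeRing c ℓ
    puiseuxRing = record { isCommutativeRing = isCommutativeRingᵖ }

    fromSeries-cong : ∀ {a b} → a ≈ b → fromSeries a ≈ᵖ fromSeries b
    fromSeries-cong = same {fromSeries _} {fromSeries _} ≡.refl ≡.refl

    fromSeries-+ : ∀ a b → fromSeries (a + b) ≈ᵖ fromSeries a +ᵖ fromSeries b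
    fromSeries-+ a b = same {fromSeries (a + b)} {fromSeries a +ᵖ fromSeries b} ≡.refl ≡.refl
      (sym (+-cong (trans (raise-0 _) (φ-1 a)) (trans (raise-0 _) (φ-1 b))))

    fromSeries-* : ∀ a b → fromSeries (a * b) ≈ᵖ fromSeries a *ᵖ fromSeries b
    fromSeries-* a b = same {fromSeries (a * b)} {fromSeries a *ᵖ fromSeries b} ≡.refl ≡.refl
      (sym (*-cong (φ-1 a) (φ-1 b)))

    -- Here x is z^((k-p)/m) times the unit b(z^(1/m)). Its inverse is z^((p-k)/m) c(z^(1/m)): the
    -- pole order p and the order k of the numerator change places.
    inverseᵖ : ∀ x k b c → coeff x ≈ z ^ k * b → b * c ≈ 1# → ∃[ y ] x *ᵖ y ≈ᵖ 1ᵖ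
    inverseᵖ x@(⟨ m , p , a ⟩) k b c a≈zᵏb bc≈1 = y , (begin
      M 0 1 (φ m a * φ m (z ^ p * c))      ≈⟨ trans (raise-0 _) (φ-1 _) ⟩
      φ m a * φ m (z ^ p * c)              ≈⟨ φ-* m _ _ ⟨
      φ m (a * (z ^ p * c))                ≈⟨ φ-cong m (*-congʳ a≈zᵏb) ⟩
      φ m (z ^ k * b * (z ^ p * c))        ≈⟨ φ-cong m (solve 4 (λ u b v c → u :* b :* (v :* c) := (v :* u) :* (b :* c)) refl _ b _ c) ⟩
      φ m (z ^ p * z ^ k * (b * c))        ≈⟨ φ-cong m (trans (*-cong (sym (^-homo-* z p k)) bc≈1) (*-identityʳ _)) ⟩
      φ m (z ^ (p ℕ.+ k))                  ≈⟨ φ-z^ m (p ℕ.+ k) ⟩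
      z ^ ((p ℕ.+ k) ℕ.* m)                ≡⟨ ≡.cong (z ^_) (e₀ m p k) ⟩
      z ^ E                                ≈⟨ *-identityʳ _ ⟨
      z ^ E * 1#                           ≈⟨ *-congˡ (φ-1# (m ℕ.* m) {{ℕ.m*n≢0 m m}}) ⟨
      z ^ E * φ (m ℕ.* m) 1#               ≈⟨ raise-z E _ ⟨
      M E (m ℕ.* m) 1#                     ∎)
      where
      y : Puiseux
      y = ⟨ m , k , z ^ p * c ⟩ {{ram≢0 x}}
      E : ℕ
      E = (p ℕ.* m ℕ.+ k ℕ.* m) ℕ.* 1
      e₀ : ∀ m p k → (p ℕ.+ k) ℕ.* m ≡ (p ℕ.* m ℕ.+ k ℕ.* m) ℕ.* 1
      e₀ = ℕSolver.solve-∀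

-- Formal power series

module PowerSeries {r ℓ} (R : CommutativeRing r ℓ) where
  open CommutativeRing R hiding (zero)
  open IntegerSolver R
  open import Algebra.Definitions.RawSemiring (Semiring.rawSemiring semiring) using (sum)
  open import Relation.Binary.Reasoning.Setoid setoid

  Series : Set r
  Series = ℕ → Carrier

  infix  4 _≈ˢ_
  infixl 7 _*ˢ_

  _≈ˢ_ : Series → Series → Set ℓ
  a ≈ˢ b = ∀ n → a n ≈ b n

  _*ˢ_ : Series → Series → Series
  (a *ˢ b) n = sum {suc n} (λ i → a (toℕ i) * b (n ℕ.∸ toℕ i))

  1ˢ : Series
  1ˢ zero    = 1#
  1ˢ (suc _) = 0#

  private
    -- By computation `(a *ˢ b) (suc n)` is `a 0 * b (suc n) + (tail a *ˢ b) n`. The inductions on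
    -- products go through this recursion.
    tail : Series → Series
    tail a n = a (suc n)

  *ˢ-cong : ∀ {a a′ b b′} → a ≈ˢ a′ → b ≈ˢ b′ → a *ˢ b ≈ˢ a′ *ˢ b′
  *ˢ-cong a≈a′ b≈b′ zero    = +-congʳ (*-cong (a≈a′ 0) (b≈b′ 0))
  *ˢ-cong a≈a′ b≈b′ (suc n) = +-cong (*-cong (a≈a′ 0) (b≈b′ (suc n))) (*ˢ-cong (a≈a′ ∘ suc) b≈b′ n)

  *ˢ-zeroˡ : ∀ a → (λ _ → 0#) *ˢ a ≈ˢ (λ _ → 0#)
  *ˢ-zeroˡ a zero    = solve 1 (λ x → con (+ 0) :* x :+ con (+ 0) := con (+ 0)) refl _
  *ˢ-zeroˡ a (suc n) = trans (+-cong (zeroˡ _) (*ˢ-zeroˡ a n)) (+-identityˡ 0#)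

  *ˢ-identityˡ : ∀ a → 1ˢ *ˢ a ≈ˢ a
  *ˢ-identityˡ a zero    = solve 1 (λ x → con (+ 1) :* x :+ con (+ 0) := x) refl _
  *ˢ-identityˡ a (suc n) = trans (+-cong (*-identityˡ _) (*ˢ-zeroˡ a n)) (+-identityʳ _)

  *ˢ-distribʳ-+ : ∀ c a b → (λ n → a n + b n) *ˢ c ≈ˢ (λ n → (a *ˢ c) n + (b *ˢ c) n)
  *ˢ-distribʳ-+ c a b zero    = solve 3 (λ a b c → (a :+ b) :* c :+ con (+ 0) := (a :* c :+ con (+ 0)) :+ (b :* c :+ con (+ 0))) refl _ _ _
  *ˢ-distribʳ-+ c a b (suc n) = trans (+-congˡ (*ˢ-distribʳ-+ c (tail a) (tail b) n))
    (solve 5 (λ a b c x y → (a :+ b) :* c :+ (x :+ y) := (a :* c :+ x) :+ (b :* c :+ y)) refl _ _ _ _ _)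

  *ˢ-scaleˡ : ∀ x a b → (λ n → x * a n) *ˢ b ≈ˢ (λ n → x * (a *ˢ b) n)
  *ˢ-scaleˡ x a b zero    = solve 3 (λ x a b → x :* a :* b :+ con (+ 0) := x :* (a :* b :+ con (+ 0))) refl _ _ _
  *ˢ-scaleˡ x a b (suc n) = trans (+-congˡ (*ˢ-scaleˡ x (tail a) b n))
    (solve 4 (λ x a b y → x :* a :* b :+ x :* y := x :* (a :* b :+ y)) refl _ _ _ _)

  *ˢ-assoc : ∀ a b c → (a *ˢ b) *ˢ c ≈ˢ a *ˢ (b *ˢ c)
  *ˢ-assoc a b c zero    = solve 3 (λ a b c → (a :* b :+ con (+ 0)) :* c :+ con (+ 0) := a :* (b :* c :+ con (+ 0)) :+ con (+ 0)) refl _ _ _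
  *ˢ-assoc a b c (suc n) = begin
    (a 0 * b 0 + 0#) * c (suc n) + ((λ n → a 0 * b (suc n) + (tail a *ˢ b) n) *ˢ c) n
      ≈⟨ +-congˡ (*ˢ-distribʳ-+ c (λ n → a 0 * b (suc n)) (tail a *ˢ b) n) ⟩
    (a 0 * b 0 + 0#) * c (suc n) + (((λ n → a 0 * b (suc n)) *ˢ c) n + ((tail a *ˢ b) *ˢ c) n)
      ≈⟨ +-congˡ (+-cong (*ˢ-scaleˡ (a 0) (tail b) c n) (*ˢ-assoc (tail a) b c n)) ⟩
    (a 0 * b 0 + 0#) * c (suc n) + (a 0 * (tail b *ˢ c) n + (tail a *ˢ (b *ˢ c)) n)
      ≈⟨ solve 5 (λ a b c x y → (a :* b :+ con (+ 0)) :* c :+ (a :* x :+ y) := a :* (b :* c :+ x) :+ y) refl _ _ _ _ _ ⟩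
    a 0 * (b 0 * c (suc n) + (tail b *ˢ c) n) + (tail a *ˢ (b *ˢ c)) n ∎

  -- The definition peels off the head of the left factor; commutativity also needs the mirror
  -- image.
  *ˢ-sucʳ : ∀ a b n → (a *ˢ b) (suc n) ≈ b 0 * a (suc n) + (a *ˢ tail b) n
  *ˢ-sucʳ a b zero    = solve 4 (λ a₀ a₁ b₀ b₁ → a₀ :* b₁ :+ (a₁ :* b₀ :+ con (+ 0)) := b₀ :* a₁ :+ (a₀ :* b₁ :+ con (+ 0))) refl _ _ _ _
  *ˢ-sucʳ a b (suc n) = trans (+-congˡ (*ˢ-sucʳ (tail a) b n))
    (solve 3 (λ x y z → x :+ (y :+ z) := y :+ (x :+ z)) refl _ _ _)

  *ˢ-comm : ∀ a b → a *ˢ b ≈ˢ b *ˢ a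
  *ˢ-comm a b zero    = +-congʳ (*-comm _ _)
  *ˢ-comm a b (suc n) = trans (+-congˡ (*ˢ-comm (tail a) b n)) (sym (*ˢ-sucʳ b a n))

  isCommutativeRingˢ : IsCommutativeRing _≈ˢ_ (λ a b n → a n + b n) _*ˢ_ (λ a n → - a n) (λ _ → 0#) 1ˢ
  isCommutativeRingˢ = record
    { isRing = record
      { +-isAbelianGroup = record
        { isGroup = record
          { isMonoid = record
            { isSemigroup = record
              { isMagma = record
                { isEquivalence = record
                  { refl  = λ n → refl
                  ; sym   = λ p n → sym (p n)
                  ; trans = λ p q n → trans (p n) (q n)
                  }
                ; ∙-cong = λ p q n → +-cong (p n) (q n)
                }
              ; assoc = λ a b c n → +-assoc (a n) (b n) (c n)
              }
            ; identity = (λ a n → +-identityˡ (a n)) , (λ a n → +-identityʳ (a n))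
            }
          ; inverse = (λ a n → -‿inverseˡ (a n)) , (λ a n → -‿inverseʳ (a n))
          ; ⁻¹-cong = λ p n → -‿cong (p n)
          }
        ; comm = λ a b n → +-comm (a n) (b n)
        }
      ; *-cong = *ˢ-cong
      ; *-assoc = *ˢ-assoc
      ; *-identity = *ˢ-identityˡ , (λ a n → trans (*ˢ-comm a 1ˢ n) (*ˢ-identityˡ a n))
      ; distrib = (λ c a b n → trans (*ˢ-comm c (λ k → a k + b k) n) (trans (*ˢ-distribʳ-+ c a b n) (+-cong (*ˢ-comm a c n) (*ˢ-comm b c n)))) , *ˢ-distribʳ-+
      }
    ; *-comm = *ˢ-comm
    }

  seriesRing : CommutativeRing r ℓ
  seriesRing = record { isCommutativeRing = isCommutativeRingˢ }

  private
    module S where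
      open CommutativeRing seriesRing public
      open import Algebra.Definitions.RawSemiring (Semiring.rawSemiring (CommutativeRing.semiring seriesRing)) public using (_^_)
      open IntegerSolver seriesRing public
      open import Relation.Binary.Reasoning.Setoid (CommutativeRing.setoid seriesRing) public

  zˢ : Series
  zˢ zero    = 0#
  zˢ (suc n) = 1ˢ n

  zˢ*-zero : ∀ a → (zˢ *ˢ a) 0 ≈ 0#
  zˢ*-zero a = solve 1 (λ x → con (+ 0) :* x :+ con (+ 0) := con (+ 0)) refl _

  zˢ*-suc : ∀ a n → (zˢ *ˢ a) (suc n) ≈ a n
  zˢ*-suc a n = trans (+-cong (zeroˡ _) (*ˢ-identityˡ a n)) (+-identityˡ _)

  zˢ-cancel : ∀ a b → zˢ *ˢ a ≈ˢ zˢ *ˢ b → a ≈ˢ b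
  zˢ-cancel a b za≈zb n = trans (sym (zˢ*-suc a n)) (trans (za≈zb (suc n)) (zˢ*-suc b n))

  zˢ^-cancel : ∀ m a b → zˢ S.^ m *ˢ a ≈ˢ zˢ S.^ m *ˢ b → a ≈ˢ b
  zˢ^-cancel zero    a b p = S.trans (S.sym (S.*-identityˡ a)) (S.trans p (S.*-identityˡ b))
  zˢ^-cancel (suc m) a b p = zˢ^-cancel m a b (zˢ-cancel _ _
    (S.trans (S.sym (S.*-assoc zˢ (zˢ S.^ m) a)) (S.trans p (S.*-assoc zˢ (zˢ S.^ m) b))))

  constantˢ : Carrier → Series
  constantˢ x zero    = x
  constantˢ x (suc n) = 0#

  constantˢ-cong : ∀ {x y} → x ≈ y → constantˢ x ≈ˢ constantˢ y
  constantˢ-cong x≈y zero    = x≈y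
  constantˢ-cong x≈y (suc n) = refl

  constantˢ-+ : ∀ x y → constantˢ (x + y) ≈ˢ constantˢ x S.+ constantˢ y
  constantˢ-+ x y zero    = refl
  constantˢ-+ x y (suc n) = sym (+-identityˡ 0#)

  constantˢ-*ˡ : ∀ x a → constantˢ x *ˢ a ≈ˢ (λ n → x * a n)
  constantˢ-*ˡ x a zero    = +-identityʳ _
  constantˢ-*ˡ x a (suc n) = trans (+-congˡ (*ˢ-zeroˡ a n)) (+-identityʳ _)

  constantˢ-* : ∀ x y → constantˢ (x * y) ≈ˢ constantˢ x *ˢ constantˢ y
  constantˢ-* x y zero    = sym (+-identityʳ _)
  constantˢ-* x y (suc n) = sym (trans (constantˢ-*ˡ x (constantˢ y) (suc n)) (zeroʳ x))

  constantˢ-1 : constantˢ 1# ≈ˢ 1ˢ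
  constantˢ-1 zero    = refl
  constantˢ-1 (suc n) = refl

  constantˢ-0 : constantˢ 0# ≈ˢ S.0#
  constantˢ-0 zero    = refl
  constantˢ-0 (suc n) = refl

  head+tail : ∀ a → a ≈ˢ constantˢ (a 0) S.+ zˢ *ˢ tail a
  head+tail a zero    = sym (trans (+-congˡ (zˢ*-zero (tail a))) (+-identityʳ _))
  head+tail a (suc n) = sym (trans (+-congˡ (zˢ*-suc (tail a) n)) (+-identityˡ _))

  tail-* : ∀ a b → tail (a *ˢ b) ≈ˢ constantˢ (a 0) *ˢ tail b S.+ tail a *ˢ b
  tail-* a b n = +-congʳ (sym (constantˢ-*ˡ (a 0) (tail b) n))

  infix 4 _≈[_]_

  -- Congruence modulo zⁿ. Multiplication by z gains one order of precision, which makes recursive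
  -- equations for series contractive: solutions exist by iteration and are unique.
  _≈[_]_ : Series → ℕ → Series → Set ℓ
  a ≈[ n ] b = ∀ i → i ℕ.< n → a i ≈ b i

  ≈⇒≈[] : ∀ {a b} n → a ≈ˢ b → a ≈[ n ] b
  ≈⇒≈[] n a≈b i _ = a≈b i

  ≈[]⇒≈ : ∀ {a b} → (∀ n → a ≈[ n ] b) → a ≈ˢ b
  ≈[]⇒≈ a≈b i = a≈b (suc i) i ℕ.≤-refl

  ≈[]-respects : ∀ {a a′ b b′} n → a ≈ˢ a′ → b ≈ˢ b′ → a ≈[ n ] b → a′ ≈[ n ] b′
  ≈[]-respects n a≈a′ b≈b′ a≈b i i<n = trans (sym (a≈a′ i)) (trans (a≈b i i<n) (b≈b′ i))

  +-≈[] : ∀ {a a′ b b′} n → a ≈[ n ] a′ → b ≈[ n ] b′ → a S.+ b ≈[ n ] a′ S.+ b′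
  +-≈[] n p q i i<n = +-cong (p i i<n) (q i i<n)

  *-≈[] : ∀ {a a′ b b′} n → a ≈[ n ] a′ → b ≈[ n ] b′ → a *ˢ b ≈[ n ] a′ *ˢ b′
  *-≈[] (suc n) p q zero    _           = +-congʳ (*-cong (p 0 (ℕ.s≤s ℕ.z≤n)) (q 0 (ℕ.s≤s ℕ.z≤n)))
  *-≈[] (suc n) p q (suc i) (ℕ.s≤s i<n) = +-cong
    (*-cong (p 0 (ℕ.s≤s ℕ.z≤n)) (q (suc i) (ℕ.s≤s i<n)))
    (*-≈[] n (λ k k<n → p (suc k) (ℕ.s≤s k<n)) (λ k k<n → q k (ℕ.m<n⇒m<1+n k<n)) i i<n)

  zˢ*-≈[] : ∀ {a b} n → a ≈[ n ] b → zˢ *ˢ a ≈[ suc n ] zˢ *ˢ b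
  zˢ*-≈[] {a} {b} n p zero    _           = trans (zˢ*-zero a) (sym (zˢ*-zero b))
  zˢ*-≈[] {a} {b} n p (suc i) (ℕ.s≤s i<n) = trans (zˢ*-suc a i) (trans (p i i<n) (sym (zˢ*-suc b i)))

  -- The gain is really m + 1 orders, but one is enough to advance an induction on n.
  zˢ^*-≈[] : ∀ {a b} m n → a ≈[ n ] b → zˢ S.^ suc m *ˢ a ≈[ suc n ] zˢ S.^ suc m *ˢ b
  zˢ^*-≈[] {a} {b} m n p = ≈[]-respects (suc n) (S.sym (S.*-assoc zˢ (zˢ S.^ m) a)) (S.sym (S.*-assoc zˢ (zˢ S.^ m) b))
    (zˢ*-≈[] n (*-≈[] n (≈⇒≈[] {zˢ S.^ m} n S.refl) p))

  -- c = a⁻¹ is the fixed point of c ↦ y (1 - z t c), where a = a₀ + z t and y = a₀⁻¹.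
  inverseˢ : ∀ a y → a 0 * y ≈ 1# → ∃[ c ] a *ˢ c ≈ˢ 1ˢ
  inverseˢ a y a₀y≈1 = c , (S.begin
    a *ˢ c                                          S.≈⟨ *ˢ-cong (head+tail a) (S.refl {c}) ⟩
    (A S.+ zˢ *ˢ t) *ˢ c                            S.≈⟨ S.solve 4 (λ A z t c → (A S.:+ z S.:* t) S.:* c S.:= A S.:* c S.:+ z S.:* (t S.:* c)) S.refl A zˢ t c ⟩
    A *ˢ c S.+ zˢ *ˢ (t *ˢ c)                       S.≈⟨ S.+-congʳ {zˢ *ˢ (t *ˢ c)} (S.*-congˡ {A} c-fixed) ⟩
    A *ˢ step c S.+ zˢ *ˢ (t *ˢ c)                  S.≈⟨ S.solve 3 (λ A Y x → A S.:* (Y S.:* (S.con (+ 1) S.:- x)) S.:+ x S.:= A S.:* Y S.:+ (S.con (+ 1) S.:- A S.:* Y) S.:* x) S.refl A Y (zˢ *ˢ (t *ˢ c)) ⟩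
    A *ˢ Y S.+ (1ˢ S.- A *ˢ Y) *ˢ (zˢ *ˢ (t *ˢ c))  S.≈⟨ S.+-cong AY≈1 (S.*-congʳ {zˢ *ˢ (t *ˢ c)} (S.+-congˡ {1ˢ} (S.-‿cong AY≈1))) ⟩
    1ˢ S.+ (1ˢ S.- 1ˢ) *ˢ (zˢ *ˢ (t *ˢ c))          S.≈⟨ S.solve 1 (λ x → S.con (+ 1) S.:+ (S.con (+ 1) S.:- S.con (+ 1)) S.:* x S.:= S.con (+ 1)) S.refl (zˢ *ˢ (t *ˢ c)) ⟩
    1ˢ                                              S.∎)
    where
    A Y t : Series
    A = constantˢ (a 0)
    Y = constantˢ y
    t = tail a

    AY≈1 : A *ˢ Y ≈ˢ 1ˢ
    AY≈1 = S.trans (S.sym (constantˢ-* (a 0) y)) (S.trans (constantˢ-cong a₀y≈1) constantˢ-1)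

    step : Series → Series
    step x = Y *ˢ (1ˢ S.- zˢ *ˢ (t *ˢ x))

    step-≈[] : ∀ {x x′} n → x ≈[ n ] x′ → step x ≈[ suc n ] step x′
    step-≈[] {x} {x′} n p = *-≈[] (suc n) (≈⇒≈[] {Y} (suc n) S.refl) (+-≈[] (suc n) (≈⇒≈[] {1ˢ} (suc n) S.refl)
      (λ i i<n → -‿cong (zˢ*-≈[] {t *ˢ x} {t *ˢ x′} n (*-≈[] n (≈⇒≈[] {t} n S.refl) p) i i<n)))

    approx : ℕ → Series
    approx zero    = S.0#
    approx (suc k) = step (approx k)

    approx-suc : ∀ k → approx k ≈[ k ] approx (suc k)
    approx-suc zero    = λ i ()
    approx-suc (suc k) = step-≈[] k (approx-suc k)

    approx-+ : ∀ k l → approx k ≈[ k ] approx (l ℕ.+ k)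
    approx-+ k zero    i i<k = refl
    approx-+ k (suc l) i i<k = trans (approx-+ k l i i<k) (approx-suc (l ℕ.+ k) i (ℕ.≤-trans i<k (ℕ.m≤n+m k l)))

    c : Series
    -- A diagonal: consecutive approximations agree modulo zᵏ from stage k on, so coefficient n is
    -- final at stage n + 1.
    c n = approx (suc n) n

    c≈approx : ∀ k → c ≈[ k ] approx k
    c≈approx k i i<k = trans (approx-+ (suc i) (k ℕ.∸ suc i) i ℕ.≤-refl)
      (reflexive (≡.cong (λ l → approx l i) (ℕ.m∸n+n≡m i<k)))

    c-fixed : c ≈ˢ step c
    c-fixed = ≈[]⇒≈ {c} {step c} λ
      { zero i ()
      ; (suc k) i i<k → trans (c≈approx (suc k) i i<k) (sym (step-≈[] k (c≈approx k) i i<k))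
      }

  -- The order k is the index of the first nonzero coefficient; the given index n bounds the search.
  zˢ-factor : ExcludedMiddle ℓ → ∀ n a → ¬ a n ≈ 0# →
    ∃[ k ] ∃[ b ] (a ≈ˢ zˢ S.^ k *ˢ b × ¬ b 0 ≈ 0#)
  zˢ-factor em zero    a aₙ≉0 = 0 , a , S.sym (S.*-identityˡ a) , aₙ≉0
  zˢ-factor em (suc n) a aₙ≉0 with em {a 0 ≈ 0#}
  ... | no  a₀≉0 = 0 , a , S.sym (S.*-identityˡ a) , a₀≉0
  ... | yes a₀≈0 = let k , b , ta≈zᵏb , b₀≉0 = zˢ-factor em n (tail a) aₙ≉0 in
    suc k , b , (S.begin
      a                                    S.≈⟨ head+tail a ⟩
      constantˢ (a 0) S.+ zˢ *ˢ tail a     S.≈⟨ S.+-cong (S.trans (constantˢ-cong a₀≈0) constantˢ-0) (S.*-congˡ {zˢ} ta≈zᵏb) ⟩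
      S.0# S.+ zˢ *ˢ (zˢ S.^ k *ˢ b)       S.≈⟨ S.+-identityˡ (zˢ *ˢ (zˢ S.^ k *ˢ b)) ⟩
      zˢ *ˢ (zˢ S.^ k *ˢ b)                S.≈⟨ S.*-assoc zˢ (zˢ S.^ k) b ⟨
      zˢ S.^ suc k *ˢ b                    S.∎) , b₀≉0

  -- The substitution z ↦ zᵐ

  module Dilation
    (raise φ : ℕ → Series → Series)
    (raise-zero : ∀ a → raise 0 a ≈ˢ a)
    (raise-suc-zero : ∀ k a → raise (suc k) a 0 ≈ 0#)
    (raise-suc-suc : ∀ k a n → raise (suc k) a (suc n) ≈ raise k a n)
    (φ-raise : ∀ m a → φ (suc m) a ≈ˢ constantˢ (a 0) S.+ raise (suc m) (φ (suc m) (a ∘ suc)))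
    where

    raise-z : ∀ k a → raise k a ≈ˢ zˢ S.^ k *ˢ a
    raise-z zero    a = S.trans (raise-zero a) (S.sym (S.*-identityˡ a))
    raise-z (suc k) a = S.begin
      raise (suc k) a              S.≈⟨ raise-suc ⟩
      zˢ *ˢ raise k a              S.≈⟨ S.*-congˡ {zˢ} (raise-z k a) ⟩
      zˢ *ˢ (zˢ S.^ k *ˢ a)        S.≈⟨ S.*-assoc zˢ (zˢ S.^ k) a ⟨
      zˢ S.^ suc k *ˢ a            S.∎
      where
      raise-suc : raise (suc k) a ≈ˢ zˢ *ˢ raise k a
      raise-suc zero    = trans (raise-suc-zero k a) (sym (zˢ*-zero (raise k a)))
      raise-suc (suc n) = trans (raise-suc-suc k a n) (sym (zˢ*-suc (raise k a) n))

    -- This recursion determines `φ (suc m)`: knowing it on tails modulo zⁿ gives it modulo zⁿ⁺¹.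
    -- The properties of the substitution below are drawn from it.
    unfold : ∀ m a → φ (suc m) a ≈ˢ constantˢ (a 0) S.+ zˢ S.^ suc m *ˢ φ (suc m) (tail a)
    unfold m a = S.trans (φ-raise m a) (S.+-congˡ {constantˢ (a 0)} (raise-z (suc m) (φ (suc m) (tail a))))

    φ-≈[] : ∀ m {a b} n → a ≈ˢ b → φ (suc m) a ≈[ n ] φ (suc m) b
    φ-≈[] m         zero    a≈b = λ i ()
    φ-≈[] m {a} {b} (suc n) a≈b = ≈[]-respects (suc n) (S.sym (unfold m a)) (S.sym (unfold m b))
      (+-≈[] (suc n) (≈⇒≈[] (suc n) (constantˢ-cong (a≈b 0)))
        (zˢ^*-≈[] m n (φ-≈[] m n (a≈b ∘ suc))))

    φ-cong : ∀ m {a b} → a ≈ˢ b → φ (suc m) a ≈ˢ φ (suc m) b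
    φ-cong m {a} {b} a≈b = ≈[]⇒≈ {φ (suc m) a} {φ (suc m) b} λ n → φ-≈[] m n a≈b

    φ-unique : ∀ m (F : Series → Series) →
      (∀ a → F a ≈ˢ constantˢ (a 0) S.+ zˢ S.^ suc m *ˢ F (tail a)) → ∀ a → φ (suc m) a ≈ˢ F a
    φ-unique m F F-unfold a = ≈[]⇒≈ {φ (suc m) a} {F a} λ n → go n a
      where
      go : ∀ n a → φ (suc m) a ≈[ n ] F a
      go zero    a = λ i ()
      go (suc n) a = ≈[]-respects (suc n) (S.sym (unfold m a)) (S.sym (F-unfold a))
        (+-≈[] (suc n) (≈⇒≈[] {constantˢ (a 0)} (suc n) S.refl) (zˢ^*-≈[] m n (go n (tail a))))

    φ-1 : ∀ a → φ 1 a ≈ˢ a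
    φ-1 a = φ-unique 0 (λ a → a) (λ a → S.trans (head+tail a) (S.+-congˡ {constantˢ (a 0)}
      (S.*-congʳ {tail a} (S.sym (S.*-identityʳ zˢ))))) a

    φ-constant : ∀ m x → φ (suc m) (constantˢ x) ≈ˢ constantˢ x
    φ-constant m x = ≈[]⇒≈ {φ (suc m) (constantˢ x)} {constantˢ x} λ n → go n x
      where
      go : ∀ n x → φ (suc m) (constantˢ x) ≈[ n ] constantˢ x
      go zero    x = λ i ()
      -- The tail of a constant is zero, again a constant, so the induction must range over all x
      -- and continues with x = 0.
      go (suc n) x = ≈[]-respects (suc n) (S.sym (unfold m (constantˢ x)))
        (S.trans (S.+-congˡ {constantˢ x} (S.zeroʳ (zˢ S.^ suc m))) (S.+-identityʳ (constantˢ x)))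
        (+-≈[] (suc n) (≈⇒≈[] {constantˢ x} (suc n) S.refl) (zˢ^*-≈[] m n
          (≈[]-respects n (φ-cong m constantˢ-0) constantˢ-0 (go n 0#))))

    φ-0 : ∀ m → φ (suc m) S.0# ≈ˢ S.0#
    φ-0 m = S.trans (φ-cong m (S.sym constantˢ-0)) (S.trans (φ-constant m 0#) constantˢ-0)

    φ-1ˢ : ∀ m → φ (suc m) 1ˢ ≈ˢ 1ˢ
    φ-1ˢ m = S.trans (φ-cong m (S.sym constantˢ-1)) (S.trans (φ-constant m 1#) constantˢ-1)

    φ-z : ∀ m → φ (suc m) zˢ ≈ˢ zˢ S.^ suc m
    φ-z m = S.begin
      φ (suc m) zˢ                                            S.≈⟨ unfold m zˢ ⟩
      constantˢ 0# S.+ zˢ S.^ suc m *ˢ φ (suc m) (tail zˢ)    S.≈⟨ S.+-cong constantˢ-0 (S.*-congˡ {zˢ S.^ suc m} (φ-1ˢ m)) ⟩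
      S.0# S.+ zˢ S.^ suc m *ˢ 1ˢ                             S.≈⟨ S.solve 1 (λ x → S.con (+ 0) S.:+ x S.:* S.con (+ 1) S.:= x) S.refl (zˢ S.^ suc m) ⟩
      zˢ S.^ suc m                                            S.∎

    φ-+ : ∀ m a b → φ (suc m) (a S.+ b) ≈ˢ φ (suc m) a S.+ φ (suc m) b
    φ-+ m a b = ≈[]⇒≈ {φ (suc m) (a S.+ b)} {φ (suc m) a S.+ φ (suc m) b} λ n → go n a b
      where
      Z : Series
      Z = zˢ S.^ suc m
      go : ∀ n a b → φ (suc m) (a S.+ b) ≈[ n ] φ (suc m) a S.+ φ (suc m) b
      go zero    a b = λ i ()
      go (suc n) a b = ≈[]-respects (suc n)
        (S.sym (S.trans (unfold m (a S.+ b)) (S.+-congʳ {Z *ˢ φ (suc m) (tail (a S.+ b))} (constantˢ-+ (a 0) (b 0)))))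
        (S.trans
          (S.solve 5 (λ x y z p q → (x S.:+ y) S.:+ z S.:* (p S.:+ q) S.:= (x S.:+ z S.:* p) S.:+ (y S.:+ z S.:* q)) S.refl
            (constantˢ (a 0)) (constantˢ (b 0)) Z (φ (suc m) (tail a)) (φ (suc m) (tail b)))
          (S.sym (S.+-cong (unfold m a) (unfold m b))))
        (+-≈[] (suc n) (≈⇒≈[] {constantˢ (a 0) S.+ constantˢ (b 0)} (suc n) S.refl) (zˢ^*-≈[] m n (go n (tail a) (tail b))))

    -- By `tail-*` the tail of a product is a sum of two products, and each is covered modulo zⁿ
    -- because the induction ranges over all pairs of series.
    φ-* : ∀ m a b → φ (suc m) (a *ˢ b) ≈ˢ φ (suc m) a *ˢ φ (suc m) b
    φ-* m a b = ≈[]⇒≈ {φ (suc m) (a *ˢ b)} {φ (suc m) a *ˢ φ (suc m) b} λ n → go n a b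
      where
      Z : Series
      Z = zˢ S.^ suc m
      go : ∀ n a b → φ (suc m) (a *ˢ b) ≈[ n ] φ (suc m) a *ˢ φ (suc m) b
      go zero    a b = λ i ()
      go (suc n) a b = ≈[]-respects (suc n)
        (S.sym (S.trans (unfold m (a *ˢ b)) (S.+-cong
          (S.trans (constantˢ-cong (+-identityʳ (a 0 * b 0))) (constantˢ-* (a 0) (b 0)))
          (S.*-congˡ {Z} (S.trans (φ-cong m (tail-* a b)) (φ-+ m (constantˢ (a 0) *ˢ tail b) (tail a *ˢ b)))))))
        (S.trans
          (S.+-congˡ {A *ˢ B} (S.*-congˡ {Z} (S.+-cong (S.*-congʳ {b′} (φ-constant m (a 0))) (S.*-congˡ {a′} (unfold m b)))))
          (S.trans
            (S.solve 5 (λ A B Z a′ b′ → A S.:* B S.:+ Z S.:* (A S.:* b′ S.:+ a′ S.:* (B S.:+ Z S.:* b′)) S.:= (A S.:+ Z S.:* a′) S.:* (B S.:+ Z S.:* b′)) S.refl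
              A B Z a′ b′)
            (S.sym (*ˢ-cong (unfold m a) (unfold m b)))))
        (+-≈[] (suc n) (≈⇒≈[] {A *ˢ B} (suc n) S.refl)
          (zˢ^*-≈[] m n (+-≈[] n (go n (constantˢ (a 0)) (tail b)) (go n (tail a) b))))
        where
        A B a′ b′ : Series
        A  = constantˢ (a 0)
        B  = constantˢ (b 0)
        a′ = φ (suc m) (tail a)
        b′ = φ (suc m) (tail b)

    φ-z^ : ∀ m n → φ (suc m) (zˢ S.^ n) ≈ˢ zˢ S.^ (n ℕ.* suc m)
    φ-z^ m zero    = φ-1ˢ m
    φ-z^ m (suc n) = S.trans (φ-* m zˢ (zˢ S.^ n)) (S.trans (*ˢ-cong (φ-z m) (φ-z^ m n))
      (S.sym (^-homo-* zˢ (suc m) (n ℕ.* suc m))))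
      where open import Algebra.Properties.Semiring.Exp (CommutativeRing.semiring seriesRing) using (^-homo-*)

    φ-φ : ∀ k l a → φ (suc k) (φ (suc l) a) ≈ˢ φ (suc k ℕ.* suc l) a
    -- The composite obeys the recursion that characterises the substitution for the product
    -- (k+1)(l+1), of which `l ℕ.+ k ℕ.* suc l` is the predecessor.
    φ-φ k l a = S.sym (φ-unique (l ℕ.+ k ℕ.* suc l) (φ (suc k) ∘ φ (suc l)) both-unfold a)
      where
      both-unfold : ∀ a → φ (suc k) (φ (suc l) a) ≈ˢ
        constantˢ (a 0) S.+ zˢ S.^ (suc k ℕ.* suc l) *ˢ φ (suc k) (φ (suc l) (tail a))
      both-unfold a = S.begin
        φ (suc k) (φ (suc l) a)
          S.≈⟨ φ-cong k (unfold l a) ⟩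
        φ (suc k) (constantˢ (a 0) S.+ zˢ S.^ suc l *ˢ φ (suc l) (tail a))
          S.≈⟨ φ-+ k (constantˢ (a 0)) (zˢ S.^ suc l *ˢ φ (suc l) (tail a)) ⟩
        φ (suc k) (constantˢ (a 0)) S.+ φ (suc k) (zˢ S.^ suc l *ˢ φ (suc l) (tail a))
          S.≈⟨ S.+-cong (φ-constant k (a 0)) (S.trans (φ-* k (zˢ S.^ suc l) (φ (suc l) (tail a)))
                 (S.*-congʳ {φ (suc k) (φ (suc l) (tail a))} (φ-z^ k (suc l)))) ⟩
        constantˢ (a 0) S.+ zˢ S.^ (suc l ℕ.* suc k) *ˢ φ (suc k) (φ (suc l) (tail a))
          S.≡⟨ ≡.cong (λ e → constantˢ (a 0) S.+ zˢ S.^ e *ˢ φ (suc k) (φ (suc l) (tail a))) (ℕ.*-comm (suc l) (suc k)) ⟩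
        constantˢ (a 0) S.+ zˢ S.^ (suc k ℕ.* suc l) *ˢ φ (suc k) (φ (suc l) (tail a)) S.∎

    -- The images determine the constant terms. Subtracting these and cancelling zᵐ⁺¹ leaves the
    -- images of the tails, so one coefficient after another is recovered.
    φ-injective : ∀ m a b → φ (suc m) a ≈ˢ φ (suc m) b → a ≈ˢ b
    φ-injective m a b φa≈φb zero    = begin
      a 0              ≈⟨ head a ⟨
      φ (suc m) a 0    ≈⟨ φa≈φb 0 ⟩
      φ (suc m) b 0    ≈⟨ head b ⟩
      b 0              ∎
      where
      head : ∀ a → φ (suc m) a 0 ≈ a 0
      head a = trans (unfold m a 0) (trans (+-congˡ (trans
        (S.*-assoc zˢ (zˢ S.^ m) (φ (suc m) (tail a)) 0) (zˢ*-zero (zˢ S.^ m *ˢ φ (suc m) (tail a))))) (+-identityʳ (a 0)))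
    φ-injective m a b φa≈φb (suc n) = φ-injective m (tail a) (tail b)
      (zˢ^-cancel (suc m) (φ (suc m) (tail a)) (φ (suc m) (tail b)) (S.begin
        Z *ˢ φ (suc m) (tail a)
          S.≈⟨ S.solve 2 (λ c x → x S.:= S.:- c S.:+ (c S.:+ x)) S.refl A (Z *ˢ φ (suc m) (tail a)) ⟩
        S.- A S.+ (A S.+ Z *ˢ φ (suc m) (tail a))
          S.≈⟨ S.+-congˡ {S.- A} (S.trans (S.sym (unfold m a)) (S.trans φa≈φb (unfold m b))) ⟩
        S.- A S.+ (constantˢ (b 0) S.+ Z *ˢ φ (suc m) (tail b))
          S.≈⟨ S.+-congˡ {S.- A} (S.+-congʳ {Z *ˢ φ (suc m) (tail b)} (constantˢ-cong (sym (φ-injective m a b φa≈φb 0)))) ⟩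
        S.- A S.+ (A S.+ Z *ˢ φ (suc m) (tail b))
          S.≈⟨ S.solve 2 (λ c x → x S.:= S.:- c S.:+ (c S.:+ x)) S.refl A (Z *ˢ φ (suc m) (tail b)) ⟨
        Z *ˢ φ (suc m) (tail b) S.∎)) n
      where
      Z A : Series
      Z = zˢ S.^ suc m
      A = constantˢ (a 0)

    φ-cong′ : ∀ k {{_ : NonZero k}} {a b} → a ≈ˢ b → φ k a ≈ˢ φ k b
    φ-cong′ (suc k) = φ-cong k

    φ-injective′ : ∀ k {{_ : NonZero k}} a b → φ k a ≈ˢ φ k b → a ≈ˢ b
    φ-injective′ (suc k) = φ-injective k

    φ-z^′ : ∀ k {{_ : NonZero k}} n → φ k (zˢ S.^ n) ≈ˢ zˢ S.^ (n ℕ.* k)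
    φ-z^′ (suc k) = φ-z^ k

    φ-+′ : ∀ k {{_ : NonZero k}} a b → φ k (a S.+ b) ≈ˢ φ k a S.+ φ k b
    φ-+′ (suc k) = φ-+ k

    φ-*′ : ∀ k {{_ : NonZero k}} a b → φ k (a *ˢ b) ≈ˢ φ k a *ˢ φ k b
    φ-*′ (suc k) = φ-* k

    φ-φ′ : ∀ k l {{_ : NonZero k}} {{_ : NonZero l}} a → φ k (φ l a) ≈ˢ φ (k ℕ.* l) a
    φ-φ′ (suc k) (suc l) = φ-φ k l

    module P = PuiseuxSeries.Laws seriesRing zˢ raise φ raise-z zˢ^-cancel φ-1
      φ-cong′ φ-injective′ φ-z^′ φ-+′ φ-*′ φ-φ′

    ≉0ᵖ⇒invertible : ExcludedMiddle ℓ → (∀ v → ¬ v ≈ 0# → ∃[ w ] v * w ≈ 1#) →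
      ∀ x → ¬ x P.≈ᵖ P.0ᵖ → ∃[ y ] x P.*ᵖ y P.≈ᵖ P.1ᵖ
    ≉0ᵖ⇒invertible em inverse x x≉0 with em {∃[ n ] (¬ P.Puiseux.coeff x n ≈ 0#)}
    ... | no  a≈0        = contradiction (P.≈0ᵖ x (λ n → decidable-stable em (λ aₙ≉0 → a≈0 (n , aₙ≉0)))) x≉0
    ... | yes (n , aₙ≉0) =
      let k , b , a≈zᵏb , b₀≉0 = zˢ-factor em n (P.Puiseux.coeff x) aₙ≉0
          y , b₀y≈1            = inverse (b 0) b₀≉0
          c , bc≈1             = inverseˢ b y b₀y≈1
      in P.inverseᵖ x k b c a≈zᵏb bc≈1

-- The field ℝ

open import Defs

open ℝ

-- `x ≈ʳ y` unfolds to this property of the difference of the two sequences.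
IsNull : (ℕ → ℚ) → Set
IsNull s = ∀ ε → 0ℚ ℚ.< ε → ∃[ N ] (∀ n → N ℕ.≤ n → ∣ s n ∣ ℚ.< ε)

null-ext : ∀ {s t} → (∀ n → s n ≡ t n) → IsNull s → IsNull t
null-ext s≡t s→0 ε 0<ε with s→0 ε 0<ε
... | N , sN = N , λ n h → ≡.subst (λ q → ∣ q ∣ ℚ.< ε) (s≡t n) (sN n h)

null-0 : IsNull (λ _ → 0ℚ)
null-0 ε 0<ε = 0 , λ _ _ → 0<ε

null-+ : ∀ {s t} → IsNull s → IsNull t → IsNull (λ n → s n ℚ.+ t n)
null-+ s→0 t→0 ε 0<ε with s→0 (½ ℚ.* ε) (Closure.half-pos ε 0<ε) | t→0 (½ ℚ.* ε) (Closure.half-pos ε 0<ε)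
... | M , sM | N , tN = M ℕ.⊔ N , λ n h →
  Closure.∣+∣-small (sM n (ℕ.m⊔n≤o⇒m≤o M N h)) (tN n (ℕ.m⊔n≤o⇒n≤o M N h))

null-neg : ∀ {s} → IsNull s → IsNull (λ n → ℚ.- s n)
null-neg {s} s→0 ε 0<ε with s→0 ε 0<ε
... | N , sN = N , λ n h → ≡.subst (ℚ._< ε) (≡.sym (ℚ.∣-p∣≡∣p∣ (s n))) (sN n h)

cauchy*null : ∀ s t → IsCauchy s → IsNull t → IsNull (λ n → s n ℚ.* t n)
cauchy*null s t cs t→0 ε 0<ε =
  let B , 0<B , M , sM = Closure.eventually-bounded s cs
      δ , 0<δ , small  = Closure.shrink B 0<B ε 0<ε
      N , tN           = t→0 δ 0<δ
  in M ℕ.⊔ N , λ n h →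
    small (s n) (t n) (sM n (ℕ.m⊔n≤o⇒m≤o M N h)) (tN n (ℕ.m⊔n≤o⇒n≤o M N h))

pointwise : ∀ x y → (∀ n → seq x n ≡ seq y n) → x ≈ʳ y
pointwise x y x≡y = null-ext (λ n → ≡.sym (≡.trans (≡.cong (ℚ._- seq y n) (x≡y n)) (ℚ.+-inverseʳ (seq y n)))) null-0

module _ where
  open +-*-Solver

  ≈ʳ-sym : ∀ x y → x ≈ʳ y → y ≈ʳ x
  ≈ʳ-sym x y x≈y = null-ext
    (λ n → solve 2 (λ a b → :- (a :- b) := b :- a) ≡.refl (seq x n) (seq y n)) (null-neg x≈y)

  ≈ʳ-trans : ∀ x y w → x ≈ʳ y → y ≈ʳ w → x ≈ʳ w
  ≈ʳ-trans x y w x≈y y≈w = null-ext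
    (λ n → solve 3 (λ a b c → (a :- b) :+ (b :- c) := a :- c) ≡.refl (seq x n) (seq y n) (seq w n))
    (null-+ x≈y y≈w)

  +ʳ-cong : ∀ x x′ y y′ → x ≈ʳ x′ → y ≈ʳ y′ → x +ʳ y ≈ʳ x′ +ʳ y′
  +ʳ-cong x x′ y y′ x≈x′ y≈y′ = null-ext
    (λ n → solve 4 (λ a b c d → (a :- b) :+ (c :- d) := (a :+ c) :- (b :+ d)) ≡.refl
      (seq x n) (seq x′ n) (seq y n) (seq y′ n))
    (null-+ x≈x′ y≈y′)

  -ʳ-cong : ∀ x y → x ≈ʳ y → -ʳ x ≈ʳ -ʳ y
  -ʳ-cong x y x≈y = null-ext
    (λ n → solve 2 (λ a b → :- (a :- b) := (:- a) :- (:- b)) ≡.refl (seq x n) (seq y n)) (null-neg x≈y)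

*ʳ-cong : ∀ x x′ y y′ → x ≈ʳ x′ → y ≈ʳ y′ → x *ʳ y ≈ʳ x′ *ʳ y′
*ʳ-cong x x′ y y′ x≈x′ y≈y′ = null-ext
  (λ n → Closure.product-difference (seq x n) (seq x′ n) (seq y n) (seq y′ n))
  (null-+ {λ n → seq x n ℚ.* (seq y n ℚ.- seq y′ n)} {λ n → seq y′ n ℚ.* (seq x n ℚ.- seq x′ n)}
    (cauchy*null (seq x) (λ n → seq y n ℚ.- seq y′ n) (cauchy x) y≈y′)
    (cauchy*null (seq y′) (λ n → seq x n ℚ.- seq x′ n) (cauchy y′) x≈x′))

isCommutativeRingʳ : IsCommutativeRing _≈ʳ_ _+ʳ_ _*ʳ_ -ʳ_ (constant 0ℚ) (constant 1ℚ)
isCommutativeRingʳ = record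
  { isRing = record
    { +-isAbelianGroup = record
      { isGroup = record
        { isMonoid = record
          { isSemigroup = record
            { isMagma = record
              { isEquivalence = record
                { refl  = λ {x} → pointwise x x (λ n → ≡.refl)
                ; sym   = λ {x} {y} → ≈ʳ-sym x y
                ; trans = λ {x} {y} {w} → ≈ʳ-trans x y w
                }
              ; ∙-cong = λ {x} {x′} {y} {y′} → +ʳ-cong x x′ y y′
              }
            ; assoc = λ x y w → pointwise ((x +ʳ y) +ʳ w) (x +ʳ (y +ʳ w)) (λ n → ℚ.+-assoc (seq x n) (seq y n) (seq w n))
            }
          ; identity = (λ x → pointwise (constant 0ℚ +ʳ x) x (λ n → ℚ.+-identityˡ (seq x n)))
                     , (λ x → pointwise (x +ʳ constant 0ℚ) x (λ n → ℚ.+-identityʳ (seq x n)))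
          }
        ; inverse = (λ x → pointwise (-ʳ x +ʳ x) (constant 0ℚ) (λ n → ℚ.+-inverseˡ (seq x n)))
                  , (λ x → pointwise (x +ʳ -ʳ x) (constant 0ℚ) (λ n → ℚ.+-inverseʳ (seq x n)))
        ; ⁻¹-cong = λ {x} {y} → -ʳ-cong x y
        }
      ; comm = λ x y → pointwise (x +ʳ y) (y +ʳ x) (λ n → ℚ.+-comm (seq x n) (seq y n))
      }
    ; *-cong = λ {x} {x′} {y} {y′} → *ʳ-cong x x′ y y′
    ; *-assoc = λ x y w → pointwise ((x *ʳ y) *ʳ w) (x *ʳ (y *ʳ w)) (λ n → ℚ.*-assoc (seq x n) (seq y n) (seq w n))
    ; *-identity = (λ x → pointwise (constant 1ℚ *ʳ x) x (λ n → ℚ.*-identityˡ (seq x n)))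
                 , (λ x → pointwise (x *ʳ constant 1ℚ) x (λ n → ℚ.*-identityʳ (seq x n)))
    ; distrib = (λ x y w → pointwise (x *ʳ (y +ʳ w)) (x *ʳ y +ʳ x *ʳ w) (λ n → ℚ.*-distribˡ-+ (seq x n) (seq y n) (seq w n)))
              , (λ x y w → pointwise ((y +ʳ w) *ʳ x) (y *ʳ x +ʳ w *ʳ x) (λ n → ℚ.*-distribʳ-+ (seq x n) (seq y n) (seq w n)))
    }
  ; *-comm = λ x y → pointwise (x *ʳ y) (y *ʳ x) (λ n → ℚ.*-comm (seq x n) (seq y n))
  }

ℝ-ring : CommutativeRing 0ℓ 0ℓ
ℝ-ring = record { isCommutativeRing = isCommutativeRingʳ }

-- Reciprocals of real numbers

IsAway : (ℕ → ℚ) → Set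
IsAway s = ∃[ δ ] (0ℚ ℚ.< δ × ∃[ N ] (∀ n → N ℕ.≤ n → δ ℚ.≤ ∣ s n ∣))

-- From N on the terms differ by less than ε/4, so a single rational comparison decides: if the N-th
-- term is below ε/2 in absolute value, later ones stay below ε; otherwise they stay at or above
-- ε/4.
small-or-away : ∀ s → IsCauchy s → ∀ ε → 0ℚ ℚ.< ε →
  IsAway s ⊎ ∃[ N ] (∀ n → N ℕ.≤ n → ∣ s n ∣ ℚ.< ε)
small-or-away s cs ε 0<ε with cs (½ ℚ.* (½ ℚ.* ε)) (Closure.half-pos _ (Closure.half-pos ε 0<ε))
... | N , sN = go (∣ s N ∣ ℚ.<? h)
  where
  h q : ℚ
  h = ½ ℚ.* ε
  q = ½ ℚ.* h

  0<h : 0ℚ ℚ.< h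
  0<h = Closure.half-pos ε 0<ε
  0<q : 0ℚ ℚ.< q
  0<q = Closure.half-pos h 0<h

  q<h : q ℚ.< h
  q<h = ≡.subst₂ ℚ._<_ (ℚ.+-identityʳ q) (Closure.halves h) (ℚ.+-monoʳ-< q 0<q)

  go : Dec (∣ s N ∣ ℚ.< h) → IsAway s ⊎ ∃[ N ] (∀ n → N ℕ.≤ n → ∣ s n ∣ ℚ.< ε)
  go (yes sN<h) = inj₂ (N , λ n k → ≡.subst (λ r → ∣ r ∣ ℚ.< ε)
    (solve 2 (λ a b → (a :- b) :+ b := a) ≡.refl (s n) (s N))
    (Closure.∣+∣-small {ε} {s n ℚ.- s N} {s N} (ℚ.<-trans (sN n N k ℕ.≤-refl) q<h) sN<h))
    where open +-*-Solver
  go (no sN≮h) = inj₁ (q , 0<q , N , λ n k → ℚ.≮⇒≥ λ sn<q → sN≮h (≡.subst (λ r → ∣ r ∣ ℚ.< h)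
    (solve 2 (λ a b → (a :- b) :+ b := a) ≡.refl (s N) (s n))
    (Closure.∣+∣-small {h} {s N ℚ.- s n} {s n} (sN N n ℕ.≤-refl k) sn<q)))
    where open +-*-Solver

-- Finitely many terms of a sequence bounded away from 0 may vanish, hence a total reciprocal. The
-- decision is an argument so that proofs can split on it.
inverseOr0 : ∀ p → Dec (p ≡ 0ℚ) → ℚ
inverseOr0 p (yes _)  = 0ℚ
inverseOr0 p (no p≢0) = 1/_ p {{ℚ.≢-nonZero p≢0}}

inverseℚ : ℚ → ℚ
inverseℚ p = inverseOr0 p (p ℚ.≟ 0ℚ)

inverseℚ-inverseʳ : ∀ {δ} p → 0ℚ ℚ.< δ → δ ℚ.≤ ∣ p ∣ → p ℚ.* inverseℚ p ≡ 1ℚ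
inverseℚ-inverseʳ {δ} p 0<δ δ≤∣p∣ = go (p ℚ.≟ 0ℚ)
  where
  go : (dec : Dec (p ≡ 0ℚ)) → p ℚ.* inverseOr0 p dec ≡ 1ℚ
  go (yes p≡0) = contradiction (ℚ.<-≤-trans 0<δ (≡.subst (λ r → δ ℚ.≤ ∣ r ∣) p≡0 δ≤∣p∣)) (ℚ.<-irrefl ≡.refl)
  go (no p≢0)  = ℚ.*-inverseʳ p {{ℚ.≢-nonZero p≢0}}

*-mono-≤-nonNeg : ∀ {p q r s} → 0ℚ ℚ.≤ p → 0ℚ ℚ.≤ s → p ℚ.≤ q → r ℚ.≤ s → p ℚ.* r ℚ.≤ q ℚ.* s
*-mono-≤-nonNeg {p} {q} {r} {s} 0≤p 0≤s p≤q r≤s = ℚ.≤-trans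
  (ℚ.*-monoˡ-≤-nonNeg p {{ℚ.nonNegative 0≤p}} r≤s)
  (ℚ.*-monoʳ-≤-nonNeg s {{ℚ.nonNegative 0≤s}} p≤q)

0<p*q : ∀ {p q} → 0ℚ ℚ.< p → 0ℚ ℚ.< q → 0ℚ ℚ.< p ℚ.* q
0<p*q {p} {q} 0<p 0<q = ≡.subst (ℚ._< p ℚ.* q) (ℚ.*-zeroʳ p) (ℚ.*-monoʳ-<-pos p {{ℚ.positive 0<p}} 0<q)

-- From 1/p - 1/q = (q - p)/(p q): if two reciprocals differed by at least ε, the terms would differ
-- by at least δ·δ·ε, which is the precision requested of `s`.
inverse-cauchy : ∀ s → IsCauchy s → IsAway s → IsCauchy (λ n → inverseℚ (s n))
inverse-cauchy s cs (δ , 0<δ , M , sM) ε 0<ε with cs (δ ℚ.* (δ ℚ.* ε)) (0<p*q 0<δ (0<p*q 0<δ 0<ε))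
... | N , sN = M ℕ.⊔ N , λ m n h k → ℚ.≰⇒> λ ε≤∣u∣ →
  ℚ.<-irrefl ≡.refl (ℚ.<-≤-trans (sN n m (ℕ.m⊔n≤o⇒n≤o M N k) (ℕ.m⊔n≤o⇒n≤o M N h))
    (≡.subst (δ ℚ.* (δ ℚ.* ε) ℚ.≤_) (∣p∣*∣q∣*∣u∣ (s m) (s n) (sM m (ℕ.m⊔n≤o⇒m≤o M N h)) (sM n (ℕ.m⊔n≤o⇒m≤o M N k)))
      (*-mono-≤-nonNeg (ℚ.<⇒≤ 0<δ)
        (≡.subst (0ℚ ℚ.≤_) (ℚ.∣p*q∣≡∣p∣*∣q∣ (s n) _) (ℚ.0≤∣p∣ (s n ℚ.* (inverseℚ (s m) ℚ.- inverseℚ (s n)))))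
        (sM m (ℕ.m⊔n≤o⇒m≤o M N h))
        (*-mono-≤-nonNeg (ℚ.<⇒≤ 0<δ) (ℚ.0≤∣p∣ _) (sM n (ℕ.m⊔n≤o⇒m≤o M N k)) ε≤∣u∣))))
  where
  ∣p∣*∣q∣*∣u∣ : ∀ p q → δ ℚ.≤ ∣ p ∣ → δ ℚ.≤ ∣ q ∣ →
    ∣ p ∣ ℚ.* (∣ q ∣ ℚ.* ∣ inverseℚ p ℚ.- inverseℚ q ∣) ≡ ∣ q ℚ.- p ∣
  ∣p∣*∣q∣*∣u∣ p q δ≤p δ≤q = begin
    ∣ p ∣ ℚ.* (∣ q ∣ ℚ.* ∣ p⁻¹ ℚ.- q⁻¹ ∣)                  ≡⟨ ≡.cong (∣ p ∣ ℚ.*_) (ℚ.∣p*q∣≡∣p∣*∣q∣ q _) ⟨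
    ∣ p ∣ ℚ.* ∣ q ℚ.* (p⁻¹ ℚ.- q⁻¹) ∣                      ≡⟨ ℚ.∣p*q∣≡∣p∣*∣q∣ p _ ⟨
    ∣ p ℚ.* (q ℚ.* (p⁻¹ ℚ.- q⁻¹)) ∣                        ≡⟨ ≡.cong ∣_∣ (solve 4 (λ p q a b → p :* (q :* (a :- b)) := q :* (p :* a) :- p :* (q :* b)) ≡.refl p q p⁻¹ q⁻¹) ⟩
    ∣ q ℚ.* (p ℚ.* p⁻¹) ℚ.- p ℚ.* (q ℚ.* q⁻¹) ∣            ≡⟨ ≡.cong₂ (λ a b → ∣ q ℚ.* a ℚ.- p ℚ.* b ∣) (inverseℚ-inverseʳ p 0<δ δ≤p) (inverseℚ-inverseʳ q 0<δ δ≤q) ⟩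
    ∣ q ℚ.* 1ℚ ℚ.- p ℚ.* 1ℚ ∣                              ≡⟨ ≡.cong₂ (λ a b → ∣ a ℚ.- b ∣) (ℚ.*-identityʳ q) (ℚ.*-identityʳ p) ⟩
    ∣ q ℚ.- p ∣                                            ∎
    where
    open ≡.≡-Reasoning
    open +-*-Solver
    p⁻¹ q⁻¹ : ℚ
    p⁻¹ = inverseℚ p
    q⁻¹ = inverseℚ q

module _ (em : ExcludedMiddle 0ℓ) where

  -- If the sequence is not bounded away from 0, `small-or-away` returns its second alternative for
  -- every ε, which makes x null.
  ≉0⇒away : ∀ x → ¬ x ≈ʳ constant 0ℚ → IsAway (seq x)
  ≉0⇒away x x≉0 with em {IsAway (seq x)}
  ... | yes away = away
  ... | no ¬away = contradiction (null-ext (λ n → ≡.sym (ℚ.+-identityʳ (seq x n))) x→0) x≉0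
    where
    x→0 : IsNull (seq x)
    x→0 ε 0<ε with small-or-away (seq x) (cauchy x) ε 0<ε
    ... | inj₁ away  = contradiction away ¬away
    ... | inj₂ small = small

  inverseʳ : ∀ x → ¬ x ≈ʳ constant 0ℚ → ∃[ y ] x *ʳ y ≈ʳ constant 1ℚ
  inverseʳ x x≉0 with ≉0⇒away x x≉0
  ... | away@(δ , 0<δ , N , xN) = mkℝ (λ n → inverseℚ (seq x n)) (inverse-cauchy (seq x) (cauchy x) away) ,
    λ ε 0<ε → N , λ n h → ≡.subst (ℚ._< ε)
      (≡.sym (≡.cong (λ r → ∣ r ℚ.- 1ℚ ∣) (inverseℚ-inverseʳ (seq x n) 0<δ (xN n h)))) 0<ε

-- Where the sum of squares is below ε², a term of `s` of size at least ε is impossible, since its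
-- square alone reaches ε².
square-null : ∀ (s t : ℕ → ℚ) → IsNull (λ n → s n ℚ.* s n ℚ.+ t n ℚ.* t n) → IsNull s
square-null s t s²+t²→0 ε 0<ε with s²+t²→0 (ε ℚ.* ε) (0<p*q 0<ε 0<ε)
... | N , sN = N , λ n h → ℚ.≰⇒> λ ε≤∣s∣ → ℚ.<-irrefl ≡.refl (begin-strict
  ε ℚ.* ε                                    ≤⟨ *-mono-≤-nonNeg (ℚ.<⇒≤ 0<ε) (ℚ.0≤∣p∣ (s n)) ε≤∣s∣ ε≤∣s∣ ⟩
  ∣ s n ∣ ℚ.* ∣ s n ∣                        ≡⟨ ∣p∣² (s n) ⟩
  s n ℚ.* s n                                ≡⟨ ℚ.+-identityʳ _ ⟨
  s n ℚ.* s n ℚ.+ 0ℚ                         ≤⟨ ℚ.+-monoʳ-≤ (s n ℚ.* s n) (0≤p² (t n)) ⟩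
  s n ℚ.* s n ℚ.+ t n ℚ.* t n                ≤⟨ p≤∣p∣ (s n ℚ.* s n ℚ.+ t n ℚ.* t n) ⟩
  ∣ s n ℚ.* s n ℚ.+ t n ℚ.* t n ∣            <⟨ sN n h ⟩
  ε ℚ.* ε                                    ∎)
  where
  open ℚ.≤-Reasoning
  0≤∣p∣² : ∀ p → 0ℚ ℚ.≤ ∣ p ∣ ℚ.* ∣ p ∣
  0≤∣p∣² p = ≡.subst (0ℚ ℚ.≤_) (ℚ.∣p*q∣≡∣p∣*∣q∣ p p) (ℚ.0≤∣p∣ (p ℚ.* p))
  ∣p∣² : ∀ p → ∣ p ∣ ℚ.* ∣ p ∣ ≡ p ℚ.* p
  ∣p∣² p with ℚ.∣p∣≡p∨∣p∣≡-p p
  ... | inj₁ e = ≡.cong₂ ℚ._*_ e e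
  ... | inj₂ e = ≡.trans (≡.cong₂ ℚ._*_ e e) (solve 1 (λ a → (:- a) :* (:- a) := a :* a) ≡.refl p)
    where open +-*-Solver
  0≤p² : ∀ p → 0ℚ ℚ.≤ p ℚ.* p
  0≤p² p = ≡.subst (0ℚ ℚ.≤_) (∣p∣² p) (0≤∣p∣² p)
  p≤∣p∣ : ∀ p → p ℚ.≤ ∣ p ∣
  p≤∣p∣ p with ℚ.∣p∣≡p∨∣p∣≡-p p | ℚ.≤-total 0ℚ p
  ... | inj₁ e | _        = ℚ.≤-reflexive (≡.sym e)
  ... | inj₂ e | inj₁ 0≤p = ℚ.≤-reflexive (≡.sym (ℚ.0≤p⇒∣p∣≡p 0≤p))
  ... | inj₂ e | inj₂ p≤0 = ℚ.≤-trans p≤0 (ℚ.0≤∣p∣ p)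

sum-of-squares≈0 : ∀ x y → x *ʳ x +ʳ y *ʳ y ≈ʳ constant 0ℚ → x ≈ʳ constant 0ℚ
sum-of-squares≈0 x y x²+y²≈0 = null-ext (λ n → ≡.sym (ℚ.+-identityʳ (seq x n)))
  (square-null (seq x) (seq y)
    (null-ext (λ n → ℚ.+-identityʳ (seq x n ℚ.* seq x n ℚ.+ seq y n ℚ.* seq y n)) x²+y²≈0))

-- The fields ℂ and K

module ℂᶜ = Complexification ℝ-ring

module _ where
  open CommutativeRing ℂᶜ.complexRing using (refl)

  toComplex : ℂ → ℂᶜ.Complex
  toComplex v = ℂ.re v ℂᶜ.+i ℂ.im v

  ℂ-ring : CommutativeRing 0ℓ 0ℓ
  ℂ-ring = pullback ℂ-rawRing ℂᶜ.complexRing toComplex id id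
    (λ v w → refl {toComplex (v ℂR.+ w)}) (λ v w → refl {toComplex (v ℂR.* w)})
    (λ v → refl {toComplex (ℂR.- v)}) (refl {toComplex ℂR.0#}) (refl {toComplex ℂR.1#})

norm : ℂ → ℝ
norm (a +i b) = a *ʳ a +ʳ b *ʳ b

norm≈0 : ∀ v → norm v ≈ʳ constant 0ℚ → v ℂR.≈ ℂR.0#
norm≈0 (a +i b) norm≈0 = sum-of-squares≈0 a b norm≈0 ,
  sum-of-squares≈0 b a (≈ʳ-trans (b *ʳ b +ʳ a *ʳ a) (a *ʳ a +ʳ b *ʳ b) (constant 0ℚ)
    (CommutativeRing.+-comm ℝ-ring (b *ʳ b) (a *ʳ a)) norm≈0)

module _ (em : ExcludedMiddle 0ℓ) where

  inverseℂ : ∀ v → ¬ v ℂR.≈ ℂR.0# → ∃[ w ] v ℂR.* w ℂR.≈ ℂR.1#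
  inverseℂ v v≉0 =
    let t , norm*t≈1 = inverseʳ em (norm v) (v≉0 ∘ norm≈0 v)
        w , v*w≈1    = ℂᶜ.inverseᶜ (toComplex v) t norm*t≈1
    in (ℂᶜ.Complex.re w +i ℂᶜ.Complex.im w) , v*w≈1

-- Power series over ℂ and the field K

module ℂ[[z]] = PowerSeries ℂ-ring
module Sᵣ = CommutativeRing ℂ[[z]].seriesRing

-- The two unit series come from separate definitions by cases and agree only coefficient by
-- coefficient.
1ˢ≈ : 1ˢ Sᵣ.≈ ℂ[[z]].1ˢ
1ˢ≈ zero    = CommutativeRing.refl ℂ-ring {ℂR.1#}
1ˢ≈ (suc n) = CommutativeRing.refl ℂ-ring {ℂR.0#}

dilate-∣ : ∀ m a {n} q → n ≡ q ℕ.* suc m → dilate (suc m) a n ≡ a q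
dilate-∣ m a {n} q n≡qm with suc m ∣? n
... | yes (divides r n≡rm) = ≡.cong a (ℕ.*-cancelʳ-≡ r q (suc m) (≡.trans (≡.sym n≡rm) n≡qm))
... | no  m∤n              = contradiction (divides q n≡qm) m∤n

dilate-∤ : ∀ m a {n} → m ∤ n → dilate m a n ≡ ℂR.0#
dilate-∤ m a {n} m∤n with m ∣? n
... | yes m∣n = contradiction m∣n m∤n
... | no  _   = ≡.refl

raise-< : ∀ k a {n} → n ℕ.< k → raise k a n ≡ ℂR.0#
raise-< (suc k) a {zero}  _           = ≡.refl
raise-< (suc k) a {suc n} (ℕ.s≤s n<k) = raise-< k a n<k

raise-+ : ∀ k a n → raise k a (k ℕ.+ n) ≡ a n
raise-+ zero    a n = ≡.refl
raise-+ (suc k) a n = raise-+ k a n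

dilate-+ : ∀ m a n → dilate (suc m) a (suc m ℕ.+ n) ≡ dilate (suc m) (a ∘ suc) n
dilate-+ m a n = go (suc m ∣? n)
  where
  go : Dec (suc m ∣ n) → dilate (suc m) a (suc m ℕ.+ n) ≡ dilate (suc m) (a ∘ suc) n
  go (yes (divides q n≡qm)) = ≡.trans
    (dilate-∣ m a (suc q) (≡.cong (suc m ℕ.+_) n≡qm)) (≡.sym (dilate-∣ m (a ∘ suc) q n≡qm))
  go (no m∤n) = ≡.trans
    (dilate-∤ (suc m) a (λ m∣m+n → m∤n (∣m+n∣m⇒∣n m∣m+n ∣-refl))) (≡.sym (dilate-∤ (suc m) (a ∘ suc) m∤n))

-- The recursion required by `Dilation`: below degree m + 1 only the constant term survives, and
-- from there on the coefficients are those of the dilated tail.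
dilate-raise : ∀ m a n → dilate (suc m) a n ℂR.≈
  (ℂ[[z]].constantˢ (a 0) Sᵣ.+ raise (suc m) (dilate (suc m) (a ∘ suc))) n
dilate-raise m a zero = ≡.subst (ℂR._≈ (a 0 ℂR.+ ℂR.0#)) (≡.sym (dilate-∣ m a 0 ≡.refl))
  (CommutativeRing.sym ℂ-ring {a 0 ℂR.+ ℂR.0#} {a 0} (CommutativeRing.+-identityʳ ℂ-ring (a 0)))
dilate-raise m a (suc n) = ≡.subst (ℂR._≈ (ℂR.0# ℂR.+ raise m b n)) (≡.sym (shifted (n ℕ.<? m)))
  (CommutativeRing.sym ℂ-ring {ℂR.0# ℂR.+ raise m b n} {raise m b n} (CommutativeRing.+-identityˡ ℂ-ring (raise m b n)))
  where
  b : Series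
  b = dilate (suc m) (a ∘ suc)
  shifted : Dec (n ℕ.< m) → dilate (suc m) a (suc n) ≡ raise m b n
  -- The degree is n + 1, which lies strictly between 0 and m + 1 and so is no multiple of m + 1.
  shifted (yes n<m) = ≡.trans (dilate-∤ (suc m) a (>⇒∤ (ℕ.s≤s n<m))) (≡.sym (raise-< m b n<m))
  shifted (no n≮m)  = ≡.subst (λ k → dilate (suc m) a (suc k) ≡ raise m b k) (ℕ.m+[n∸m]≡n (ℕ.≮⇒≥ n≮m))
    (≡.trans (dilate-+ m a (n ℕ.∸ m)) (≡.sym (raise-+ m b (n ℕ.∸ m))))

module Dil = ℂ[[z]].Dilation raise dilate (λ a → Sᵣ.refl {a})
  (λ k a → CommutativeRing.refl ℂ-ring {ℂR.0#})
  (λ k a n → CommutativeRing.refl ℂ-ring {raise k a n})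
  dilate-raise

module KP = Dil.P

toPuiseux : K → KP.Puiseux
toPuiseux x = KP.⟨ K.ram x , K.pole x , K.coeff x ⟩ {{K.ram≢0 x}}

module KPᵣ = CommutativeRing KP.puiseuxRing

K-ring : CommutativeRing 0ℓ 0ℓ
K-ring = pullback K-rawRing KP.puiseuxRing toPuiseux id id
  (λ x y → KPᵣ.refl {toPuiseux (x + y)}) (λ x y → KPᵣ.refl {toPuiseux (x * y)})
  (λ x → KPᵣ.refl {toPuiseux (- x)}) (KPᵣ.refl {toPuiseux 0#}) (KP.fromSeries-cong {1ˢ} {ℂ[[z]].1ˢ} 1ˢ≈)

module Kᵣ = CommutativeRing K-ring

fromSeries-^ : ∀ a n → fromSeries (a SeriesR.^ n) ≈ fromSeries a ^ n
fromSeries-^ a zero    = Kᵣ.refl {1#}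
fromSeries-^ a (suc n) = Kᵣ.trans {fromSeries (a SeriesR.^ suc n)} {fromSeries a * fromSeries (a SeriesR.^ n)} {fromSeries a ^ suc n}
  (KP.fromSeries-* a (a SeriesR.^ n))
  (Kᵣ.*-congˡ {fromSeries a} {fromSeries (a SeriesR.^ n)} {fromSeries a ^ n} (fromSeries-^ a n))

fromSeries-equation : ∀ a n → a SeriesR.≈ SeriesR.1# SeriesR.+ zˢ SeriesR.* a SeriesR.^ n →
  fromSeries a ≈ 1# + z * fromSeries a ^ n
fromSeries-equation a n equation = begin
  fromSeries a                                                 ≈⟨ KP.fromSeries-cong {a} {SeriesR.1# SeriesR.+ zˢ SeriesR.* a SeriesR.^ n} equation ⟩
  fromSeries (SeriesR.1# SeriesR.+ zˢ SeriesR.* a SeriesR.^ n) ≈⟨ KP.fromSeries-+ SeriesR.1# (zˢ SeriesR.* a SeriesR.^ n) ⟩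
  1# + fromSeries (zˢ SeriesR.* a SeriesR.^ n)                 ≈⟨ Kᵣ.+-congˡ {1#} {fromSeries (zˢ SeriesR.* a SeriesR.^ n)} {z * fromSeries (a SeriesR.^ n)} (KP.fromSeries-* zˢ (a SeriesR.^ n)) ⟩
  1# + z * fromSeries (a SeriesR.^ n)                          ≈⟨ Kᵣ.+-congˡ {1#} {z * fromSeries (a SeriesR.^ n)} {z * fromSeries a ^ n} (Kᵣ.*-congˡ {z} {fromSeries (a SeriesR.^ n)} {fromSeries a ^ n} (fromSeries-^ a n)) ⟩
  1# + z * fromSeries a ^ n                                    ∎
  where open import Relation.Binary.Reasoning.Setoid Kᵣ.setoid

module _ (em : ExcludedMiddle 0ℓ) where
  open Classical em

  inverseK : ∀ x → x ≉ 0# → ∃[ y ] x * y ≈ 1#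
  inverseK x x≉0 = fromPuiseux (Dil.≉0ᵖ⇒invertible em (inverseℂ em) (toPuiseux x) x≉0)
    where
    fromPuiseux : ∃[ y ] toPuiseux x KP.*ᵖ y KP.≈ᵖ KP.1ᵖ → ∃[ y ] x * y ≈ 1#
    fromPuiseux (KP.⟨ m , p , a ⟩ , xy≈1) = y ,
      Kᵣ.trans {x * y} {fromSeries ℂ[[z]].1ˢ} {1#} xy≈1
        (KP.fromSeries-cong {ℂ[[z]].1ˢ} {1ˢ} (Sᵣ.sym {1ˢ} {ℂ[[z]].1ˢ} 1ˢ≈))
      where
      y : K
      y = ⟨ m , p , a ⟩

  ⁻¹-inverseʳ : ∀ x → (∃[ y ] x * y ≈ 1#) → x * x ⁻¹ ≈ 1#
  ⁻¹-inverseʳ x invertible = go em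
    where
    -- Generalising over the decision lets `pick` compute, although `em` itself does not.
    go : ∀ dec → x * pick {x} dec ≈ 1#
    go (yes (_ , xy≈1)) = xy≈1
    go (no ¬invertible) = contradiction invertible ¬invertible

  invertible⊎⁻¹≡0 : ∀ x → (∃[ y ] x * y ≈ 1#) ⊎ x ⁻¹ ≡ 0#
  invertible⊎⁻¹≡0 x = go em
    where
    go : ∀ dec → (∃[ y ] x * y ≈ 1#) ⊎ pick {x} dec ≡ 0#
    go (yes invertible) = inj₁ invertible
    go (no _)           = inj₂ ≡.refl

  module KField = FieldRecurrence
    _≈_ _+_ _*_ -_ 0# 1# Kᵣ.isCommutativeRing
    _-_ (λ x y → ≡.refl)
    _^_ (λ x → ≡.refl) (λ x n → ≡.refl)
    sum product (λ f → ≡.refl) (λ f → ≡.refl) (λ f → ≡.refl) (λ f → ≡.refl)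
    _⁻¹ ⁻¹-inverseʳ invertible⊎⁻¹≡0 inverseK
    _/_ (λ x y → ≡.refl)
    _^ᶻ_ (λ x n → ≡.refl) (λ x n → ≡.refl)
    odd (λ i → ≡.refl)

-- Unlike a type signature, the body of a definition is stored with the copies
-- made by "open Classical em" and "open RawRing K-rawRing" inlined. The theorem
-- and R.recurrence therefore agree syntactically, see FieldRecurrence.
Lemma4 : Set₁
Lemma4 =
    (em : ExcludedMiddle 0ℓ) → let open Classical em in
    (d : ℕ) → 1 ℕ.≤ d →
    (Tˢ : Series) →
    Tˢ 0 ℂR.≈ ℂR.1# →
    Tˢ SeriesR.≈ SeriesR.1# SeriesR.+ zˢ SeriesR.* Tˢ SeriesR.^ (2 ℕ.* d) →
    let T = fromSeries Tˢ in
    (X : K) → SmallSolution d T X →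
    (Λ : K) → (∀ (k : ℤ) → 1# - Λ * X ^ᶻ k ≉ 0#) →
    Recurrence d (λ j →
      let u : ℤ → K
          u k = 1# - Λ * X ^ᶻ (k ℤ.+ j)
      in T * ((u (+ (d ℕ.+ 1)) * u (+ (3 ℕ.* d ℕ.+ 4)))
            / (u (+ (d ℕ.+ 3)) * u (+ (3 ℕ.* d ℕ.+ 2)))))

lemma4 : Lemma4
lemma4 em d 1≤d Tˢ _ T-equation X X-small Λ u≉0 =
  R.recurrence d 1≤d z (fromSeries Tˢ) (fromSeries-equation Tˢ (2 ℕ.* d) T-equation)
    X (Classical.SmallSolution.characteristic X-small) Λ u≉0
  where
  module R = KField em
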